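{- Let $E/F$ be an unramified cubic field extension of non-Archimedean local fields and let $R$ be an order of $E$. Let $s=S(R)$ and let $f=f(R)$ be the conductor exponent of $R$. Then $\#\overline{\mathrm{Cl}}(R)$ depends only on $s$, $f$ and $q$, and $$\#\overline{\mathrm{Cl}}(R)=\begin{cases} \dfrac{q^{\frac s2+2}+7q^{\frac s2+1}+4q^{\frac s2}+(2s-2)q^{\frac f2}(1-q)-8q^{\frac f2+1}-3q^{s-f+1}-q^{s-f}}{q^{\frac f2}(q-1)^2} & s \text{ even},\ f\text{ even};\\[1.2em] \dfrac{4q^{\frac s2+1}+7q^{\frac s2}+q^{\frac s2-1}+(2s-2)q^{\frac{f-1}2}(1-q)-8q^{\frac{f+1}2}-q^{s-f+1}-3q^{s-f}}{q^{\frac{f-1}2}(q-1)^2} & s\text{ even},\ f\text{ odd};\\[1.2em] \dfrac{4q^{\frac{s+3}2}+7q^{\frac{s+1}2}+q^{\frac{s-1}2}+(2s-2)q^{\frac f2}(1-q)-8q^{\frac f2+1}-3q^{s-f+1}-q^{s-f}}{q^{\frac f2}(q-1)^2} & s\text{ odd},\ f\text{ even};\\[1.2em] \dfrac{q^{\frac{s+3}2}+7q^{\frac{s+1}2}+4q^{\frac{s-1}2}+(2s-2)q^{\frac{f-1}2}(1-q)-8q^{\frac{f+1}2}-q^{s-f+1}-3q^{s-f}}{q^{\frac{f-1}2}(q-1)^2} & s\text{ odd},\ f\text{ odd}. \end{cases}$$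
   Context: $F$ is a non-Archimedean local field of any characteristic, with ring of integers $\mathfrak o$, uniformizer $\pi$, and residue field of cardinality $q$. $\mathcal O_E$ is the ring of integers of $E$. An order of $E$ is a subring $\mathcal O\subset E$ containing $\mathfrak o$, finitely generated as an $\mathfrak o$-module, with $F\mathcal O=E$. $S(R)$ is the length of $\mathcal O_E/R$ as an $\mathfrak o$-module. The conductor exponent $f(R)\ge0$ is defined by $\{a\in\mathcal O_E: a\mathcal O_E\subset R\}=\pi^{f(R)}\mathcal O_E$. A fractional $R$-ideal is a nonzero finitely generated $R$-submodule of $E$; $\overline{\mathrm{Cl}}(R)$ is the set (monoid) of fractional $R$-ideals modulo multiplication by $E^\times$. -}

module Defs where

open import Level using (Level; 0ℓ; _⊔_; suc)
open import Algebra.Bundles using (AbelianGroup; CommutativeRing; RawRing)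
open import Algebra.Module.Bundles using (LeftModule; RawLeftModule)
open import Algebra.Morphism.Structures using (IsRingHomomorphism; IsRingMonomorphism)
open import Algebra.Module.Morphism.Structures using (IsLeftModuleMonomorphism)
import Algebra.Definitions.RawMonoid as RawMonoidDefs
import Algebra.Module.Construct.TensorUnit as TensorUnit
import Algebra.Module.Morphism.LeftModuleMonomorphism as ModuleMono
import Algebra.Morphism.RingMonomorphism as RingMono
import Algebra.Module.Properties.LeftModule as LeftModuleProperties
import Algebra.Properties.AbelianGroup as AbelianGroupProperties
import Algebra.Properties.Group as GroupProperties
import Algebra.Properties.Ring as RingProperties
import Algebra.Properties.Semiring.Exp as Exp
open import Data.Fin.Base as Fin using (Fin; inject₁)
open import Data.Integer.Base as ℤ using (ℤ; +_; -[1+_]; 0ℤ; 1ℤ)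
import Data.Integer.Literals as ℤ-Literals
import Data.Integer.Properties as ℤ
open import Data.Maybe.Properties using (just-injective)
open import Data.Nat.Base as ℕ using (ℕ; NonZero; NonTrivial; parity)
import Data.Nat.Literals as ℕ-Literals
import Data.Nat.Properties as ℕ
open import Data.Parity.Base using (Parity; 0ℙ; 1ℙ)
open import Data.Product.Base using (Σ-syntax; ∃; ∃-syntax; _×_; _,_; proj₁; proj₂)
open import Data.Rational.Base using (ℚ)
import Data.Rational.Base as ℚ
open import Data.Rational.Literals as ℚ-Literals using (fromℤ)
open import Function.Base using (_∘_; id)
open import Function.Bundles using (Bijection; _⇔_; mk⇔; Equivalence)
open import Relation.Binary.Bundles using (Setoid)
open import Relation.Binary.PropositionalEquality as ≡ using (_≡_)
import Relation.Binary.Reasoning.Setoid as SetoidReasoning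
open import Relation.Binary.Construct.Add.Supremum.NonStrict ℤ._≤_
  using (_≤⁺_; [_]; _≤⊤⁺)
open import Relation.Nullary.Construct.Add.Supremum using (_⁺; ⊤⁺; [_])
open import Relation.Nullary.Negation.Core using (¬_; contradiction)
open import Relation.Unary using (Pred; _∈_; _∉_; _⊆_; _≐_)

HasCardinality : ∀ {a ℓ} → Setoid a ℓ → ℕ → Set (a ⊔ ℓ)
HasCardinality S n = Bijection (≡.setoid (Fin n)) S

record IsField {c ℓ} (K : CommutativeRing c ℓ) : Set (c ⊔ ℓ) where
  open CommutativeRing K
  field
    1≉0        : ¬ 1# ≈ 0#
    invertible : ∀ {x} → ¬ x ≈ 0# → ∃[ y ] x * y ≈ 1#

record IsSubring {c ℓ p} (A : CommutativeRing c ℓ)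
                 (P : Pred (CommutativeRing.Carrier A) p) : Set (c ⊔ ℓ ⊔ p) where
  open CommutativeRing A
  field
    resp     : ∀ {x y} → x ≈ y → x ∈ P → y ∈ P
    +-closed : ∀ {x y} → x ∈ P → y ∈ P → x + y ∈ P
    *-closed : ∀ {x y} → x ∈ P → y ∈ P → x * y ∈ P
    neg-closed : ∀ {x} → x ∈ P → - x ∈ P
    0-closed : 0# ∈ P
    1-closed : 1# ∈ P

module _ {c ℓ p} {A : CommutativeRing c ℓ} {P : Pred (CommutativeRing.Carrier A) p}
         (isSubring : IsSubring A P) where
  private
    module A = CommutativeRing A
    open IsSubring isSubring

    raw : RawRing (c ⊔ p) ℓ
    raw = record
      { Carrier = ∃ P
      ; _≈_     = λ x y → proj₁ x A.≈ proj₁ y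
      ; _+_     = λ x y → proj₁ x A.+ proj₁ y , +-closed (proj₂ x) (proj₂ y)
      ; _*_     = λ x y → proj₁ x A.* proj₁ y , *-closed (proj₂ x) (proj₂ y)
      ; -_      = λ x → A.- proj₁ x , neg-closed (proj₂ x)
      ; 0#      = A.0# , 0-closed
      ; 1#      = A.1# , 1-closed
      }

    inclusion-isMono : IsRingMonomorphism raw A.rawRing proj₁
    inclusion-isMono = record
      { isRingHomomorphism = record
        { isSemiringHomomorphism = record
          { isNearSemiringHomomorphism = record
            { +-isMonoidHomomorphism = record
              { isMagmaHomomorphism = record
                { isRelHomomorphism = record { cong = id }
                ; homo = λ _ _ → A.refl
                }
              ; ε-homo = A.refl
              }
            ; *-homo = λ _ _ → A.refl
            }
          ; 1#-homo = A.refl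
          }
        ; -‿homo = λ _ → A.refl
        }
      ; injective = id
      }

  subring : CommutativeRing (c ⊔ p) ℓ
  subring = record
    { RawRing raw
    ; isCommutativeRing = RingMono.isCommutativeRing inclusion-isMono A.isCommutativeRing
    }

  inclusion-isHom : IsRingHomomorphism (CommutativeRing.rawRing subring) A.rawRing proj₁
  inclusion-isHom = IsRingMonomorphism.isRingHomomorphism inclusion-isMono

algebraModule : ∀ {a ℓa b ℓb} (A : CommutativeRing a ℓa) (B : CommutativeRing b ℓb)
  {φ : CommutativeRing.Carrier A → CommutativeRing.Carrier B} →
  IsRingHomomorphism (CommutativeRing.rawRing A) (CommutativeRing.rawRing B) φ →
  LeftModule (CommutativeRing.ring A) b ℓb
algebraModule A B {φ} φ-hom = record
  { Carrierᴹ = B.Carrier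
  ; _≈ᴹ_     = B._≈_
  ; _+ᴹ_     = B._+_
  ; _*ₗ_     = λ a x → φ a B.* x
  ; 0ᴹ       = B.0#
  ; -ᴹ_      = B.-_
  ; isLeftModule = record
    { isLeftSemimodule = record
      { +ᴹ-isCommutativeMonoid = B.+-isCommutativeMonoid
      ; isPreleftSemimodule = record
        { *ₗ-cong      = λ a≈b x≈y → B.*-cong (φ.⟦⟧-cong a≈b) x≈y
        ; *ₗ-zeroˡ     = λ x → B.trans (B.*-congʳ φ.0#-homo) (B.zeroˡ x)
        ; *ₗ-distribʳ  = λ x a b → B.trans (B.*-congʳ (φ.+-homo a b)) (B.distribʳ x (φ a) (φ b))
        ; *ₗ-identityˡ = λ x → B.trans (B.*-congʳ φ.1#-homo) (B.*-identityˡ x)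
        ; *ₗ-assoc     = λ a b x → B.trans (B.*-congʳ (φ.*-homo a b)) (B.*-assoc (φ a) (φ b) x)
        ; *ₗ-zeroʳ     = λ a → B.zeroʳ (φ a)
        ; *ₗ-distribˡ  = λ a x y → B.distribˡ (φ a) x y
        }
      }
    ; -ᴹ‿cong    = B.-‿cong
    ; -ᴹ‿inverse = B.-‿inverse
    }
  }
  where
  module B = CommutativeRing B
  module φ = IsRingHomomorphism φ-hom

module _ {r ℓr m ℓm} {A : CommutativeRing r ℓr}
         (M : LeftModule (CommutativeRing.ring A) m ℓm) where
  open CommutativeRing A using (Carrier) renaming (_≈_ to _≈ₐ_; 0# to 0ₐ)
  open LeftModule M
  open RawMonoidDefs +ᴹ-rawMonoid using (sum)

  record IsSubmodule {p} (P : Pred Carrierᴹ p) : Set (r ⊔ m ⊔ ℓm ⊔ p) where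
    field
      resp      : ∀ {x y} → x ≈ᴹ y → x ∈ P → y ∈ P
      0ᴹ-closed : 0ᴹ ∈ P
      +ᴹ-closed : ∀ {x y} → x ∈ P → y ∈ P → x +ᴹ y ∈ P
      *ₗ-closed : ∀ a {x} → x ∈ P → a *ₗ x ∈ P

  linearCombination : ∀ {n} → (Fin n → Carrier) → (Fin n → Carrierᴹ) → Carrierᴹ
  linearCombination a x = sum (λ i → a i *ₗ x i)

  Span : ∀ {p} → Pred Carrierᴹ p → Pred Carrierᴹ (r ⊔ m ⊔ ℓm ⊔ p)
  Span P x = ∃[ n ] Σ[ g ∈ (Fin n → Carrierᴹ) ]
    (∀ i → g i ∈ P) × ∃[ a ] x ≈ᴹ linearCombination a g

  FinitelyGenerated : ∀ {p} → Pred Carrierᴹ p → Set (r ⊔ m ⊔ ℓm ⊔ p)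
  FinitelyGenerated P = ∃[ n ] Σ[ g ∈ (Fin n → Carrierᴹ) ]
    (∀ i → g i ∈ P) × (∀ x → x ∈ P → ∃[ a ] x ≈ᴹ linearCombination a g)

  IsBasis : ∀ {n} → (Fin n → Carrierᴹ) → Set (r ⊔ ℓr ⊔ m ⊔ ℓm)
  IsBasis b = (∀ x → ∃[ a ] x ≈ᴹ linearCombination a b)
            × (∀ a → linearCombination a b ≈ᴹ 0ᴹ → ∀ i → a i ≈ₐ 0ₐ)

  HasDimension : ℕ → Set (r ⊔ ℓr ⊔ m ⊔ ℓm)
  HasDimension n = Σ[ b ∈ (Fin n → Carrierᴹ) ] IsBasis b

  -- Chains N₀ ⊊ N₁ ⊊ ⋯ ⊊ Nₙ of submodules.  The predicates live at a level at
  -- which the span of any finite family can be formed, so that fixing the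
  -- level does not change which lengths occur.
  record StrictChain (n : ℕ) : Set (suc (r ⊔ m ⊔ ℓm)) where
    field
      N           : Fin (ℕ.suc n) → Pred Carrierᴹ (r ⊔ m ⊔ ℓm)
      isSubmodule : ∀ i → IsSubmodule (N i)
      increasing  : ∀ (i : Fin n) → N (inject₁ i) ⊆ N (Fin.suc i)
      strict      : ∀ (i : Fin n) → ∃[ x ] x ∈ N (Fin.suc i) × x ∉ N (inject₁ i)

  -- The length of a module is the supremum of the lengths of its strict chains.
  IsLength : ℕ → Set (suc (r ⊔ m ⊔ ℓm))
  IsLength n = StrictChain n × (∀ k → StrictChain k → k ℕ.≤ n)

  module _ {p} {P : Pred Carrierᴹ p} (isSubmodule : IsSubmodule P) where
    open IsSubmodule isSubmodule
    open LeftModuleProperties M using (-ᴹ-involutive; inverseˡ-uniqueᴹ)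
    private
      module AG = AbelianGroupProperties +ᴹ-abelianGroup
      module A = CommutativeRing A

      -1*x : ∀ x → (A.- A.1#) *ₗ x ≈ᴹ -ᴹ x
      -1*x x = inverseˡ-uniqueᴹ _ _ (begin
        (A.- A.1#) *ₗ x +ᴹ x              ≈⟨ +ᴹ-congˡ (≈ᴹ-sym (*ₗ-identityˡ x)) ⟩
        (A.- A.1#) *ₗ x +ᴹ A.1# *ₗ x      ≈⟨ ≈ᴹ-sym (*ₗ-distribʳ x _ _) ⟩
        (A.- A.1# A.+ A.1#) *ₗ x          ≈⟨ *ₗ-congʳ (A.-‿inverseˡ _) ⟩
        A.0# *ₗ x                         ≈⟨ *ₗ-zeroˡ x ⟩
        0ᴹ                                ∎)
        where open SetoidReasoning ≈ᴹ-setoid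

      neg-closed : ∀ {x} → x ∈ P → -ᴹ x ∈ P
      neg-closed {x} x∈P = resp (-1*x x) (*ₗ-closed _ x∈P)

      raw : RawLeftModule Carrier (m ⊔ p) ℓm
      raw = record
        { Carrierᴹ = ∃ P
        ; _≈ᴹ_     = λ x y → proj₁ x ≈ᴹ proj₁ y
        ; _+ᴹ_     = λ x y → proj₁ x +ᴹ proj₁ y , +ᴹ-closed (proj₂ x) (proj₂ y)
        ; _*ₗ_     = λ a x → a *ₗ proj₁ x , *ₗ-closed a (proj₂ x)
        ; 0ᴹ       = 0ᴹ , 0ᴹ-closed
        ; -ᴹ_      = λ x → -ᴹ proj₁ x , neg-closed (proj₂ x)
        }

      proj₁-isMono : IsLeftModuleMonomorphism raw (LeftModule.rawLeftModule M) proj₁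
      proj₁-isMono = record
        { isLeftModuleHomomorphism = record
          { +ᴹ-isGroupHomomorphism = record
            { isMonoidHomomorphism = record
              { isMagmaHomomorphism = record
                { isRelHomomorphism = record { cong = id }
                ; homo = λ _ _ → ≈ᴹ-refl
                }
              ; ε-homo = ≈ᴹ-refl
              }
            ; ⁻¹-homo = λ _ → ≈ᴹ-refl
            }
          ; *ₗ-homo = λ _ _ → ≈ᴹ-refl
          }
        ; injective = id
        }

    submodule : LeftModule (CommutativeRing.ring A) (m ⊔ p) ℓm
    submodule = record
      { RawLeftModule raw
      ; isLeftModule = ModuleMono.isLeftModule proj₁-isMono A.isRing isLeftModule
      }

    private
      infix 4 _∼_
      _∼_ : Carrierᴹ → Carrierᴹ → Set p
      x ∼ y = x +ᴹ -ᴹ y ∈ P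

      lift : ∀ {x y} → x ≈ᴹ y → x ∼ y
      lift {x} {y} x≈y = resp
        (≈ᴹ-sym (≈ᴹ-trans (+ᴹ-congʳ x≈y) (-ᴹ‿inverseʳ y))) 0ᴹ-closed

      ∼-sym : ∀ {x y} → x ∼ y → y ∼ x
      ∼-sym {x} {y} x∼y = resp (begin
        -ᴹ (x +ᴹ -ᴹ y)       ≈⟨ AG.⁻¹-∙-comm x (-ᴹ y) ⟨
        -ᴹ x +ᴹ -ᴹ (-ᴹ y)    ≈⟨ +ᴹ-congˡ (-ᴹ-involutive y) ⟩
        -ᴹ x +ᴹ y            ≈⟨ +ᴹ-comm _ _ ⟩
        y +ᴹ -ᴹ x            ∎) (neg-closed x∼y)
        where open SetoidReasoning ≈ᴹ-setoid

      ∼-trans : ∀ {x y z} → x ∼ y → y ∼ z → x ∼ z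
      ∼-trans {x} {y} {z} x∼y y∼z = resp (begin
        (x +ᴹ -ᴹ y) +ᴹ (y +ᴹ -ᴹ z)   ≈⟨ +ᴹ-assoc _ _ _ ⟩
        x +ᴹ (-ᴹ y +ᴹ (y +ᴹ -ᴹ z))   ≈⟨ +ᴹ-congˡ (≈ᴹ-sym (+ᴹ-assoc _ _ _)) ⟩
        x +ᴹ ((-ᴹ y +ᴹ y) +ᴹ -ᴹ z)   ≈⟨ +ᴹ-congˡ (+ᴹ-congʳ (-ᴹ‿inverseˡ y)) ⟩
        x +ᴹ (0ᴹ +ᴹ -ᴹ z)            ≈⟨ +ᴹ-congˡ (+ᴹ-identityˡ _) ⟩
        x +ᴹ -ᴹ z                    ∎) (+ᴹ-closed x∼y y∼z)
        where open SetoidReasoning ≈ᴹ-setoid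

      interchange : ∀ w x y z → (w +ᴹ x) +ᴹ (y +ᴹ z) ≈ᴹ (w +ᴹ y) +ᴹ (x +ᴹ z)
      interchange w x y z = begin
        (w +ᴹ x) +ᴹ (y +ᴹ z)   ≈⟨ +ᴹ-assoc _ _ _ ⟩
        w +ᴹ (x +ᴹ (y +ᴹ z))   ≈⟨ +ᴹ-congˡ (≈ᴹ-sym (+ᴹ-assoc _ _ _)) ⟩
        w +ᴹ ((x +ᴹ y) +ᴹ z)   ≈⟨ +ᴹ-congˡ (+ᴹ-congʳ (+ᴹ-comm _ _)) ⟩
        w +ᴹ ((y +ᴹ x) +ᴹ z)   ≈⟨ +ᴹ-congˡ (+ᴹ-assoc _ _ _) ⟩
        w +ᴹ (y +ᴹ (x +ᴹ z))   ≈⟨ +ᴹ-assoc _ _ _ ⟨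
        (w +ᴹ y) +ᴹ (x +ᴹ z)   ∎
        where open SetoidReasoning ≈ᴹ-setoid

      ∼-+-cong : ∀ {x y u v} → x ∼ y → u ∼ v → x +ᴹ u ∼ y +ᴹ v
      ∼-+-cong {x} {y} {u} {v} x∼y u∼v = resp (begin
        (x +ᴹ -ᴹ y) +ᴹ (u +ᴹ -ᴹ v)   ≈⟨ interchange _ _ _ _ ⟩
        (x +ᴹ u) +ᴹ (-ᴹ y +ᴹ -ᴹ v)   ≈⟨ +ᴹ-congˡ (AG.⁻¹-∙-comm y v) ⟩
        (x +ᴹ u) +ᴹ -ᴹ (y +ᴹ v)      ∎) (+ᴹ-closed x∼y u∼v)
        where open SetoidReasoning ≈ᴹ-setoid

      ∼-neg-cong : ∀ {x y} → x ∼ y → -ᴹ x ∼ -ᴹ y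
      ∼-neg-cong {x} {y} x∼y = resp (≈ᴹ-sym (AG.⁻¹-∙-comm x (-ᴹ y))) (neg-closed x∼y)

      *ₗ-neg : ∀ a x → a *ₗ (-ᴹ x) ≈ᴹ -ᴹ (a *ₗ x)
      *ₗ-neg a x = inverseˡ-uniqueᴹ _ _ (begin
        a *ₗ (-ᴹ x) +ᴹ a *ₗ x   ≈⟨ *ₗ-distribˡ a _ _ ⟨
        a *ₗ (-ᴹ x +ᴹ x)        ≈⟨ *ₗ-congˡ (-ᴹ‿inverseˡ x) ⟩
        a *ₗ 0ᴹ                 ≈⟨ *ₗ-zeroʳ a ⟩
        0ᴹ                      ∎)
        where open SetoidReasoning ≈ᴹ-setoid

      ∼-*ₗ-cong : ∀ {a b x y} → a ≈ₐ b → x ∼ y → a *ₗ x ∼ b *ₗ y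
      ∼-*ₗ-cong {a} {b} {x} {y} a≈b x∼y = resp (begin
        a *ₗ (x +ᴹ -ᴹ y)            ≈⟨ *ₗ-distribˡ a _ _ ⟩
        a *ₗ x +ᴹ a *ₗ (-ᴹ y)       ≈⟨ +ᴹ-congˡ (*ₗ-neg a y) ⟩
        a *ₗ x +ᴹ -ᴹ (a *ₗ y)       ≈⟨ +ᴹ-congˡ (-ᴹ‿cong (*ₗ-congʳ a≈b)) ⟩
        a *ₗ x +ᴹ -ᴹ (b *ₗ y)       ∎) (*ₗ-closed a x∼y)
        where open SetoidReasoning ≈ᴹ-setoid

    quotient : LeftModule (CommutativeRing.ring A) m p
    quotient = record
      { Carrierᴹ = Carrierᴹ
      ; _≈ᴹ_     = _∼_
      ; _+ᴹ_     = _+ᴹ_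
      ; _*ₗ_     = _*ₗ_
      ; 0ᴹ       = 0ᴹ
      ; -ᴹ_      = -ᴹ_
      ; isLeftModule = record
        { isLeftSemimodule = record
          { +ᴹ-isCommutativeMonoid = record
            { isMonoid = record
              { isSemigroup = record
                { isMagma = record
                  { isEquivalence = record
                    { refl = lift ≈ᴹ-refl ; sym = ∼-sym ; trans = ∼-trans }
                  ; ∙-cong = ∼-+-cong
                  }
                ; assoc = λ x y z → lift (+ᴹ-assoc x y z)
                }
              ; identity = (λ x → lift (+ᴹ-identityˡ x)) , (λ x → lift (+ᴹ-identityʳ x))
              }
            ; comm = λ x y → lift (+ᴹ-comm x y)
            }
          ; isPreleftSemimodule = record
            { *ₗ-cong      = ∼-*ₗ-cong
            ; *ₗ-zeroˡ     = λ x → lift (*ₗ-zeroˡ x)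
            ; *ₗ-distribʳ  = λ x a b → lift (*ₗ-distribʳ x a b)
            ; *ₗ-identityˡ = λ x → lift (*ₗ-identityˡ x)
            ; *ₗ-assoc     = λ a b x → lift (*ₗ-assoc a b x)
            ; *ₗ-zeroʳ     = λ a → lift (*ₗ-zeroʳ a)
            ; *ₗ-distribˡ  = λ a x y → lift (*ₗ-distribˡ a x y)
            }
          }
        ; -ᴹ‿cong    = ∼-neg-cong
        ; -ᴹ‿inverse = (λ x → lift (-ᴹ‿inverseˡ x)) , (λ x → lift (-ᴹ‿inverseʳ x))
        }
      }

infixl 6 _+⁺_

_+⁺_ : ℤ ⁺ → ℤ ⁺ → ℤ ⁺
[ m ] +⁺ [ n ] = [ m ℤ.+ n ]
[ m ] +⁺ ⊤⁺    = ⊤⁺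
⊤⁺    +⁺ _     = ⊤⁺

-- The valuation is additive and normalised: v 0 = ∞ and v π = 1.
record DiscretelyValuedField c ℓ : Set (suc (c ⊔ ℓ)) where
  field
    commutativeRing : CommutativeRing c ℓ
    isField         : IsField commutativeRing
  open CommutativeRing commutativeRing public
  open IsField isField public
  field
    v      : Carrier → ℤ ⁺
    v-cong : ∀ {x y} → x ≈ y → v x ≡ v y
    v-∞    : ∀ {x} → v x ≡ ⊤⁺ ⇔ x ≈ 0#
    v-*    : ∀ x y → v (x * y) ≡ v x +⁺ v y
    v-+    : ∀ {m x y} → m ≤⁺ v x → m ≤⁺ v y → m ≤⁺ v (x + y)
    π      : Carrier
    v-π    : v π ≡ [ 1ℤ ]

  Integral : Pred Carrier 0ℓ
  Integral x = [ 0ℤ ] ≤⁺ v x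

  v-1# : v 1# ≡ [ 0ℤ ]
  v-1# with v 1# in eq | v-* 1# 1#
  ... | ⊤⁺ | _ = contradiction (Equivalence.to v-∞ eq) 1≉0
  ... | [ a ] | eq′ = ≡.cong [_] (identityʳ-unique a a (≡.sym a≡a+a))
    where
    open GroupProperties (AbelianGroup.group ℤ.+-0-abelianGroup) using (identityʳ-unique)
    a≡a+a : a ≡ a ℤ.+ a
    a≡a+a = just-injective (≡.trans (≡.sym eq) (≡.trans (v-cong (sym (*-identityˡ 1#))) eq′))

  private
    a+a≡0⇒a≡0 : ∀ a → a ℤ.+ a ≡ 0ℤ → a ≡ 0ℤ
    a+a≡0⇒a≡0 (+ ℕ.zero) _ = ≡.refl

    v-[-1] : v (- 1#) ≡ [ 0ℤ ]
    v-[-1] with v (- 1#) | ≡.trans (≡.sym (v-* (- 1#) (- 1#))) (v-cong (-1*-1≈1))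
      where
      -1*-1≈1 : - 1# * - 1# ≈ 1#
      -1*-1≈1 = trans (-1*x≈-x (- 1#)) (-‿involutive 1#)
        where open RingProperties ring
    ... | [ a ] | eq = ≡.cong [_] (a+a≡0⇒a≡0 a (just-injective (≡.trans eq v-1#)))
    ... | ⊤⁺ | eq with () ← ≡.trans eq v-1#

    v-*-≥ : ∀ {m n x y} → [ m ] ≤⁺ v x → [ n ] ≤⁺ v y → [ m ℤ.+ n ] ≤⁺ v (x * y)
    v-*-≥ {x = x} {y} m≤ n≤ rewrite v-* x y with v x | v y | m≤ | n≤
    ... | [ _ ] | [ _ ] | [ p ] | [ q ] = [ ℤ.+-mono-≤ p q ]
    ... | [ _ ] | ⊤⁺    | _     | _     = _ ≤⊤⁺
    ... | ⊤⁺    | _     | _     | _     = _ ≤⊤⁺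

    v-neg-≥ : ∀ {m x} → [ m ] ≤⁺ v x → [ m ] ≤⁺ v (- x)
    v-neg-≥ {m} {x} m≤ = ≡.subst₂ _≤⁺_
      (≡.cong [_] (ℤ.+-identityˡ m)) (v-cong (RingProperties.-1*x≈-x ring x))
      (v-*-≥ (≡.subst ([ 0ℤ ] ≤⁺_) (≡.sym v-[-1]) [ ℤ.≤-refl ]) m≤)

    v-0-≥ : ∀ {m} → m ≤⁺ v 0#
    v-0-≥ rewrite Equivalence.from v-∞ refl = _ ≤⊤⁺

  integral-isSubring : IsSubring commutativeRing Integral
  integral-isSubring = record
    { resp       = λ x≈y → ≡.subst ([ 0ℤ ] ≤⁺_) (v-cong x≈y)
    ; +-closed   = v-+
    ; *-closed   = v-*-≥
    ; neg-closed = v-neg-≥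
    ; 0-closed   = v-0-≥
    ; 1-closed   = ≡.subst ([ 0ℤ ] ≤⁺_) (≡.sym v-1#) [ ℤ.≤-refl ]
    }

  𝒪 : CommutativeRing c ℓ
  𝒪 = subring integral-isSubring

  Maximal : Pred (CommutativeRing.Carrier 𝒪) 0ℓ
  Maximal x = [ 1ℤ ] ≤⁺ v (proj₁ x)

  maximal-isSubmodule : IsSubmodule {A = 𝒪} (TensorUnit.leftModule {R = CommutativeRing.ring 𝒪}) Maximal
  maximal-isSubmodule = record
    { resp      = λ x≈y → ≡.subst ([ 1ℤ ] ≤⁺_) (v-cong x≈y)
    ; 0ᴹ-closed = v-0-≥
    ; +ᴹ-closed = v-+
    ; *ₗ-closed = λ a → v-*-≥ (proj₂ a)
    }

  residueField : Setoid c 0ℓ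
  residueField = LeftModule.≈ᴹ-setoid (quotient _ maximal-isSubmodule)

  IsCauchy : (ℕ → Carrier) → Set
  IsCauchy u = ∀ (m : ℤ) → ∃[ k ] ∀ i j → k ℕ.≤ i → k ℕ.≤ j → [ m ] ≤⁺ v (u i - u j)

  ConvergesTo : (ℕ → Carrier) → Carrier → Set
  ConvergesTo u x = ∀ (m : ℤ) → ∃[ k ] ∀ i → k ℕ.≤ i → [ m ] ≤⁺ v (u i - x)

-- Non-Archimedean local fields of any characteristic, described as the
-- complete discretely valued fields with finite residue field.
record LocalField c ℓ : Set (suc (c ⊔ ℓ)) where
  field
    discretelyValuedField : DiscretelyValuedField c ℓ
  open DiscretelyValuedField discretelyValuedField public
  field
    complete    : ∀ u → IsCauchy u → ∃[ x ] ConvergesTo u x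
    q           : ℕ
    residueCard : HasCardinality residueField q

  q-nonTrivial : NonTrivial q
  q-nonTrivial = go q residueCard
    where
    0̄ 1̄ : Setoid.Carrier residueField
    0̄ = CommutativeRing.0# 𝒪
    1̄ = CommutativeRing.1# 𝒪

    1̄≉0̄ : ¬ Setoid._≈_ residueField 1̄ 0̄
    1̄≉0̄ 1∼0 with ≡.subst ([ 1ℤ ] ≤⁺_) (≡.trans (v-cong 1-0≈1) v-1#) 1∼0
      where
      1-0≈1 : 1# + - 0# ≈ 1#
      1-0≈1 = trans (+-congˡ (RingProperties.-0#≈0# ring)) (+-identityʳ 1#)
    ... | [ ℤ.+≤+ () ]

    go : ∀ n → HasCardinality residueField n → NonTrivial n
    go ℕ.zero b with () ← proj₁ (Bijection.surjective b 1̄)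
    go (ℕ.suc ℕ.zero) b = contradiction 1∼0 1̄≉0̄
      where
      hit : ∀ x → Setoid._≈_ residueField (Bijection.to b Fin.zero) x
      hit x with Bijection.surjective b x
      ... | Fin.zero , eq = eq ≡.refl
      1∼0 : Setoid._≈_ residueField 1̄ 0̄
      1∼0 = Setoid.trans residueField {1̄} {Bijection.to b Fin.zero} {0̄}
        (Setoid.sym residueField {Bijection.to b Fin.zero} {1̄} (hit 1̄)) (hit 0̄)
    go (ℕ.suc (ℕ.suc n)) b = _

record FiniteExtension {c₁ ℓ₁ c₂ ℓ₂} (F : LocalField c₁ ℓ₁) (E : LocalField c₂ ℓ₂)
                       : Set (c₁ ⊔ ℓ₁ ⊔ c₂ ⊔ ℓ₂) where
  private
    module F = LocalField F
    module E = LocalField E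
  field
    ι       : F.Carrier → E.Carrier
    ι-isHom : IsRingHomomorphism F.rawRing E.rawRing ι

  asVectorSpace : LeftModule F.ring c₂ ℓ₂
  asVectorSpace = algebraModule F.commutativeRing E.commutativeRing ι-isHom

  field
    degree       : ℕ
    hasDimension : HasDimension {A = F.commutativeRing} asVectorSpace degree

    -- On F the normalised valuation of E is e times that of F.
    e            : ℕ
    ramification : ∀ {x m} → F.v x ≡ [ m ] → E.v (ι x) ≡ [ + e ℤ.* m ]

  IsCubic : Set
  IsCubic = degree ≡ 3

  -- The residue extension is separable because the residue fields are finite,
  -- so the ramification index alone decides whether E/F is unramified.
  IsUnramified : Set
  IsUnramified = e ≡ 1

module _ {c₁ ℓ₁ c₂ ℓ₂} {F : LocalField c₁ ℓ₁} {E : LocalField c₂ ℓ₂}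
         (E/F : FiniteExtension F E) where
  private
    module F = LocalField F
    module E = LocalField E
  open FiniteExtension E/F
  open Exp E.semiring using (_^_)

  private
    module ι = IsRingHomomorphism ι-isHom

    integral-preserved : ∀ {x} → x ∈ F.Integral → ι x ∈ E.Integral
    integral-preserved {x} 0≤vx with F.v x in eq | 0≤vx
    ... | [ m ] | [ 0≤m ] rewrite ramification eq =
      [ ≡.subst (ℤ._≤ + e ℤ.* m) (ℤ.*-zeroʳ (+ e)) (ℤ.*-monoˡ-≤-nonNeg (+ e) 0≤m) ]
    ... | ⊤⁺ | _ rewrite E.v-cong (E.trans (ι.⟦⟧-cong (Equivalence.to F.v-∞ eq)) ι.0#-homo)
                       | Equivalence.from E.v-∞ E.refl = _ ≤⊤⁺

  𝔬-to-E-isHom : IsRingHomomorphism (CommutativeRing.rawRing F.𝒪) E.rawRing (ι ∘ proj₁)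
  𝔬-to-E-isHom = isRingHomomorphism E.trans (inclusion-isHom F.integral-isSubring) ι-isHom
    where open import Algebra.Morphism.Construct.Composition using (isRingHomomorphism)

  E-over-𝔬 : LeftModule (CommutativeRing.ring F.𝒪) c₂ ℓ₂
  E-over-𝔬 = algebraModule F.𝒪 E.commutativeRing 𝔬-to-E-isHom

  integral-isSubmodule : IsSubmodule {A = F.𝒪} E-over-𝔬 E.Integral
  integral-isSubmodule = record
    { resp      = resp
    ; 0ᴹ-closed = 0-closed
    ; +ᴹ-closed = +-closed
    ; *ₗ-closed = λ a → *-closed (integral-preserved (proj₂ a))
    }
    where open IsSubring E.integral-isSubring

  𝒪E-over-𝔬 : LeftModule (CommutativeRing.ring F.𝒪) c₂ ℓ₂
  𝒪E-over-𝔬 = submodule {A = F.𝒪} E-over-𝔬 integral-isSubmodule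

  record IsOrder {p} (R : Pred E.Carrier p) : Set (c₁ ⊔ ℓ₁ ⊔ c₂ ⊔ ℓ₂ ⊔ p) where
    field
      isSubring         : IsSubring E.commutativeRing R
      contains-𝔬        : ∀ {x} → x ∈ F.Integral → ι x ∈ R
      finitelyGenerated : FinitelyGenerated {A = F.𝒪} E-over-𝔬 R
      spans             : ∀ x → x ∈ Span {A = F.commutativeRing} asVectorSpace R

  module _ {p} {R : Pred E.Carrier p} (isOrder : IsOrder R) where
    open IsOrder isOrder
    private
      module R = IsSubring isSubring

      R-ring : CommutativeRing (c₂ ⊔ p) ℓ₂
      R-ring = subring isSubring

    order-isSubmodule : IsSubmodule {A = F.𝒪} 𝒪E-over-𝔬 (λ x → proj₁ x ∈ R)
    order-isSubmodule = record
      { resp      = R.resp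
      ; 0ᴹ-closed = R.0-closed
      ; +ᴹ-closed = R.+-closed
      ; *ₗ-closed = λ a → R.*-closed (contains-𝔬 (proj₂ a))
      }

    -- S(R), the 𝔬-length of 𝒪E/R.  An order is contained in 𝒪E, so restricting
    -- its membership predicate to 𝒪E loses nothing.
    IsS : ℕ → Set (suc (c₁ ⊔ c₂ ⊔ p))
    IsS = IsLength {A = F.𝒪} (quotient {A = F.𝒪} 𝒪E-over-𝔬 order-isSubmodule)

    -- f(R), defined by {a ∈ 𝒪E : a𝒪E ⊆ R} = π^f 𝒪E.
    IsConductorExponent : ℕ → Set (c₂ ⊔ ℓ₂ ⊔ p)
    IsConductorExponent f =
      (λ a → a ∈ E.Integral × (∀ b → b ∈ E.Integral → a E.* b ∈ R))
      ≐ (λ a → ∃[ b ] b ∈ E.Integral × a E.≈ (ι F.π ^ f) E.* b)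

    E-over-R : LeftModule (CommutativeRing.ring R-ring) c₂ ℓ₂
    E-over-R = algebraModule R-ring E.commutativeRing (inclusion-isHom isSubring)

    record FractionalIdeal : Set (suc (c₂ ⊔ ℓ₂ ⊔ p)) where
      field
        ideal             : Pred E.Carrier (c₂ ⊔ ℓ₂ ⊔ p)
        isSubmodule       : IsSubmodule {A = R-ring} E-over-R ideal
        finitelyGenerated : FinitelyGenerated {A = R-ring} E-over-R ideal
        nonzero           : ∃[ x ] x ∈ ideal × ¬ x E.≈ E.0#

    open FractionalIdeal using (ideal)

    scale : E.Carrier → Pred E.Carrier (c₂ ⊔ ℓ₂ ⊔ p) → Pred E.Carrier (c₂ ⊔ ℓ₂ ⊔ p)
    scale t I x = ∃[ y ] y ∈ I × x E.≈ t E.* y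

    Homothetic : FractionalIdeal → FractionalIdeal → Set (c₂ ⊔ ℓ₂ ⊔ p)
    Homothetic I J = ∃[ t ] ¬ t E.≈ E.0# × ideal J ≐ scale t (ideal I)

    private
      homothetic-refl : ∀ {I} → Homothetic I I
      homothetic-refl {I} = E.1# , E.1≉0
        , (λ {x} x∈I → x , x∈I , E.sym (E.*-identityˡ x))
        , (λ { (y , y∈I , x≈) → IsSubmodule.resp (FractionalIdeal.isSubmodule I)
                 (E.sym (E.trans x≈ (E.*-identityˡ y))) y∈I })

      inverse-cancel : ∀ {t u} → t E.* u E.≈ E.1# → ∀ y → u E.* (t E.* y) E.≈ y
      inverse-cancel {t} {u} tu≈1 y = begin
        u E.* (t E.* y)   ≈⟨ E.*-assoc u t y ⟨
        (u E.* t) E.* y   ≈⟨ E.*-congʳ (E.*-comm u t) ⟩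
        (t E.* u) E.* y   ≈⟨ E.*-congʳ tu≈1 ⟩
        E.1# E.* y        ≈⟨ E.*-identityˡ y ⟩
        y                 ∎
        where open SetoidReasoning E.setoid

      homothetic-sym : ∀ {I J} → Homothetic I J → Homothetic J I
      homothetic-sym {I} {J} (t , t≉0 , J⊆tI , tI⊆J) with E.invertible t≉0
      ... | u , tu≈1 = u
        , (λ u≈0 → E.1≉0 (E.trans (E.sym tu≈1) (E.trans (E.*-congˡ u≈0) (E.zeroʳ t))))
        , (λ {x} x∈I → t E.* x , tI⊆J (x , x∈I , E.refl) , E.sym (inverse-cancel tu≈1 x))
        , (λ { (y , y∈J , x≈uy) → let (z , z∈I , y≈tz) = J⊆tI y∈J in
             IsSubmodule.resp (FractionalIdeal.isSubmodule I)
               (E.sym (E.trans x≈uy (E.trans (E.*-congˡ y≈tz) (inverse-cancel tu≈1 z)))) z∈I })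

      homothetic-trans : ∀ {I J K} → Homothetic I J → Homothetic J K → Homothetic I K
      homothetic-trans (t , t≉0 , J⊆tI , tI⊆J) (u , u≉0 , K⊆uJ , uJ⊆K) = u E.* t
        , (λ ut≈0 → t≉0 (cancel ut≈0))
        , (λ x∈K → let (y , y∈J , x≈uy) = K⊆uJ x∈K
                       (z , z∈I , y≈tz) = J⊆tI y∈J in
             z , z∈I , E.trans x≈uy (E.trans (E.*-congˡ y≈tz) (E.sym (E.*-assoc u t z))))
        , (λ { (z , z∈I , x≈) → uJ⊆K (t E.* z , tI⊆J (z , z∈I , E.refl)
                                      , E.trans x≈ (E.*-assoc u t z)) })
        where
        cancel : u E.* t E.≈ E.0# → t E.≈ E.0#
        cancel ut≈0 with E.invertible u≉0
        ... | w , uw≈1 = E.trans (E.sym (inverse-cancel uw≈1 t))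
                                 (E.trans (E.*-congˡ ut≈0) (E.zeroʳ w))

    Cl̄ : Setoid (suc (c₂ ⊔ ℓ₂ ⊔ p)) (c₂ ⊔ ℓ₂ ⊔ p)
    Cl̄ = record
      { Carrier = FractionalIdeal
      ; _≈_     = Homothetic
      ; isEquivalence = record
        { refl  = λ {I} → homothetic-refl {I}
        ; sym   = λ {I} {J} → homothetic-sym {I} {J}
        ; trans = λ {I} {J} {K} → homothetic-trans {I} {J} {K}
        }
      }

module ClassNumberFormula (q : ℕ) .{{_ : NonTrivial q}} where
  open import Agda.Builtin.FromNat using (Number; fromNat)
  open import Data.Unit.Base using (tt)
  private
    instance
      number-ℕ : Number ℕ
      number-ℕ = ℕ-Literals.number

      number-ℤ : Number ℤ
      number-ℤ = ℤ-Literals.number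

      number-ℚ : Number ℚ
      number-ℚ = ℚ-Literals.number

      q≢0 : NonZero q
      q≢0 = ℕ.nonTrivial⇒nonZero q

      q∸1≢0 : NonZero (q ℕ.∸ 1)
      q∸1≢0 = ℕ.>-nonZero (ℕ.m<n⇒0<n∸m (ℕ.nonTrivial⇒n>1 q))

  q^ : ℤ → ℚ
  q^ (+ n)    = fromℤ (+ (q ℕ.^ n))
  q^ -[1+ n ] = 1ℤ ℚ./ (q ℕ.^ ℕ.suc n)
    where instance _ = ℕ.m^n≢0 q (ℕ.suc n)

  -- Binds more loosely than +, so it divides the whole numerator before it.
  infixl 5 _/[q^_·[q-1]²]
  _/[q^_·[q-1]²] : ℚ → ℕ → ℚ
  x /[q^ n ·[q-1]²] = x ℚ.* (1ℤ ℚ./ (q ℕ.^ n ℕ.* (q ℕ.∸ 1) ℕ.^ 2))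
    where
    instance
      _ = ℕ.m^n≢0 q n
      _ = ℕ.m^n≢0 (q ℕ.∸ 1) 2
      _ = ℕ.m*n≢0 (q ℕ.^ n) ((q ℕ.∸ 1) ℕ.^ 2)

  -- The floor divisions by 2 are exact in the parity case in which they occur.
  -- Exponents are integers, so that s/2 - 1 and s - f are not truncated.
  classNumber : (s f : ℕ) → ℚ
  classNumber s f = byParity (parity s) (parity f)
    where
    open import Data.Integer.Base using () renaming (_+_ to _⊕_; _-_ to _⊖_; _/ℕ_ to _÷_)
    open import Data.Rational.Base using (_+_; _-_; _*_)
    S F : ℤ
    S = + s
    F = + f
    Q : ℚ
    Q = fromℤ (+ q)

    byParity : Parity → Parity → ℚ
    byParity 0ℙ 0ℙ =
      q^ (S ÷ 2 ⊕ 2) + 7 * q^ (S ÷ 2 ⊕ 1) + 4 * q^ (S ÷ 2)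
        + (2 * fromℤ S - 2) * q^ (F ÷ 2) * (1 - Q)
        - 8 * q^ (F ÷ 2 ⊕ 1) - 3 * q^ (S ⊖ F ⊕ 1) - q^ (S ⊖ F)
      /[q^ f ℕ./ 2 ·[q-1]²]
    byParity 0ℙ 1ℙ =
      4 * q^ (S ÷ 2 ⊕ 1) + 7 * q^ (S ÷ 2) + q^ (S ÷ 2 ⊖ 1)
        + (2 * fromℤ S - 2) * q^ ((F ⊖ 1) ÷ 2) * (1 - Q)
        - 8 * q^ ((F ⊕ 1) ÷ 2) - q^ (S ⊖ F ⊕ 1) - 3 * q^ (S ⊖ F)
      /[q^ (f ℕ.∸ 1) ℕ./ 2 ·[q-1]²]
    byParity 1ℙ 0ℙ =
      4 * q^ ((S ⊕ 3) ÷ 2) + 7 * q^ ((S ⊕ 1) ÷ 2) + q^ ((S ⊖ 1) ÷ 2)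
        + (2 * fromℤ S - 2) * q^ (F ÷ 2) * (1 - Q)
        - 8 * q^ (F ÷ 2 ⊕ 1) - 3 * q^ (S ⊖ F ⊕ 1) - q^ (S ⊖ F)
      /[q^ f ℕ./ 2 ·[q-1]²]
    byParity 1ℙ 1ℙ =
      q^ ((S ⊕ 3) ÷ 2) + 7 * q^ ((S ⊕ 1) ÷ 2) + 4 * q^ ((S ⊖ 1) ÷ 2)
        + (2 * fromℤ S - 2) * q^ ((F ⊖ 1) ÷ 2) * (1 - Q)
        - 8 * q^ ((F ⊕ 1) ÷ 2) - q^ (S ⊖ F ⊕ 1) - 3 * q^ (S ⊖ F)
      /[q^ (f ℕ.∸ 1) ℕ./ 2 ·[q-1]²]

-- Write O and 𝔬 for the rings of integers of E and F.  Every ideal class has a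
-- member that contains 1 and lies in O, and such a lattice has the form
-- Lat i j w = 𝔬 + 𝔬 ϖⁱ w + ϖʲ O with i ≤ j and w independent of 1 modulo ϖ.  In
-- particular R = Lat a b y, where b = f, a = s − f and a ≤ b ≤ 2a.  The residue
-- field of E has no quadratic subfield over that of F, so that 1, w, w² is an
-- 𝔬-basis of O.  It follows that, with m = min (i, j − i),
--   * Lat i j w is stable under R exactly when j ∸ a ≤ m, j ≤ b and w is
--     congruent to y as a point of P¹(𝔬/ϖ^(j ∸ a));
--   * its class determines i, j and the point w of P¹(𝔬/ϖᵐ), and is determined
--     by them.
-- With T(n) = Σ_{j<n} Σ_{i≤j} q^min(i, j − i) the number of these data is
-- T(a + 1) + T(a ∸ 1) + T(a) − T(2a − b).

module Submission where

open import Defs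
open import Level using (Level; 0ℓ; _⊔_; Lift; lift; lower) renaming (suc to lsuc)
open import Algebra.Bundles using (AbelianGroup; CommutativeRing)
open import Algebra.Morphism.Structures using (IsRingHomomorphism)
import Algebra.Properties.Group as GroupProperties
import Algebra.Properties.Ring as RingProperties
import Algebra.Solver.Ring as RingSolver
open import Algebra.Solver.Ring.AlmostCommutativeRing
  using (fromCommutativeRing; _-Raw-AlmostCommutative⟶_)
open import Data.Empty using (⊥; ⊥-elim)
open import Data.Fin.Base as Fin using (Fin; toℕ)
open import Data.Fin.Patterns using (0F; 1F; 2F; 3F)
import Data.Fin.Properties as Fin
open import Data.Integer.Base as ℤ using (ℤ; +_; -[1+_]; 0ℤ; 1ℤ)
import Data.Integer.Properties as ℤ
open import Data.Maybe.Base as Maybe using (Maybe)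
open import Data.Maybe.Properties using (just-injective)
open import Data.Nat.Base as ℕ using (ℕ; zero; suc; z≤n; s≤s; _∸_; _⊓_)
open import Data.Nat.DivMod using (m/n≡1+[m∸n]/n)
import Data.Nat.Properties as ℕ
open import Data.Parity.Base using (0ℙ; 1ℙ)
open import Data.Product.Base using (Σ-syntax; ∃; ∃₂; ∃-syntax; _×_; _,_; proj₁; proj₂)
open import Data.Rational.Base as ℚ using (ℚ; toℚᵘ)
open import Data.Rational.Literals using (fromℤ)
import Data.Rational.Properties as ℚ
open import Data.Rational.Unnormalised.Base using (mkℚᵘ; *≡*)
import Data.Rational.Unnormalised.Properties as ℚᵘ
open import Data.Sum.Base using (_⊎_; inj₁; inj₂; [_,_]′)
open import Data.Sum.Function.Propositional using (_⊎-↔_)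
open import Function.Base using (_∘_)
open import Function.Bundles using (Bijection; _↔_; mk↔ₛ′; Inverse; Equivalence)
open import Function.Construct.Composition using (_↔-∘_)
open import Relation.Binary.Bundles using (Setoid)
open import Relation.Binary.Construct.Add.Supremum.NonStrict ℤ._≤_
  using (_≤⁺_; [_]; _≤⊤⁺; ≤⁺-trans; ≤⁺-dec; ≤⁺-total; ≤⁺-reflexive-≡)
open import Relation.Binary.PropositionalEquality as ≡ using (_≡_; _≢_)
import Relation.Binary.Reasoning.Setoid as SetoidReasoning
import Relation.Binary.Reflection as Reflection
open import Relation.Nullary using (¬_; Dec; yes; no; contradiction)
open import Relation.Nullary.Construct.Add.Supremum using (⊤⁺; [_])
open import Relation.Nullary.Decidable
  using (map′; _×-dec_; ¬?; decidable-stable; True; toWitness; fromWitness)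
open import Relation.Unary using (Pred; _∈_; _∉_; _⊆_; _≐_)

-- Three obstacles shape the proof. Ideals, orders and members of chains are arbitrary predicates,
-- whereas finding i, j and w needs decidable membership. It comes from finite generation: a lattice
-- that contains ϖᶠ O is known modulo ϖᶠ, so adjoining a generator to a decidable lattice is a
-- search among finitely many coefficients. Being unramified is given as ramification index 1, so
-- the residue degree has to be derived. If O were 𝔬 + 𝔬 x modulo ϖ, then Nakayama's lemma, applied
-- to the generators of R, would put R into 𝔬 + 𝔬 x, which cannot span E. The exponent m = min (i, j
-- - i) has two sources. For a homothety from Lat i j w to Lat i j w′ the product of ϖⁱ w and ϖⁱ w′
-- is an error in ϖ²ⁱ O, and the lattice itself is blind to ϖʲ O; division by ϖⁱ leaves the
-- precisions i and j - i. Conversely, changing w modulo ϖʲ⁻ⁱ does not change the lattice, and a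
-- change by ϖⁱ t is undone by a Möbius transformation with coefficients in 𝔬, read off from a
-- linear relation between 1, w, t and a product.

-- Equations in commutative rings.

-- The coefficients are integers because cancellation is undecidable in an abstract ring.
module IntegerSolver {c ℓ} (R : CommutativeRing c ℓ) where
  open CommutativeRing R
  open RingProperties ring using (-‿involutive; -‿distribˡ-*; -‿distribʳ-*; -0#≈0#; -‿+-comm)
  open import Algebra.Properties.Semiring.Mult.TCOptimised semiring
    using (×1-homo-*; ×-homo-+; 1+×) renaming (_×_ to _·_)
  open SetoidReasoning setoid

  private
    fromInt : ℤ → Carrier
    fromInt (+ n)    = n · 1#
    fromInt -[1+ n ] = - (suc n · 1#)

    fromInt-neg : ∀ i → fromInt (ℤ.- i) ≈ - fromInt i
    fromInt-neg (+ zero)  = sym -0#≈0#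
    fromInt-neg (+ suc n) = refl
    fromInt-neg -[1+ n ]  = sym (-‿involutive _)

    fromInt-⊖ : ∀ m n → fromInt (m ℤ.⊖ n) ≈ m · 1# - n · 1#
    fromInt-⊖ zero    zero    = sym (-‿inverseʳ _)
    fromInt-⊖ (suc m) zero    = sym (trans (+-congˡ -0#≈0#) (+-identityʳ _))
    fromInt-⊖ zero    (suc n) = sym (+-identityˡ _)
    fromInt-⊖ (suc m) (suc n) rewrite ℤ.[1+m]⊖[1+n]≡m⊖n m n = begin
      fromInt (m ℤ.⊖ n)                      ≈⟨ fromInt-⊖ m n ⟩
      a - b                                  ≈⟨ +-congʳ (+-identityˡ a) ⟨
      (0# + a) - b                           ≈⟨ +-congʳ (+-congʳ (-‿inverseʳ 1#)) ⟨
      ((1# - 1#) + a) - b                    ≈⟨ +-congʳ (+-assoc _ _ _) ⟩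
      (1# + (- 1# + a)) - b                  ≈⟨ +-congʳ (+-congˡ (+-comm _ _)) ⟩
      (1# + (a - 1#)) - b                    ≈⟨ +-congʳ (+-assoc _ _ _) ⟨
      ((1# + a) - 1#) - b                    ≈⟨ +-assoc _ _ _ ⟩
      (1# + a) + (- 1# - b)                  ≈⟨ +-congˡ (-‿+-comm 1# b) ⟩
      (1# + a) - (1# + b)                    ≈⟨ +-cong (1+× m 1#) (-‿cong (1+× n 1#)) ⟨
      suc m · 1# - suc n · 1#                ∎
      where
      a b : Carrier
      a = m · 1#
      b = n · 1#

    fromInt-+ : ∀ i j → fromInt (i ℤ.+ j) ≈ fromInt i + fromInt j
    fromInt-+ (+ m)    (+ n)    = ×-homo-+ 1# m n
    fromInt-+ (+ m)    -[1+ n ] = fromInt-⊖ m (suc n)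
    fromInt-+ -[1+ m ] (+ n)    = trans (fromInt-⊖ n (suc m)) (+-comm _ _)
    fromInt-+ -[1+ m ] -[1+ n ] = begin
      - (suc (suc (m ℕ.+ n)) · 1#)             ≡⟨ ≡.cong (λ k → - (k · 1#)) (ℕ.+-suc (suc m) n) ⟨
      - ((suc m ℕ.+ suc n) · 1#)               ≈⟨ -‿cong (×-homo-+ 1# (suc m) (suc n)) ⟩
      - (suc m · 1# + suc n · 1#)              ≈⟨ -‿+-comm _ _ ⟨
      - (suc m · 1#) - suc n · 1#              ∎

    fromInt-+*ʳ : ∀ m j → fromInt (+ m ℤ.* j) ≈ fromInt (+ m) * fromInt j
    fromInt-+*ʳ m (+ n) = trans (reflexive (≡.cong fromInt (≡.sym (ℤ.pos-* m n)))) (×1-homo-* m n)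
    fromInt-+*ʳ m -[1+ n ] = begin
      fromInt (+ m ℤ.* -[1+ n ])              ≡⟨ ≡.cong fromInt (ℤ.neg-distribʳ-* (+ m) (+ suc n)) ⟨
      fromInt (ℤ.- (+ m ℤ.* + suc n))         ≈⟨ fromInt-neg (+ m ℤ.* + suc n) ⟩
      - fromInt (+ m ℤ.* + suc n)             ≈⟨ -‿cong (fromInt-+*ʳ m (+ suc n)) ⟩
      - (fromInt (+ m) * fromInt (+ suc n))   ≈⟨ -‿distribʳ-* _ _ ⟩
      fromInt (+ m) * fromInt -[1+ n ]        ∎

    fromInt-* : ∀ i j → fromInt (i ℤ.* j) ≈ fromInt i * fromInt j
    fromInt-* (+ m)    j = fromInt-+*ʳ m j
    fromInt-* -[1+ m ] j = begin
      fromInt (-[1+ m ] ℤ.* j)                ≡⟨ ≡.cong fromInt (ℤ.neg-distribˡ-* (+ suc m) j) ⟨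
      fromInt (ℤ.- (+ suc m ℤ.* j))           ≈⟨ fromInt-neg (+ suc m ℤ.* j) ⟩
      - fromInt (+ suc m ℤ.* j)               ≈⟨ -‿cong (fromInt-+*ʳ (suc m) j) ⟩
      - (fromInt (+ suc m) * fromInt j)       ≈⟨ -‿distribˡ-* _ _ ⟩
      fromInt -[1+ m ] * fromInt j            ∎

    morphism : ℤ.+-*-rawRing -Raw-AlmostCommutative⟶ fromCommutativeRing R
    morphism = record
      { ⟦_⟧ = fromInt ; +-homo = fromInt-+ ; *-homo = fromInt-* ; -‿homo = fromInt-neg
      ; 0-homo = refl ; 1-homo = refl }

    fromInt-≟ : ∀ i j → Maybe (fromInt i ≈ fromInt j)
    fromInt-≟ i j with i ℤ.≟ j
    ... | yes i≡j = Maybe.just (reflexive (≡.cong fromInt i≡j))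
    ... | no  _   = Maybe.nothing

  open module Solver = RingSolver ℤ.+-*-rawRing (fromCommutativeRing R) morphism fromInt-≟ public
    using (_:+_; _:*_; _:-_; :-_; con)

  -- Opaque, because `with` would otherwise normalise the soundness proof.
  opaque
    correct : ∀ {n} (e : Solver.Polynomial n) ρ → Solver.⟦ e ⟧↓ ρ ≈ Solver.⟦ e ⟧ ρ
    correct = Solver.correct

  open Reflection setoid Solver.var Solver.⟦_⟧ Solver.⟦_⟧↓ correct public
    using (solve) renaming (_⊜_ to _:=_)

module LinearCombination {c ℓ} (R : CommutativeRing c ℓ) where
  open CommutativeRing R
  open IntegerSolver R
  open SetoidReasoning setoid

  opaque
    -- The solver proves identities only. An equation that follows from hypotheses becomes an
    -- identity once the multipliers are named that express `a - b` in the ideal of the hypotheses.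
    linear : ∀ {a b p q} m → p ≈ q → a - b ≈ m * (p - q) → a ≈ b
    linear {a} {b} {p} {q} m p≈q eq = begin
      a                     ≈⟨ solve 2 (λ a b → a := (a :- b) :+ b) refl a b ⟩
      (a - b) + b           ≈⟨ +-congʳ eq ⟩
      m * (p - q) + b       ≈⟨ +-congʳ (*-congˡ (+-congʳ p≈q)) ⟩
      m * (q - q) + b       ≈⟨ solve 3 (λ m q b → m :* (q :- q) :+ b := b) refl m q b ⟩
      b                     ∎

    linear₂ : ∀ {a b p q p′ q′} m m′ → p ≈ q → p′ ≈ q′ →
              a - b ≈ m * (p - q) + m′ * (p′ - q′) → a ≈ b
    linear₂ {a} {b} {p} {q} {p′} {q′} m m′ p≈q p′≈q′ eq = linear m p≈q (begin
      a - b                                ≈⟨ eq ⟩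
      m * (p - q) + m′ * (p′ - q′)         ≈⟨ +-congˡ (*-congˡ (+-congʳ p′≈q′)) ⟩
      m * (p - q) + m′ * (q′ - q′)         ≈⟨ solve 3 (λ x m q → x :+ m :* (q :- q) := x) refl (m * (p - q)) m′ q′ ⟩
      m * (p - q)                          ∎)

-- Valuations, units and powers of a uniformiser.

module Valuation {c ℓ} (E : DiscretelyValuedField c ℓ) where
  open DiscretelyValuedField E
  open RingProperties ring using (-1*x≈-x; -‿involutive; -‿distribˡ-*)
  open import Algebra.Properties.Semiring.Exp semiring public using (_^_; ^-homo-*)
  open SetoidReasoning setoid

  -- The ideal ϖⁿ O. In terms of the valuation it is decidable and independent of the choice of ϖ.
  V : ℕ → Pred Carrier 0ℓ
  V n x = [ + n ] ≤⁺ v x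

  V-resp : ∀ {n x y} → x ≈ y → V n x → V n y
  V-resp {n} x≈y = ≡.subst ([ + n ] ≤⁺_) (v-cong x≈y)

  V-mono : ∀ {m n x} → m ℕ.≤ n → V n x → V m x
  V-mono m≤n = ≤⁺-trans ℤ.≤-trans [ ℤ.+≤+ m≤n ]

  V? : ∀ n x → Dec (V n x)
  V? n x = ≤⁺-dec ℤ._≤?_ [ + n ] (v x)

  V-0# : ∀ {n} → V n 0#
  V-0# rewrite Equivalence.from v-∞ refl = _ ≤⊤⁺

  V-* : ∀ {m n x y} → V m x → V n y → V (m ℕ.+ n) (x * y)
  V-* {x = x} {y} m≤ n≤ rewrite v-* x y with v x | v y | m≤ | n≤
  ... | [ _ ] | [ _ ] | [ p ] | [ q ] = [ ℤ.+-mono-≤ p q ]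
  ... | [ _ ] | ⊤⁺    | _     | _     = _ ≤⊤⁺
  ... | ⊤⁺    | _     | _     | _     = _ ≤⊤⁺

  V-*ˡ : ∀ {n x y} → V 0 x → V n y → V n (x * y)
  V-*ˡ = V-*

  V-*ʳ : ∀ {n x y} → V n x → V 0 y → V n (x * y)
  V-*ʳ Vx Vy = V-resp (*-comm _ _) (V-* Vy Vx)

  V-1# : V 0 1#
  V-1# = IsSubring.1-closed integral-isSubring

  V-neg : ∀ {n x} → V n x → V n (- x)
  V-neg Vx = V-resp (-1*x≈-x _) (V-*ˡ (IsSubring.neg-closed integral-isSubring V-1#) Vx)

  V-- : ∀ {n x y} → V n x → V n y → V n (x - y)
  V-- Vx Vy = v-+ Vx (V-neg Vy)

  V-neg⁻¹ : ∀ {n x} → V n (- x) → V n x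
  V-neg⁻¹ Vx = V-resp (-‿involutive _) (V-neg Vx)

  ¬V₁1 : ¬ V 1 1#
  ¬V₁1 V1 with v 1# | v-1# | V1
  ... | _ | ≡.refl | [ ℤ.+≤+ () ]

  ≉0⇒v : ∀ {x} → ¬ x ≈ 0# → ∃[ m ] v x ≡ [ m ]
  ≉0⇒v {x} x≉0 with v x in eq
  ... | [ m ] = m , ≡.refl
  ... | ⊤⁺    = contradiction (Equivalence.to v-∞ eq) x≉0

  v⇒≉0 : ∀ {x m} → v x ≡ [ m ] → ¬ x ≈ 0#
  v⇒≉0 eq x≈0 with () ← ≡.trans (≡.sym eq) (Equivalence.from v-∞ x≈0)

  ≈0? : ∀ x → Dec (x ≈ 0#)
  ≈0? x with v x in eq
  ... | ⊤⁺    = yes (Equivalence.to v-∞ eq)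
  ... | [ _ ] = no (v⇒≉0 eq)

  v-≤-≉0 : ∀ {x y} → v x ≤⁺ v y → ¬ y ≈ 0# → ¬ x ≈ 0#
  v-≤-≉0 {x} {y} vx≤vy y≉0 x≈0 with v x | Equivalence.from v-∞ x≈0 | v y | ≉0⇒v y≉0 | vx≤vy
  ... | _ | ≡.refl | _ | _ , ≡.refl | ()

  V-inverse : ∀ {x y} → ¬ V 0 x → x * y ≈ 1# → V 1 y
  V-inverse {x} {y} ¬Vx xy≈1 with v x | v y | ≡.trans (≡.sym (v-* x y)) (≡.trans (v-cong xy≈1) v-1#)
  ... | ⊤⁺    | _     | _  = contradiction (_ ≤⊤⁺) ¬Vx
  ... | [ m ] | ⊤⁺    | _  = _ ≤⊤⁺
  ... | [ m ] | [ n ] | eq = [ ≡.subst (1ℤ ℤ.≤_) n≡ (ℤ.+-monoʳ-≤ 1ℤ (≡.subst (ℤ._≤ -[1+ 0 ] ℤ.+ n) m+n≡0 (ℤ.+-monoˡ-≤ n m≤-1))) ]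
    where
    m+n≡0 : m ℤ.+ n ≡ 0ℤ
    m+n≡0 = just-injective eq
    m≤-1 : m ℤ.≤ -[1+ 0 ]
    m≤-1 = ℤ.i<j⇒i≤pred[j] (ℤ.≰⇒> (¬Vx ∘ [_]))
    n≡ : 1ℤ ℤ.+ (-[1+ 0 ] ℤ.+ n) ≡ n
    n≡ = ≡.trans (≡.sym (ℤ.+-assoc 1ℤ -[1+ 0 ] n)) (ℤ.+-identityˡ n)

  -- Adding the valuation of t⁻¹ to both sides of v t ≤ v x compares t⁻¹ x with t t⁻¹, so v t⁻¹ need
  -- not be computed.
  V-quotient : ∀ {n x t t⁻¹} → t * t⁻¹ ≈ 1# → v t ≤⁺ v x → V n (t * t⁻¹) → V n (t⁻¹ * x)
  V-quotient {n} {x} {t} {t⁻¹} tt⁻¹≈1 vt≤vx Vtt⁻¹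
    rewrite v-* t t⁻¹ | v-* t⁻¹ x with v t | v t⁻¹ | v x | vt≤vx | Vtt⁻¹
  ... | [ a ] | [ b ] | [ d ] | [ a≤d ] | [ p ] =
        [ ℤ.≤-trans p (≡.subst (ℤ._≤ b ℤ.+ d) (ℤ.+-comm b a) (ℤ.+-monoʳ-≤ b a≤d)) ]
  ... | [ a ] | [ b ] | ⊤⁺    | _       | _     = _ ≤⊤⁺
  ... | [ a ] | ⊤⁺    | _     | _       | _     = _ ≤⊤⁺
  ... | ⊤⁺    | [ b ] | ⊤⁺    | _       | _     = _ ≤⊤⁺
  ... | ⊤⁺    | ⊤⁺    | _     | _       | _     = _ ≤⊤⁺

  ≤⁺-refl : ∀ {a} → a ≤⁺ a
  ≤⁺-refl = ≤⁺-reflexive-≡ ℤ.≤-reflexive ≡.refl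

  minimal-v : ∀ {n} (x : Fin (suc n) → Carrier) → ∃[ p ] ∀ i → v (x p) ≤⁺ v (x i)
  minimal-v {zero}  x = Fin.zero , λ { Fin.zero → ≤⁺-refl }
  minimal-v {suc n} x with minimal-v (x ∘ Fin.suc)
  ... | p , min with ≤⁺-total ℤ.≤-total (v (x Fin.zero)) (v (x (Fin.suc p)))
  ... | inj₂ p≤0 = Fin.suc p , λ { Fin.zero → p≤0 ; (Fin.suc i) → min i }
  ... | inj₁ 0≤p = Fin.zero , λ
    { Fin.zero    → ≤⁺-refl
    ; (Fin.suc i) → ≤⁺-trans ℤ.≤-trans 0≤p (min i) }

  -- The units of O.
  U : Pred Carrier 0ℓ
  U x = V 0 x × ¬ V 1 x

  U-1# : U 1#
  U-1# = V-1# , ¬V₁1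

  U-resp : ∀ {x y} → x ≈ y → U x → U y
  U-resp x≈y (Vx , ¬Vx) = V-resp x≈y Vx , ¬Vx ∘ V-resp (sym x≈y)

  U⇒v≡0 : ∀ {x} → U x → v x ≡ [ 0ℤ ]
  U⇒v≡0 {x} (Vx , ¬Vx) with v x
  U⇒v≡0 {x} ([ ℤ.+≤+ {n = zero}  _ ] , ¬Vx) | _ = ≡.refl
  U⇒v≡0 {x} ([ ℤ.+≤+ {n = suc _} _ ] , ¬Vx) | _ = contradiction [ ℤ.+≤+ (s≤s z≤n) ] ¬Vx
  U⇒v≡0 {x} (_ , ¬Vx) | ⊤⁺ = contradiction (_ ≤⊤⁺) ¬Vx

  v≡0⇒U : ∀ {x} → v x ≡ [ 0ℤ ] → U x
  v≡0⇒U {x} eq rewrite eq = [ ℤ.≤-refl ] , λ { [ ℤ.+≤+ () ] }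

  +⁺-identityˡ : ∀ a → [ 0ℤ ] +⁺ a ≡ a
  +⁺-identityˡ [ _ ] = ≡.cong [_] (ℤ.+-identityˡ _)
  +⁺-identityˡ ⊤⁺    = ≡.refl

  v-unit-* : ∀ {u x} → U u → v (u * x) ≡ v x
  v-unit-* {u} {x} Uu = ≡.trans (v-* u x)
    (≡.trans (≡.cong (_+⁺ v x) (U⇒v≡0 Uu)) (+⁺-identityˡ (v x)))

  U-* : ∀ {x y} → U x → U y → U (x * y)
  U-* Ux Uy = v≡0⇒U (≡.trans (v-unit-* Ux) (U⇒v≡0 Uy))

  U-cancel : ∀ {n u x} → U u → V n (u * x) → V n x
  U-cancel {n} Uu = ≡.subst ([ + n ] ≤⁺_) (v-unit-* Uu)

  U-≉0 : ∀ {x} → U x → ¬ x ≈ 0#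
  U-≉0 Ux = v⇒≉0 (U⇒v≡0 Ux)

  U-inverse : ∀ {x} → U x → ∃[ y ] U y × x * y ≈ 1#
  U-inverse Ux with invertible (U-≉0 Ux)
  ... | y , xy≈1 = y , v≡0⇒U (≡.trans (≡.sym (v-unit-* Ux)) (≡.trans (v-cong xy≈1) v-1#)) , xy≈1

  U-+ : ∀ {x y} → U x → V 1 y → U (x + y)
  U-+ {x} {y} (Vx , ¬Vx) Vy = v-+ Vx (V-mono z≤n Vy) , λ Vx+y → ¬Vx (V-resp (begin
    (x + y) - y      ≈⟨ +-assoc _ _ _ ⟩
    x + (y - y)      ≈⟨ +-congˡ (-‿inverseʳ y) ⟩
    x + 0#           ≈⟨ +-identityʳ x ⟩
    x                ∎) (V-- Vx+y Vy))

  U-factor : ∀ {x y} → V 0 x → V 0 y → U (x * y) → U x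
  U-factor Vx Vy (_ , ¬Vxy) = Vx , λ V₁x → ¬Vxy (V-*ʳ V₁x Vy)

module Uniformiser {c ℓ} (E : DiscretelyValuedField c ℓ)
                   {ϖ : DiscretelyValuedField.Carrier E}
                   (v-ϖ : DiscretelyValuedField.v E ϖ ≡ [ 1ℤ ]) where
  open DiscretelyValuedField E
  open Valuation E
  open GroupProperties (AbelianGroup.group ℤ.+-0-abelianGroup) using (\\-leftDividesʳ)

  infix 9 ϖ^_

  -- Opaque, so that exponents can be inferred.
  opaque
    ϖ^_ : ℕ → Carrier
    ϖ^ n = ϖ ^ n

    ϖ^-zero : ϖ^ 0 ≈ 1#
    ϖ^-zero = refl

    ϖ^-suc : ∀ n → ϖ^ (suc n) ≈ ϖ * ϖ^ n
    ϖ^-suc n = refl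

    ϖ^-homo : ∀ m n → ϖ^ (m ℕ.+ n) ≈ ϖ^ m * ϖ^ n
    ϖ^-homo = ^-homo-* ϖ

    v-ϖ^ : ∀ n → v (ϖ^ n) ≡ [ + n ]
    v-ϖ^ zero    = v-1#
    v-ϖ^ (suc n) = ≡.trans (v-* ϖ (ϖ ^ n)) (≡.cong₂ _+⁺_ v-ϖ (v-ϖ^ n))

  V-ϖ^ : ∀ n → V n (ϖ^ n)
  V-ϖ^ n rewrite v-ϖ^ n = [ ℤ.≤-refl ]

  V-ϖ^⁻¹ : ∀ {m n} → V m (ϖ^ n) → m ℕ.≤ n
  V-ϖ^⁻¹ {m} {n} p rewrite v-ϖ^ n with p
  ... | [ ℤ.+≤+ m≤n ] = m≤n

  V-ϖ^* : ∀ k {n x} → V n x → V (k ℕ.+ n) (ϖ^ k * x)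
  V-ϖ^* k = V-* (V-ϖ^ k)

  ϖ^-integral : ∀ n → V 0 (ϖ^ n)
  ϖ^-integral n = V-mono z≤n (V-ϖ^ n)

  ϖ^≉0 : ∀ n → ¬ ϖ^ n ≈ 0#
  ϖ^≉0 n = v⇒≉0 (v-ϖ^ n)

  V-ϖ^-cancel : ∀ k {n x} → V (k ℕ.+ n) (ϖ^ k * x) → V n x
  V-ϖ^-cancel k {n} {x} p rewrite v-* (ϖ^ k) x | v-ϖ^ k with v x | p
  ... | ⊤⁺    | _     = _ ≤⊤⁺
  ... | [ a ] | [ q ] = [ cancel q ]
    where
    cancel : + (k ℕ.+ n) ℤ.≤ + k ℤ.+ a → + n ℤ.≤ a
    cancel q = ≡.subst₂ ℤ._≤_ (\\-leftDividesʳ (+ k) (+ n)) (\\-leftDividesʳ (+ k) a)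
      (ℤ.+-monoʳ-≤ (ℤ.- (+ k)) (≡.subst (ℤ._≤ + k ℤ.+ a) (ℤ.pos-+ k n) q))

-- Finite sums and the count in terms of T.

guard : ∀ {p} {P : Set p} → Dec P → ℕ → ℕ
guard (yes _) n = n
guard (no  _) n = 0

sumTo : (ℕ → ℕ) → ℕ → ℕ
sumTo f zero    = 0
sumTo f (suc n) = f 0 ℕ.+ sumTo (f ∘ suc) n

guard-↔ : ∀ {p} {P : Set p} (P? : Dec P) → (∀ (x y : P) → x ≡ y) → ∀ n → Fin (guard P? n) ↔ (P × Fin n)
guard-↔ (yes p) irrelevant n = mk↔ₛ′ (p ,_) proj₂ (λ (p′ , i) → ≡.cong (_, i) (irrelevant p p′)) (λ _ → ≡.refl)
guard-↔ (no ¬p) irrelevant n = mk↔ₛ′ (λ ()) (λ (p , _) → contradiction p ¬p) (λ (p , _) → contradiction p ¬p) (λ ())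

sumTo-↔ : ∀ {t} {T : ℕ → Set t} {f} n → (∀ i → Fin (f i) ↔ T i) → Fin (sumTo f n) ↔ (∃ λ i → i ℕ.< n × T i)
sumTo-↔ zero    e = mk↔ₛ′ (λ ()) (λ ()) (λ ()) (λ ())
sumTo-↔ {T = T} (suc n) e =
  mk↔ₛ′ [ (λ x → 0 , s≤s z≤n , x) , (λ (i , i<n , x) → suc i , s≤s i<n , x) ]′
        (λ { (zero , _ , x) → inj₁ x ; (suc i , s≤s i<n , x) → inj₂ (i , i<n , x) })
        (λ { (zero , s≤s z≤n , x) → ≡.refl ; (suc i , s≤s i<n , x) → ≡.refl })
        (λ { (inj₁ x) → ≡.refl ; (inj₂ (i , i<n , x)) → ≡.refl })
  ↔-∘ ((e 0 ⊎-↔ sumTo-↔ {T = T ∘ suc} n (e ∘ suc)) ↔-∘ Fin.+↔⊎)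

sumTo-cong : ∀ {f g} n → (∀ i → i ℕ.< n → f i ≡ g i) → sumTo f n ≡ sumTo g n
sumTo-cong zero    eq = ≡.refl
sumTo-cong (suc n) eq = ≡.cong₂ ℕ._+_ (eq 0 (s≤s z≤n)) (sumTo-cong n (λ i i<n → eq (suc i) (s≤s i<n)))

sumTo-split : ∀ f m n → sumTo f (m ℕ.+ n) ≡ sumTo f m ℕ.+ sumTo (f ∘ (m ℕ.+_)) n
sumTo-split f zero    n = ≡.refl
sumTo-split f (suc m) n = ≡.trans (≡.cong (f 0 ℕ.+_) (sumTo-split (f ∘ suc) m n)) (≡.sym (ℕ.+-assoc (f 0) _ _))

sumTo-snoc : ∀ f n → sumTo f (suc n) ≡ sumTo f n ℕ.+ f n
sumTo-snoc f n = ≡.trans (≡.cong (sumTo f) (ℕ.+-comm 1 n)) (≡.trans (sumTo-split f n 1)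
  (≡.cong (sumTo f n ℕ.+_) (≡.trans (ℕ.+-identityʳ _) (≡.cong f (ℕ.+-identityʳ n)))))

sumTo-+ : ∀ f g n → sumTo (λ i → f i ℕ.+ g i) n ≡ sumTo f n ℕ.+ sumTo g n
sumTo-+ f g zero    = ≡.refl
sumTo-+ f g (suc n) = ≡.trans (≡.cong (f 0 ℕ.+ g 0 ℕ.+_) (sumTo-+ (f ∘ suc) (g ∘ suc) n))
  (interchange (f 0) (g 0) _ _)
  where open import Algebra.Properties.CommutativeSemigroup ℕ.+-commutativeSemigroup using (interchange)

sumTo-* : ∀ c f n → sumTo (λ i → c ℕ.* f i) n ≡ c ℕ.* sumTo f n
sumTo-* c f zero    = ≡.sym (ℕ.*-zeroʳ c)
sumTo-* c f (suc n) = ≡.trans (≡.cong (c ℕ.* f 0 ℕ.+_) (sumTo-* c (f ∘ suc) n)) (≡.sym (ℕ.*-distribˡ-+ c (f 0) _))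

sumTo-reverse : ∀ f n → sumTo (λ t → f (n ∸ suc t)) n ≡ sumTo f n
sumTo-reverse f zero    = ≡.refl
sumTo-reverse f (suc n) = ≡.trans (≡.cong (f n ℕ.+_) (sumTo-reverse f n))
  (≡.trans (ℕ.+-comm (f n) _) (≡.sym (sumTo-snoc f n)))

row : (ℕ → ℕ) → ℕ → ℕ
row φ j = sumTo (λ i → φ (i ⊓ (j ∸ i))) (suc j)

-- At both ends of the row the minimum is 0; the shift i = i′ + 1 lowers all other minima by one.
-- This two-step recursion is the reason why the closed form depends on parities.
row-suc-suc : ∀ φ j → row φ (suc (suc j)) ≡ φ 0 ℕ.+ (row (φ ∘ suc) j ℕ.+ φ 0)
row-suc-suc φ j = ≡.cong (φ 0 ℕ.+_) (≡.trans
  (sumTo-snoc (λ i → φ (suc i ⊓ (suc j ∸ i))) (suc j))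
  (≡.cong₂ ℕ._+_
    (sumTo-cong (suc j) (λ i i<1+j → ≡.cong (λ x → φ (suc i ⊓ x)) (ℕ.+-∸-assoc 1 (ℕ.≤-pred i<1+j))))
    (≡.cong φ (≡.trans (≡.cong (suc (suc j) ⊓_) (ℕ.n∸n≡0 j)) (ℕ.⊓-zeroʳ (suc (suc j)))))))

module Count (q : ℕ) where

  -- Counts the points y + e y² of P¹(𝔬/ϖᵐ) with e divisible by ϖᵏ.
  term : ℕ → ℕ → ℕ
  term k m = guard (k ℕ.≤? m) (q ℕ.^ (m ∸ k))

  -- For j ≤ a the congruence with y is void, and the points of P¹(𝔬/ϖᵐ) outside the chart y + e y²
  -- count too. There are qᵐ⁻¹ of them, but none for m = 0, when P¹ is a single point.
  extra : ℕ → ℕ → ℕ → ℕ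
  extra a j m = guard (j ℕ.≤? a ×-dec 1 ℕ.≤? m) (q ℕ.^ (m ∸ 1))

  cell : ℕ → ℕ → ℕ → ℕ
  cell a j i = term (j ∸ a) (i ⊓ (j ∸ i)) ℕ.+ extra a j (i ⊓ (j ∸ i))

  total : ℕ → ℕ → ℕ
  total a b = sumTo (λ j → sumTo (cell a j) (suc j)) (suc b)

  r : ℕ → ℕ
  r = row (q ℕ.^_)

  T : ℕ → ℕ
  T = sumTo r

  private
    term-suc : ∀ k m → term (suc k) (suc m) ≡ term k m
    term-suc k m with k ℕ.≤? m | suc k ℕ.≤? suc m
    ... | yes _   | yes _   = ≡.refl
    ... | no  _   | no  _   = ≡.refl
    ... | yes k≤m | no  ¬p  = contradiction (s≤s k≤m) ¬p
    ... | no  ¬p  | yes k≤m = contradiction (ℕ.≤-pred k≤m) ¬p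

    row-cong : ∀ {φ ψ} j → (∀ m → φ m ≡ ψ m) → row φ j ≡ row ψ j
    row-cong j eq = sumTo-cong (suc j) (λ i _ → eq (i ⊓ (j ∸ i)))

    row-term-suc : ∀ k j → row (term (suc k)) (suc (suc j)) ≡ row (term k) j
    row-term-suc k j = ≡.trans (row-suc-suc (term (suc k)) j)
      (≡.trans (ℕ.+-identityʳ _) (row-cong j (term-suc k)))

  r-suc-suc : ∀ j → r (suc (suc j)) ≡ 2 ℕ.+ q ℕ.* r j
  r-suc-suc j = ≡.trans (row-suc-suc (q ℕ.^_) j) (≡.trans
    (≡.cong (λ x → 1 ℕ.+ (x ℕ.+ 1)) (sumTo-* q (λ i → q ℕ.^ (i ⊓ (j ∸ i))) (suc j)))
    (≡.cong suc (ℕ.+-comm _ 1)))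

  private
    -- The condition k ≤ min (i, j - i) confines i to the interval from k to j - k, on which the
    -- reduced minima form a full row for j - 2k.
    row-term : ∀ k l → row (term k) (k ℕ.+ k ℕ.+ l) ≡ r l
    row-term zero    l = ≡.refl
    row-term (suc k) l rewrite ℕ.+-suc k k = ≡.trans (row-term-suc k (k ℕ.+ k ℕ.+ l)) (row-term k l)

    row-cell-≤ : ∀ {a j} → j ℕ.≤ a → sumTo (cell a j) (suc j) ≡ r j ℕ.+ row (term 1) j
    row-cell-≤ {a} {j} j≤a = ≡.trans
      (sumTo-+ (λ i → term (j ∸ a) (i ⊓ (j ∸ i))) (λ i → extra a j (i ⊓ (j ∸ i))) (suc j))
      (≡.cong₂ ℕ._+_
        (≡.cong (λ k → row (term k) j) (ℕ.m≤n⇒m∸n≡0 j≤a))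
        (sumTo-cong (suc j) (λ i _ → second (i ⊓ (j ∸ i)))))
      where
      second : ∀ m → extra a j m ≡ term 1 m
      second m with j ℕ.≤? a | 1 ℕ.≤? m
      ... | yes _ | yes _ = ≡.refl
      ... | yes _ | no  _ = ≡.refl
      ... | no ¬p | _     = contradiction j≤a ¬p

    row-cell-> : ∀ {a j} → a ℕ.< j → sumTo (cell a j) (suc j) ≡ row (term (j ∸ a)) j
    row-cell-> {a} {j} a<j = sumTo-cong (suc j) (λ i _ → ≡.trans
      (≡.cong (term (j ∸ a) (i ⊓ (j ∸ i)) ℕ.+_) (second (i ⊓ (j ∸ i)))) (ℕ.+-identityʳ _))
      where
      second : ∀ m → extra a j m ≡ 0
      second m with j ℕ.≤? a | 1 ℕ.≤? m
      ... | yes j≤a | _     = contradiction j≤a (ℕ.<⇒≱ a<j)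
      ... | no  _   | yes _ = ≡.refl
      ... | no  _   | no  _ = ≡.refl

    sum-row-term : ∀ a → sumTo (row (term 1)) (suc a) ≡ T (a ∸ 1)
    sum-row-term zero          = ≡.refl
    sum-row-term (suc zero)    = ≡.refl
    sum-row-term (suc (suc a)) = sumTo-cong (suc a) (λ i _ → row-term-suc 0 i)

    row-cell-beyond : ∀ {a e} t → e ℕ.≤ a → t ℕ.< e →
      sumTo (cell a (suc a ℕ.+ t)) (suc (suc a ℕ.+ t)) ≡ r (a ∸ suc t)
    row-cell-beyond {a} {e} t e≤a t<e = ≡.trans (row-cell-> (s≤s (ℕ.m≤m+n a t))) (≡.trans
      (≡.cong₂ (λ k j → row (term k) j) k≡ j≡) (row-term (suc t) (a ∸ suc t)))
      where
      k≡ : suc a ℕ.+ t ∸ a ≡ suc t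
      k≡ = ≡.trans (≡.cong (_∸ a) (≡.sym (ℕ.+-suc a t))) (ℕ.m+n∸m≡n a (suc t))
      j≡ : suc a ℕ.+ t ≡ suc t ℕ.+ suc t ℕ.+ (a ∸ suc t)
      j≡ = ≡.sym (≡.trans (ℕ.+-assoc (suc t) (suc t) _) (≡.trans (≡.cong (suc t ℕ.+_) (ℕ.m+[n∸m]≡n (ℕ.≤-trans t<e e≤a)))
             (≡.trans (ℕ.+-comm (suc t) a) (ℕ.+-suc a t))))

  -- Additive, so that no difference of sums occurs; b is a + e. A row j ≤ a splits by the two
  -- charts into r j and row (term 1) j, with sums T(a + 1) and T(a - 1). The rows j = a + k with 1
  -- ≤ k ≤ e contribute r(a - k), and T(a - e) completes their sum to T(a).
  total-T : ∀ a e → e ℕ.≤ a → total a (a ℕ.+ e) ℕ.+ T (a ∸ e) ≡ T (suc a) ℕ.+ T (a ∸ 1) ℕ.+ T a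
  total-T a e e≤a = begin
    total a (a ℕ.+ e) ℕ.+ T (a ∸ e)
      ≡⟨ ≡.cong (ℕ._+ T (a ∸ e)) (sumTo-split f (suc a) e) ⟩
    sumTo f (suc a) ℕ.+ sumTo (f ∘ (suc a ℕ.+_)) e ℕ.+ T (a ∸ e)
      ≡⟨ ≡.cong₂ (λ x y → x ℕ.+ y ℕ.+ T (a ∸ e)) first beyond ⟩
    T (suc a) ℕ.+ T (a ∸ 1) ℕ.+ sumTo (λ t → r (a ∸ suc t)) e ℕ.+ T (a ∸ e)
      ≡⟨ ℕ.+-assoc (T (suc a) ℕ.+ T (a ∸ 1)) _ _ ⟩
    T (suc a) ℕ.+ T (a ∸ 1) ℕ.+ (sumTo (λ t → r (a ∸ suc t)) e ℕ.+ T (a ∸ e))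
      ≡⟨ ≡.cong (T (suc a) ℕ.+ T (a ∸ 1) ℕ.+_) tail ⟩
    T (suc a) ℕ.+ T (a ∸ 1) ℕ.+ T a ∎
    where
    open ≡.≡-Reasoning
    f : ℕ → ℕ
    f j = sumTo (cell a j) (suc j)
    first : sumTo f (suc a) ≡ T (suc a) ℕ.+ T (a ∸ 1)
    first = ≡.trans (sumTo-cong (suc a) (λ j j<1+a → row-cell-≤ (ℕ.≤-pred j<1+a)))
      (≡.trans (sumTo-+ r (row (term 1)) (suc a)) (≡.cong (T (suc a) ℕ.+_) (sum-row-term a)))
    beyond : sumTo (f ∘ (suc a ℕ.+_)) e ≡ sumTo (λ t → r (a ∸ suc t)) e
    beyond = sumTo-cong e (λ t t<e → row-cell-beyond t e≤a t<e)
    tail : sumTo (λ t → r (a ∸ suc t)) e ℕ.+ T (a ∸ e) ≡ T a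
    tail = begin
      sumTo (λ t → r (a ∸ suc t)) e ℕ.+ T (a ∸ e)
        ≡⟨ ≡.cong (sumTo (λ t → r (a ∸ suc t)) e ℕ.+_) (sumTo-reverse r (a ∸ e)) ⟨
      sumTo (λ t → r (a ∸ suc t)) e ℕ.+ sumTo (λ t → r (a ∸ e ∸ suc t)) (a ∸ e)
        ≡⟨ ≡.cong (sumTo (λ t → r (a ∸ suc t)) e ℕ.+_) (sumTo-cong (a ∸ e) (λ t _ →
             ≡.cong r (≡.trans (ℕ.∸-+-assoc a e (suc t)) (≡.cong (a ∸_) (ℕ.+-suc e t))))) ⟩
      sumTo (λ t → r (a ∸ suc t)) e ℕ.+ sumTo (λ t → r (a ∸ suc (e ℕ.+ t))) (a ∸ e)
        ≡⟨ sumTo-split (λ t → r (a ∸ suc t)) e (a ∸ e) ⟨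
      sumTo (λ t → r (a ∸ suc t)) (e ℕ.+ (a ∸ e))
        ≡⟨ ≡.cong (sumTo (λ t → r (a ∸ suc t))) (ℕ.m+[n∸m]≡n e≤a) ⟩
      sumTo (λ t → r (a ∸ suc t)) a
        ≡⟨ sumTo-reverse r a ⟩
      T a ∎

-- Parities, and integers as rational numbers.

-- Recursive rather than `n + n`, so that `double (suc h)` unfolds to two successors, as the
-- two-step recursion of `r` requires.
double : ℕ → ℕ
double zero    = zero
double (suc n) = suc (suc (double n))

double≡ : ∀ n → double n ≡ n ℕ.+ n
double≡ zero    = ≡.refl
double≡ (suc n) = ≡.cong suc (≡.trans (≡.cong suc (double≡ n)) (≡.sym (ℕ.+-suc n n)))

double-+ : ∀ m n → double m ℕ.+ double n ≡ double (m ℕ.+ n)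
double-+ zero    n = ≡.refl
double-+ (suc m) n = ≡.cong (suc ∘ suc) (double-+ m n)

double-injective : ∀ {m n} → double m ≡ double n → m ≡ n
double-injective {zero}  {zero}  _  = ≡.refl
double-injective {suc m} {suc n} eq = ≡.cong suc (double-injective (ℕ.suc-injective (ℕ.suc-injective eq)))

suc-double≢double : ∀ {m n} → suc (double m) ≢ double n
suc-double≢double {suc m} {suc n} eq = suc-double≢double {m} {n} (ℕ.suc-injective (ℕ.suc-injective eq))

data Half : ℕ → Set where
  even : ∀ n → Half (double n)
  odd  : ∀ n → Half (suc (double n))

half : ∀ n → Half n
half zero    = even 0
half (suc n) with half n
... | even m = odd m
... | odd  m = even (suc m)

parity-double : ∀ n → ℕ.parity (double n) ≡ 0ℙ
parity-double zero    = ≡.refl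
parity-double (suc n) = parity-double n

parity-suc-double : ∀ n → ℕ.parity (suc (double n)) ≡ 1ℙ
parity-suc-double zero    = ≡.refl
parity-suc-double (suc n) = parity-suc-double n

double/2 : ∀ n → double n ℕ./ 2 ≡ n
double/2 zero    = ≡.refl
double/2 (suc n) = ≡.trans (m/n≡1+[m∸n]/n {double (suc n)} {2} (s≤s (s≤s z≤n))) (≡.cong suc (double/2 n))

fromℤ-+ : ∀ i j → fromℤ (i ℤ.+ j) ≡ fromℤ i ℚ.+ fromℤ j
fromℤ-+ i j = ℚ.toℚᵘ-injective (ℚᵘ.≃-trans
  (*≡* (≡.cong (ℤ._* 1ℤ) (≡.sym (≡.cong₂ ℤ._+_ (ℤ.*-identityʳ i) (ℤ.*-identityʳ j)))))
  (ℚᵘ.≃-sym (ℚ.toℚᵘ-homo-+ (fromℤ i) (fromℤ j))))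

fromℤ-* : ∀ i j → fromℤ (i ℤ.* j) ≡ fromℤ i ℚ.* fromℤ j
fromℤ-* i j = ℚ.toℚᵘ-injective (ℚᵘ.≃-trans (*≡* ≡.refl) (ℚᵘ.≃-sym (ℚ.toℚᵘ-homo-* (fromℤ i) (fromℤ j))))

fromℤ-inverse : ∀ d .{{_ : ℕ.NonZero d}} → fromℤ (+ d) ℚ.* (1ℤ ℚ./ d) ≡ ℚ.1ℚ
fromℤ-inverse d@(suc d-1) = ℚ.toℚᵘ-injective (ℚᵘ.≃-trans
  (ℚ.toℚᵘ-homo-* (fromℤ (+ d)) (1ℤ ℚ./ d))
  (ℚᵘ.≃-trans (ℚᵘ.*-congˡ {toℚᵘ (fromℤ (+ d))} (ℚ.toℚᵘ-fromℚᵘ (mkℚᵘ 1ℤ d-1)))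
    (*≡* (≡.trans (ℤ.*-identityʳ _) (≡.trans (ℤ.*-identityʳ (+ d))
       (≡.sym (≡.trans (ℤ.*-identityˡ _) (ℤ.*-identityˡ (+ d)))))))))

-- Closed form of the counting function.

-- The counting function satisfies (q - 1)² T(2h) = (3q + 1)(qʰ - 1) - 4h(q - 1)
-- and a similar formula at odd arguments.  The algebra takes place in an
-- arbitrary commutative ring, and is applied to ℚ.
module ClosedForm (q : ℕ) {{q≢0 : ℕ.NonZero q}} {c ℓ} (R : CommutativeRing c ℓ)
  (cast : ℕ → CommutativeRing.Carrier R)
  (cast-0 : CommutativeRing._≈_ R (cast 0) (CommutativeRing.0# R))
  (cast-1 : CommutativeRing._≈_ R (cast 1) (CommutativeRing.1# R))
  (cast-+ : ∀ m n → CommutativeRing._≈_ R (cast (m ℕ.+ n)) (CommutativeRing._+_ R (cast m) (cast n)))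
  (cast-* : ∀ m n → CommutativeRing._≈_ R (cast (m ℕ.* n)) (CommutativeRing._*_ R (cast m) (cast n)))
  where
  open CommutativeRing R
  open Count q
  open IntegerSolver R
  open LinearCombination R
  open import Algebra.Properties.Semiring.Mult.TCOptimised semiring using () renaming (_×_ to _·_)

  # : ℕ → Carrier
  # n = n · 1#

  -- The origin of κ: P (r(2h) + r(2h + 1)) = κ qʰ - 4. Multiplied by P and summed over h, the term
  -- κ qʰ telescopes to κ (qʰ - 1).
  Q P κ : Carrier
  Q = cast q
  P = Q - 1#
  κ = # 3 * Q + 1#

  pow : ℕ → Carrier
  pow n = cast (q ℕ.^ n)

  cast-cong : ∀ {m n} → m ≡ n → cast m ≈ cast n
  cast-cong eq = reflexive (≡.cong cast eq)

  pow-0 : pow 0 ≈ 1#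
  pow-0 = cast-1

  pow-suc : ∀ n → pow (suc n) ≈ Q * pow n
  pow-suc n = cast-* q (q ℕ.^ n)

  pow-+ : ∀ m n → pow (m ℕ.+ n) ≈ pow m * pow n
  pow-+ m n = trans (cast-cong (ℕ.^-distribˡ-+-* q m n)) (cast-* (q ℕ.^ m) (q ℕ.^ n))

  cast-suc : ∀ n → cast (suc n) ≈ 1# + cast n
  cast-suc n = trans (cast-+ 1 n) (+-congʳ cast-1)

  cast-double : ∀ n → cast (double n) ≈ # 2 * cast n
  cast-double n = trans (cast-cong (double≡ n)) (trans (cast-+ n n)
    (solve 1 (λ n → n :+ n := con (+ 2) :* n) refl (cast n)))

  pow-double : ∀ n → pow (double n) ≈ pow n * pow n
  pow-double n = trans (cast-cong (≡.cong (q ℕ.^_) (double≡ n))) (pow-+ n n)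

  cast-r-suc-suc : ∀ j → cast (r (suc (suc j))) ≈ # 2 + Q * cast (r j)
  cast-r-suc-suc j = trans (cast-cong (r-suc-suc j)) (trans (cast-+ 2 (q ℕ.* r j))
    (+-cong (trans (cast-+ 1 1) (+-cong cast-1 cast-1)) (cast-* q (r j))))

  cast-T-suc : ∀ n → cast (T (suc n)) ≈ cast (T n) + cast (r n)
  cast-T-suc n = trans (cast-cong (sumTo-snoc r n)) (cast-+ (T n) (r n))

  r-even′ r-odd′ : Carrier → Carrier
  r-even′ x = Q * x + x - # 2
  r-odd′ x = # 2 * (Q * x) - # 2

  T-even′ T-odd′ T-pred′ : Carrier → Carrier → Carrier
  T-even′ h x = κ * x - # 4 * (h * P) - κ
  T-odd′  h x = T-even′ h x + P * r-even′ x
  T-pred′ h x = T-even′ h x - P * (# 2 * x - # 2)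

  T-even′-cong : ∀ {h h′ x x′} → h ≈ h′ → x ≈ x′ → T-even′ h x ≈ T-even′ h′ x′
  T-even′-cong h≈ x≈ = +-congʳ (+-cong (*-congˡ x≈) (-‿cong (*-congˡ (*-congʳ h≈))))

  r-even : ∀ h → P * cast (r (double h)) ≈ r-even′ (pow h)
  r-even zero = linear₂ P (- (Q + 1#)) cast-1 pow-0
    (solve 3 (λ q r x → (q :- con 1ℤ) :* r :- (q :* x :+ x :- con (+ 2)) :=
      (q :- con 1ℤ) :* (r :- con 1ℤ) :+ (:- (q :+ con 1ℤ)) :* (x :- con 1ℤ)) refl Q (cast 1) (pow 0))
  r-even (suc h) = trans (*-congˡ (cast-r-suc-suc (double h))) (trans (linear Q (r-even h)
    (solve 3 (λ q r x → (q :- con 1ℤ) :* (con (+ 2) :+ q :* r) :- (q :* (q :* x) :+ q :* x :- con (+ 2)) :=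
      q :* ((q :- con 1ℤ) :* r :- (q :* x :+ x :- con (+ 2)))) refl Q (cast (r (double h))) (pow h)))
    (sym (+-congʳ (+-cong (*-congˡ (pow-suc h)) (pow-suc h)))))

  r-odd : ∀ h → P * cast (r (suc (double h))) ≈ r-odd′ (pow h)
  r-odd zero = linear₂ P (- (# 2 * Q)) (trans (cast-+ 1 1) (+-cong cast-1 cast-1)) pow-0
    (solve 3 (λ q r x → (q :- con 1ℤ) :* r :- (con (+ 2) :* (q :* x) :- con (+ 2)) :=
      (q :- con 1ℤ) :* (r :- con (+ 2)) :+ (:- (con (+ 2) :* q)) :* (x :- con 1ℤ)) refl Q (cast 2) (pow 0))
  r-odd (suc h) = trans (*-congˡ (cast-r-suc-suc (suc (double h)))) (trans (linear Q (r-odd h)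
    (solve 3 (λ q r x → (q :- con 1ℤ) :* (con (+ 2) :+ q :* r) :- (con (+ 2) :* (q :* (q :* x)) :- con (+ 2)) :=
      q :* ((q :- con 1ℤ) :* r :- (con (+ 2) :* (q :* x) :- con (+ 2)))) refl Q (cast (r (suc (double h)))) (pow h)))
    (sym (+-congʳ (*-congˡ (*-congˡ (pow-suc h))))))

  T-even : ∀ h → (P * P) * cast (T (double h)) ≈ T-even′ (cast h) (pow h)
  T-odd  : ∀ h → (P * P) * cast (T (suc (double h))) ≈ T-odd′ (cast h) (pow h)
  T-even zero = trans (trans (*-congˡ cast-0) (solve 1 (λ q →
      let p = q :- con 1ℤ
          k = con (+ 3) :* q :+ con 1ℤ
      in (p :* p) :* con 0ℤ := k :* con 1ℤ :- con (+ 4) :* (con 0ℤ :* p) :- k) refl Q))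
    (sym (T-even′-cong cast-0 pow-0))
  T-even (suc h) = trans (*-congˡ (cast-T-suc (suc (double h)))) (trans
    (linear₂ 1# P (T-odd h) (r-odd h) (solve 5 (λ q t r x h →
      let p = q :- con 1ℤ
          k = con (+ 3) :* q :+ con 1ℤ
      in p :* p :* (t :+ r) :- (k :* (q :* x) :- con (+ 4) :* ((con 1ℤ :+ h) :* p) :- k) :=
         con 1ℤ :* (p :* p :* t :- (k :* x :- con (+ 4) :* (h :* p) :- k :+ p :* (q :* x :+ x :- con (+ 2))))
         :+ p :* (p :* r :- (con (+ 2) :* (q :* x) :- con (+ 2))))
      refl Q (cast (T (suc (double h)))) (cast (r (suc (double h)))) (pow h) (cast h)))
    (sym (T-even′-cong (cast-suc h) (pow-suc h))))
  T-odd h = trans (*-congˡ (cast-T-suc (double h)))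
    (linear₂ 1# P (T-even h) (r-even h) (solve 5 (λ p t r y z →
      p :* p :* (t :+ r) :- (y :+ p :* z) := con 1ℤ :* (p :* p :* t :- y) :+ p :* (p :* r :- z))
      refl P (cast (T (double h))) (cast (r (double h))) (T-even′ (cast h) (pow h)) (r-even′ (pow h))))

  T-pred : ∀ h → (P * P) * cast (T (double h ∸ 1)) ≈ T-pred′ (cast h) (pow h)
  -- The truncation 0 ∸ 1 = 0 does no harm, because the correction 2 q⁰ - 2 vanishes.
  T-pred zero = trans (T-even 0) (linear (P * # 2) pow-0
    (solve 3 (λ p x y → y :- (y :- p :* (con (+ 2) :* x :- con (+ 2))) := p :* con (+ 2) :* (x :- con 1ℤ))
      refl P (pow 0) (T-even′ (cast 0) (pow 0))))
  T-pred (suc h) = trans (T-odd h) (trans (solve 3 (λ q x h →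
      let p = q :- con 1ℤ
          k = con (+ 3) :* q :+ con 1ℤ
      in k :* x :- con (+ 4) :* (h :* p) :- k :+ p :* (q :* x :+ x :- con (+ 2)) :=
         k :* (q :* x) :- con (+ 4) :* ((con 1ℤ :+ h) :* p) :- k :- p :* (con (+ 2) :* (q :* x) :- con (+ 2))) refl Q (pow h) (cast h))
    (sym (+-cong (T-even′-cong (cast-suc h) (pow-suc h)) (-‿cong (*-congˡ (+-congʳ (*-congˡ (pow-suc h))))))))

  -- The common shape of the four numerators. The weights 4 and 3, which change places between the
  -- cases, belong to the arguments.
  numerator : (A B C s G D E₁ E₂ : Carrier) → Carrier
  numerator A B C s G D E₁ E₂ =
    A + # 7 * B + C + (# 2 * s - # 2) * G * (1# - Q) - # 8 * D - E₁ - E₂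

  private
    numerator-cong : ∀ {A B C s G D E₁ E₂ A′ B′ C′ s′ D′ E₁′ E₂′} →
      A ≈ A′ → B ≈ B′ → C ≈ C′ → s ≈ s′ → D ≈ D′ → E₁ ≈ E₁′ → E₂ ≈ E₂′ →
      numerator A B C s G D E₁ E₂ ≈ numerator A′ B′ C′ s′ G D′ E₁′ E₂′
    numerator-cong A B C s D E₁ E₂ = +-cong (+-cong (+-cong (+-cong (+-cong (+-cong A (*-congˡ B)) C)
      (*-congʳ (*-congʳ (+-congʳ (*-congˡ s))))) (-‿cong (*-congˡ D))) (-‿cong E₁)) (-‿cong E₂)

    cast-denominator : ∀ n → cast (q ℕ.^ n ℕ.* (q ∸ 1) ℕ.^ 2) ≈ pow n * (P * P)
    cast-denominator n = trans (cast-* (q ℕ.^ n) ((q ∸ 1) ℕ.^ 2)) (*-congˡ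
      (trans (cast-* (q ∸ 1) ((q ∸ 1) ℕ.* 1)) (*-cong cast-P (trans (cast-cong (ℕ.*-identityʳ (q ∸ 1))) cast-P))))
      where
      cast-P : cast (q ∸ 1) ≈ P
      cast-P = linear (- 1#) (trans (cast-cong (≡.sym (ℕ.suc-pred q))) (cast-suc (ℕ.pred q)))
        (solve 2 (λ q p → p :- (q :- con 1ℤ) := (:- con 1ℤ) :* (q :- (con 1ℤ :+ p))) refl Q (cast (q ∸ 1)))

    combine : ∀ {N t₁ t₂ t₃ t₄ T₁ T₂ T₃ T₄ y X} → N ℕ.+ t₄ ≡ t₁ ℕ.+ t₂ ℕ.+ t₃ →
      (P * P) * cast t₁ ≈ T₁ → (P * P) * cast t₂ ≈ T₂ → (P * P) * cast t₃ ≈ T₃ → (P * P) * cast t₄ ≈ T₄ →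
      X ≈ pow y * (T₁ + T₂ + T₃ - T₄) → X ≈ cast N * cast (q ℕ.^ y ℕ.* (q ∸ 1) ℕ.^ 2)
    combine {N} {t₁} {t₂} {t₃} {t₄} {T₁} {T₂} {T₃} {T₄} {y} {X} eq e₁ e₂ e₃ e₄ X≈ = begin
      X                                        ≈⟨ X≈ ⟩
      pow y * (T₁ + T₂ + T₃ - T₄)              ≈⟨ *-congˡ (+-cong (+-cong (+-cong e₁ e₂) e₃) (-‿cong e₄)) ⟨
      pow y * ((P * P) * cast t₁ + (P * P) * cast t₂ + (P * P) * cast t₃ - (P * P) * cast t₄)
        ≈⟨ linear (- (pow y * (P * P))) cast-eq (solve 7 (λ y p N a b c d →
             y :* (p :* a :+ p :* b :+ p :* c :- p :* d) :- N :* (y :* p) := (:- (y :* p)) :* (N :+ d :- (a :+ b :+ c)))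
             refl (pow y) (P * P) (cast N) (cast t₁) (cast t₂) (cast t₃) (cast t₄)) ⟩
      cast N * (pow y * (P * P))               ≈⟨ *-congˡ (cast-denominator y) ⟨
      cast N * cast (q ℕ.^ y ℕ.* (q ∸ 1) ℕ.^ 2) ∎
      where
      open SetoidReasoning setoid
      cast-eq : cast N + cast t₄ ≈ cast t₁ + cast t₂ + cast t₃
      cast-eq = trans (sym (cast-+ N t₄)) (trans (cast-cong eq) (trans (cast-+ (t₁ ℕ.+ t₂) t₃) (+-congʳ (cast-+ t₁ t₂))))

    pow-suc-suc : ∀ n → pow (suc (suc n)) ≈ Q * (Q * pow n)
    pow-suc-suc n = trans (pow-suc (suc n)) (*-congˡ (pow-suc n))

    cast-suc-double : ∀ m n → cast (suc (double (m ℕ.+ n))) ≈ # 2 * (cast m + cast n) + 1#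
    cast-suc-double m n = trans (cast-suc _) (trans (+-comm _ _) (+-congʳ (trans (cast-double _) (*-congˡ (cast-+ m n)))))

    T-even-suc : ∀ h → (P * P) * cast (T (double (suc h))) ≈ T-even′ (1# + cast h) (Q * pow h)
    T-even-suc h = trans (T-even (suc h)) (T-even′-cong (cast-suc h) (pow-suc h))

  module _ (α β γ N : ℕ) where
    private
      a b g x y z : Carrier
      a = cast α
      b = cast β
      g = cast γ
      x = pow α
      y = pow β
      z = pow γ
      pow-αβ : pow (α ℕ.+ β) ≈ x * y
      pow-αβ = pow-+ α β
      pow-γβ : ∀ {n} → γ ℕ.+ β ≡ n → z * y ≈ pow n
      pow-γβ eq = trans (sym (pow-+ γ β)) (cast-cong (≡.cong (q ℕ.^_) eq))
      cast-γβ : ∀ {n} → γ ℕ.+ β ≡ n → g + b ≈ cast n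
      cast-γβ eq = trans (sym (cast-+ γ β)) (cast-cong eq)

    -- In the four lemmas α, β, γ are the halves, rounded down, of a, b and 2a - b. The names give
    -- the parities of a and b, while the cases of the class number are those of s = a + b and f =
    -- b. The sum of a half-argument relation and its exponential, with the multipliers passed to
    -- `linear₂`, is all that the identity needs.
    numerator-even-even : γ ℕ.+ β ≡ double α →
      N ℕ.+ T (double γ) ≡ T (suc (double α)) ℕ.+ T (double α ∸ 1) ℕ.+ T (double α) →
      numerator (pow (2 ℕ.+ (α ℕ.+ β))) (pow (1 ℕ.+ (α ℕ.+ β))) (# 4 * pow (α ℕ.+ β)) (cast (double (α ℕ.+ β)))
        y (pow (suc β)) (# 3 * pow (suc (double α))) (pow (double α))
      ≈ cast N * cast (q ℕ.^ β ℕ.* (q ∸ 1) ℕ.^ 2)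
    numerator-even-even γβ eq = combine {y = β} eq (T-odd α) (T-pred α) (T-even α) (T-even γ) (trans
      (numerator-cong (trans (pow-suc-suc (α ℕ.+ β)) (*-congˡ (*-congˡ pow-αβ))) (trans (pow-suc (α ℕ.+ β)) (*-congˡ pow-αβ)) (*-congˡ pow-αβ)
        (trans (cast-double _) (*-congˡ (cast-+ α β))) (pow-suc β)
        (*-congˡ (trans (pow-suc (double α)) (*-congˡ (pow-double α)))) (pow-double α))
      (linear₂ κ (- (# 4 * P * y)) (trans (pow-γβ γβ) (pow-double α)) (trans (cast-γβ γβ) (cast-double α))
        (solve 7 (λ q x y z a b g →
          let p = q :- con 1ℤ
              k = con (+ 3) :* q :+ con 1ℤ
              TE = k :* x :- con (+ 4) :* (a :* p) :- k
          in (q :* (q :* (x :* y)) :+ con (+ 7) :* (q :* (x :* y)) :+ con (+ 4) :* (x :* y)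
               :+ (con (+ 2) :* (con (+ 2) :* (a :+ b)) :- con (+ 2)) :* y :* (con 1ℤ :- q)
               :- con (+ 8) :* (q :* y) :- con (+ 3) :* (q :* (x :* x)) :- x :* x)
             :- y :* ((TE :+ p :* (q :* x :+ x :- con (+ 2))) :+ (TE :- p :* (con (+ 2) :* x :- con (+ 2))) :+ TE
                      :- (k :* z :- con (+ 4) :* (g :* p) :- k))
             := k :* (z :* y :- x :* x) :+ (:- (con (+ 4) :* p :* y)) :* (g :+ b :- con (+ 2) :* a))
          refl Q x y z a b g)))

    numerator-odd-odd : γ ℕ.+ β ≡ double α →
      N ℕ.+ T (suc (double γ)) ≡ T (double (suc α)) ℕ.+ T (double α) ℕ.+ T (suc (double α)) →
      numerator (# 4 * pow (2 ℕ.+ (α ℕ.+ β))) (pow (1 ℕ.+ (α ℕ.+ β))) (pow (α ℕ.+ β)) (cast (double (suc (α ℕ.+ β))))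
        y (pow (suc β)) (pow (suc (suc (double α)))) (# 3 * pow (suc (double α)))
      ≈ cast N * cast (q ℕ.^ β ℕ.* (q ∸ 1) ℕ.^ 2)
    numerator-odd-odd γβ eq = combine {y = β} eq (T-even-suc α) (T-even α) (T-odd α) (T-odd γ) (trans
      (numerator-cong (*-congˡ (trans (pow-suc-suc (α ℕ.+ β)) (*-congˡ (*-congˡ pow-αβ)))) (trans (pow-suc (α ℕ.+ β)) (*-congˡ pow-αβ)) pow-αβ
        (trans (cast-double _) (*-congˡ (trans (cast-suc _) (+-congˡ (cast-+ α β))))) (pow-suc β)
        (trans (pow-suc-suc (double α)) (*-congˡ (*-congˡ (pow-double α)))) (*-congˡ (trans (pow-suc (double α)) (*-congˡ (pow-double α)))))
      (linear₂ (κ + P * (Q + 1#)) (- (# 4 * P * y)) (trans (pow-γβ γβ) (pow-double α)) (trans (cast-γβ γβ) (cast-double α))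
        (solve 7 (λ q x y z a b g →
          let p = q :- con 1ℤ
              k = con (+ 3) :* q :+ con 1ℤ
              TE = k :* x :- con (+ 4) :* (a :* p) :- k
          in (con (+ 4) :* (q :* (q :* (x :* y))) :+ con (+ 7) :* (q :* (x :* y)) :+ x :* y
               :+ (con (+ 2) :* (con (+ 2) :* (con 1ℤ :+ (a :+ b))) :- con (+ 2)) :* y :* (con 1ℤ :- q)
               :- con (+ 8) :* (q :* y) :- q :* (q :* (x :* x)) :- con (+ 3) :* (q :* (x :* x)))
             :- y :* ((k :* (q :* x) :- con (+ 4) :* ((con 1ℤ :+ a) :* p) :- k) :+ TE :+ (TE :+ p :* (q :* x :+ x :- con (+ 2)))
                      :- (k :* z :- con (+ 4) :* (g :* p) :- k :+ p :* (q :* z :+ z :- con (+ 2))))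
             := (k :+ p :* (q :+ con 1ℤ)) :* (z :* y :- x :* x) :+ (:- (con (+ 4) :* p :* y)) :* (g :+ b :- con (+ 2) :* a))
          refl Q x y z a b g)))

    numerator-odd-even : γ ℕ.+ β ≡ suc (double α) →
      N ℕ.+ T (double γ) ≡ T (double (suc α)) ℕ.+ T (double α) ℕ.+ T (suc (double α)) →
      numerator (# 4 * pow (2 ℕ.+ (α ℕ.+ β))) (pow (1 ℕ.+ (α ℕ.+ β))) (pow (α ℕ.+ β)) (cast (suc (double (α ℕ.+ β))))
        y (pow (suc β)) (# 3 * pow (suc (suc (double α)))) (pow (suc (double α)))
      ≈ cast N * cast (q ℕ.^ β ℕ.* (q ∸ 1) ℕ.^ 2)
    numerator-odd-even γβ eq = combine {y = β} eq (T-even-suc α) (T-even α) (T-odd α) (T-even γ) (trans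
      (numerator-cong (*-congˡ (trans (pow-suc-suc (α ℕ.+ β)) (*-congˡ (*-congˡ pow-αβ)))) (trans (pow-suc (α ℕ.+ β)) (*-congˡ pow-αβ)) pow-αβ
        (cast-suc-double α β) (pow-suc β)
        (*-congˡ (trans (pow-suc-suc (double α)) (*-congˡ (*-congˡ (pow-double α))))) (trans (pow-suc (double α)) (*-congˡ (pow-double α))))
      (linear₂ κ (- (# 4 * P * y)) (trans (pow-γβ γβ) (trans (pow-suc (double α)) (*-congˡ (pow-double α))))
        (trans (cast-γβ γβ) (trans (cast-suc _) (+-congˡ (cast-double α))))
        (solve 7 (λ q x y z a b g →
          let p = q :- con 1ℤ
              k = con (+ 3) :* q :+ con 1ℤ
              TE = k :* x :- con (+ 4) :* (a :* p) :- k
          in (con (+ 4) :* (q :* (q :* (x :* y))) :+ con (+ 7) :* (q :* (x :* y)) :+ x :* y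
               :+ (con (+ 2) :* (con (+ 2) :* (a :+ b) :+ con 1ℤ) :- con (+ 2)) :* y :* (con 1ℤ :- q)
               :- con (+ 8) :* (q :* y) :- con (+ 3) :* (q :* (q :* (x :* x))) :- q :* (x :* x))
             :- y :* ((k :* (q :* x) :- con (+ 4) :* ((con 1ℤ :+ a) :* p) :- k) :+ TE :+ (TE :+ p :* (q :* x :+ x :- con (+ 2)))
                      :- (k :* z :- con (+ 4) :* (g :* p) :- k))
             := k :* (z :* y :- q :* (x :* x)) :+ (:- (con (+ 4) :* p :* y)) :* (g :+ b :- (con 1ℤ :+ con (+ 2) :* a)))
          refl Q x y z a b g)))

    numerator-even-odd : suc (γ ℕ.+ β) ≡ double α →
      N ℕ.+ T (suc (double γ)) ≡ T (suc (double α)) ℕ.+ T (double α ∸ 1) ℕ.+ T (double α) →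
      numerator (pow (2 ℕ.+ (α ℕ.+ β))) (pow (1 ℕ.+ (α ℕ.+ β))) (# 4 * pow (α ℕ.+ β)) (cast (suc (double (α ℕ.+ β))))
        y (pow (suc β)) (pow (suc (double α))) (# 3 * pow (double α))
      ≈ cast N * cast (q ℕ.^ β ℕ.* (q ∸ 1) ℕ.^ 2)
    numerator-even-odd γβ eq = combine {y = β} eq (T-odd α) (T-pred α) (T-even α) (T-odd γ) (trans
      (numerator-cong (trans (pow-suc-suc (α ℕ.+ β)) (*-congˡ (*-congˡ pow-αβ))) (trans (pow-suc (α ℕ.+ β)) (*-congˡ pow-αβ)) (*-congˡ pow-αβ)
        (cast-suc-double α β) (pow-suc β)
        (trans (pow-suc (double α)) (*-congˡ (pow-double α))) (*-congˡ (pow-double α)))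
      (linear₂ (Q + # 3) (- (# 4 * P * y))
        (trans (*-congˡ (sym (pow-+ γ β))) (trans (sym (pow-suc (γ ℕ.+ β))) (trans (cast-cong (≡.cong (q ℕ.^_) γβ)) (pow-double α))))
        (trans (+-congˡ (sym (cast-+ γ β))) (trans (sym (cast-suc _)) (trans (cast-cong γβ) (cast-double α))))
        (solve 7 (λ q x y z a b g →
          let p = q :- con 1ℤ
              k = con (+ 3) :* q :+ con 1ℤ
              TE = k :* x :- con (+ 4) :* (a :* p) :- k
          in (q :* (q :* (x :* y)) :+ con (+ 7) :* (q :* (x :* y)) :+ con (+ 4) :* (x :* y)
               :+ (con (+ 2) :* (con (+ 2) :* (a :+ b) :+ con 1ℤ) :- con (+ 2)) :* y :* (con 1ℤ :- q)
               :- con (+ 8) :* (q :* y) :- q :* (x :* x) :- con (+ 3) :* (x :* x))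
             :- y :* ((TE :+ p :* (q :* x :+ x :- con (+ 2))) :+ (TE :- p :* (con (+ 2) :* x :- con (+ 2))) :+ TE
                      :- (k :* z :- con (+ 4) :* (g :* p) :- k :+ p :* (q :* z :+ z :- con (+ 2))))
             := (q :+ con (+ 3)) :* (q :* (z :* y) :- x :* x) :+ (:- (con (+ 4) :* p :* y)) :* (con 1ℤ :+ (g :+ b) :- con (+ 2) :* a))
          refl Q x y z a b g)))

-- The count as a value of the class number formula.

module ClassNumber (q : ℕ) {{nontrivial : ℕ.NonTrivial q}} where
  private instance
    q≢0 : ℕ.NonZero q
    q≢0 = ℕ.nonTrivial⇒nonZero q

  cast : ℕ → ℚ
  cast n = fromℤ (+ n)

  open ClassNumberFormula q
  open Count q
  private
    cast-+ : ∀ m n → cast (m ℕ.+ n) ≡ cast m ℚ.+ cast n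
    cast-+ m n = fromℤ-+ (+ m) (+ n)

    cast-* : ∀ m n → cast (m ℕ.* n) ≡ cast m ℚ.* cast n
    cast-* m n = ≡.trans (≡.cong fromℤ (ℤ.pos-* m n)) (fromℤ-* (+ m) (+ n))

  open ClosedForm q ℚ.+-*-commutativeRing cast ≡.refl ≡.refl cast-+ cast-*

  private
    fraction : (A B C s G D E₁ E₂ : ℚ) → ℚ
    fraction A B C s G D E₁ E₂ =
      A ℚ.+ cast 7 ℚ.* B ℚ.+ C ℚ.+ (cast 2 ℚ.* s ℚ.- cast 2) ℚ.* G ℚ.* (cast 1 ℚ.- cast q) ℚ.- cast 8 ℚ.* D ℚ.- E₁ ℚ.- E₂

    fraction-cong : ∀ s {A B C G D E₁ E₂ n A′ B′ C′ G′ D′ E₁′ E₂′ n′} →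
      A ≡ A′ → B ≡ B′ → C ≡ C′ → G ≡ G′ → D ≡ D′ → E₁ ≡ E₁′ → E₂ ≡ E₂′ → n ≡ n′ →
      (fraction A B C s G D E₁ E₂ /[q^ n ·[q-1]²]) ≡ (fraction A′ B′ C′ s G′ D′ E₁′ E₂′ /[q^ n′ ·[q-1]²])
    fraction-cong s ≡.refl ≡.refl ≡.refl ≡.refl ≡.refl ≡.refl ≡.refl ≡.refl = ≡.refl

    exponent : ∀ {i j} → i ≡ j → q^ i ≡ q^ j
    exponent = ≡.cong q^

    multiple : ∀ k {i j} → i ≡ j → cast k ℚ.* q^ i ≡ cast k ℚ.* q^ j
    multiple k eq = ≡.cong (λ i → cast k ℚ.* q^ i) eq

    suc-double+1/2 : ∀ n → (suc (double n) ℕ.+ 1) ℕ./ 2 ≡ suc n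
    suc-double+1/2 n = ≡.trans (≡.cong (ℕ._/ 2) (ℕ.+-comm (suc (double n)) 1)) (double/2 (suc n))

    suc-double+3/2 : ∀ n → (suc (double n) ℕ.+ 3) ℕ./ 2 ≡ suc (suc n)
    suc-double+3/2 n = ≡.trans (≡.cong (ℕ._/ 2) (ℕ.+-comm (suc (double n)) 3)) (double/2 (suc (suc n)))

    double/2+ : ∀ n m → double n ℕ./ 2 ℕ.+ m ≡ m ℕ.+ n
    double/2+ n m = ≡.trans (≡.cong (ℕ._+ m) (double/2 n)) (ℕ.+-comm n m)

    +1 : ∀ {i a} → i ≡ + a → i ℤ.+ 1ℤ ≡ + suc a
    +1 {a = a} eq = ≡.trans (≡.cong (ℤ._+ 1ℤ) eq) (≡.cong +_ (ℕ.+-comm a 1))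

  classNumber-even-even : ∀ h g {a} → + double h ℤ.- + double g ≡ + a → classNumber (double h) (double g) ≡
    (fraction (pow (2 ℕ.+ h)) (pow (1 ℕ.+ h)) (cast 4 ℚ.* pow h) (cast (double h))
      (pow g) (pow (suc g)) (cast 3 ℚ.* pow (suc a)) (pow a) /[q^ g ·[q-1]²])
  classNumber-even-even h g {a} eq
    rewrite parity-double h | parity-double g = fraction-cong (cast (double h))
    (exponent (≡.cong +_ (double/2+ h 2))) (exponent (≡.cong +_ (double/2+ h 1))) (multiple 4 (≡.cong +_ (double/2 h)))
    (exponent (≡.cong +_ (double/2 g))) (exponent (≡.cong +_ (double/2+ g 1)))
    (multiple 3 (+1 eq)) (exponent eq) (double/2 g)

  -- Here s is a sum of two odd numbers. Writing it as `double (suc h)` makes s/2 - 1 the natural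
  -- exponent h.
  classNumber-even-odd : ∀ h g {a} → + double (suc h) ℤ.- + suc (double g) ≡ + a → classNumber (double (suc h)) (suc (double g)) ≡
    (fraction (cast 4 ℚ.* pow (2 ℕ.+ h)) (pow (1 ℕ.+ h)) (pow h) (cast (double (suc h)))
      (pow g) (pow (suc g)) (pow (suc a)) (cast 3 ℚ.* pow a) /[q^ g ·[q-1]²])
  classNumber-even-odd h g {a} eq
    rewrite parity-double h | parity-suc-double g = fraction-cong (cast (double (suc h)))
    (multiple 4 (≡.cong +_ (double/2+ (suc h) 1))) (exponent (≡.cong +_ (double/2 (suc h))))
    (exponent (≡.cong (λ n → + n ℤ.- 1ℤ) (double/2 (suc h))))
    (exponent (≡.cong +_ (double/2 g))) (exponent (≡.cong +_ (suc-double+1/2 g)))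
    (exponent (+1 eq)) (multiple 3 eq) (double/2 g)

  classNumber-odd-even : ∀ h g {a} → + suc (double h) ℤ.- + double g ≡ + a → classNumber (suc (double h)) (double g) ≡
    (fraction (cast 4 ℚ.* pow (2 ℕ.+ h)) (pow (1 ℕ.+ h)) (pow h) (cast (suc (double h)))
      (pow g) (pow (suc g)) (cast 3 ℚ.* pow (suc a)) (pow a) /[q^ g ·[q-1]²])
  classNumber-odd-even h g {a} eq
    rewrite parity-suc-double h | parity-double g = fraction-cong (cast (suc (double h)))
    (multiple 4 (≡.cong +_ (suc-double+3/2 h))) (exponent (≡.cong +_ (suc-double+1/2 h))) (exponent (≡.cong +_ (double/2 h)))
    (exponent (≡.cong +_ (double/2 g))) (exponent (≡.cong +_ (double/2+ g 1)))
    (multiple 3 (+1 eq)) (exponent eq) (double/2 g)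

  classNumber-odd-odd : ∀ h g {a} → + suc (double h) ℤ.- + suc (double g) ≡ + a → classNumber (suc (double h)) (suc (double g)) ≡
    (fraction (pow (2 ℕ.+ h)) (pow (1 ℕ.+ h)) (cast 4 ℚ.* pow h) (cast (suc (double h)))
      (pow g) (pow (suc g)) (pow (suc a)) (cast 3 ℚ.* pow a) /[q^ g ·[q-1]²])
  classNumber-odd-odd h g {a} eq
    rewrite parity-suc-double h | parity-suc-double g = fraction-cong (cast (suc (double h)))
    (exponent (≡.cong +_ (suc-double+3/2 h))) (exponent (≡.cong +_ (suc-double+1/2 h))) (multiple 4 (≡.cong +_ (double/2 h)))
    (exponent (≡.cong +_ (double/2 g))) (exponent (≡.cong +_ (suc-double+1/2 g)))
    (exponent (+1 eq)) (multiple 3 eq) (double/2 g)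

  private
    cancel : ∀ {X N g} → X ≡ cast N ℚ.* cast (q ℕ.^ g ℕ.* (q ∸ 1) ℕ.^ 2) → X /[q^ g ·[q-1]²] ≡ cast N
    cancel {N = N} {g} ≡.refl = ≡.trans (ℚ.*-assoc (cast N) (cast D) _)
      (≡.trans (≡.cong (cast N ℚ.*_) (fromℤ-inverse D)) (ℚ.*-identityʳ (cast N)))
      where
      D : ℕ
      D = q ℕ.^ g ℕ.* (q ∸ 1) ℕ.^ 2
      instance
        q∸1≢0 : ℕ.NonZero (q ∸ 1)
        q∸1≢0 = ℕ.>-nonZero (ℕ.m<n⇒0<n∸m (ℕ.nonTrivial⇒n>1 q))
        D≢0 : ℕ.NonZero D
        D≢0 = ℕ.m*n≢0 (q ℕ.^ g) ((q ∸ 1) ℕ.^ 2) {{ℕ.m^n≢0 q g}} {{ℕ.m^n≢0 (q ∸ 1) 2}}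

    difference : ∀ {s} a b → s ≡ a ℕ.+ b → + s ℤ.- + b ≡ + a
    difference a b ≡.refl = ≡.trans (ℤ.m-n≡m⊖n (a ℕ.+ b) b)
      (≡.trans (ℤ.⊖-≥ (ℕ.m≤n+m b a)) (≡.cong +_ (ℕ.m+n∸n≡m a b)))

    suc-+-double : ∀ α β → suc (double (α ℕ.+ β)) ≡ double α ℕ.+ suc (double β)
    suc-+-double α β = ≡.trans (≡.cong suc (≡.sym (double-+ α β))) (≡.sym (ℕ.+-suc (double α) (double β)))

    by-parity : ∀ {a b c N} → Half a → Half b → Half c → c ℕ.+ b ≡ a ℕ.+ a →
      N ℕ.+ T c ≡ T (suc a) ℕ.+ T (a ∸ 1) ℕ.+ T a → cast N ≡ classNumber (a ℕ.+ b) b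
    by-parity {N = N} (even α) (even β) (even γ) cb eq rewrite double-+ α β = ≡.sym (≡.trans
      (classNumber-even-even (α ℕ.+ β) β (difference (double α) (double β) (≡.sym (double-+ α β))))
      (cancel {N = N} {β} (numerator-even-even α β γ N
        (double-injective (≡.trans (≡.sym (double-+ γ β)) (≡.trans cb (≡.sym (double≡ (double α)))))) eq)))
    by-parity {N = N} (odd α) (odd β) (odd γ) cb eq rewrite ℕ.+-suc (double α) (double β) | double-+ α β = ≡.sym (≡.trans
      (classNumber-even-odd (α ℕ.+ β) β (difference (suc (double α)) (suc (double β)) (≡.cong suc (suc-+-double α β))))
      (cancel {N = N} {β} (numerator-odd-odd α β γ N
        (double-injective (ℕ.suc-injective (ℕ.suc-injective (≡.trans (≡.sym (≡.trans (≡.cong suc (ℕ.+-suc (double γ) (double β))) (≡.cong (suc ∘ suc) (double-+ γ β))))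
          (≡.trans cb (≡.sym (double≡ (suc (double α))))))))) eq)))
    by-parity {N = N} (odd α) (even β) (even γ) cb eq rewrite double-+ α β = ≡.sym (≡.trans
      (classNumber-odd-even (α ℕ.+ β) β (difference (suc (double α)) (double β) (≡.cong suc (≡.sym (double-+ α β)))))
      (cancel {N = N} {β} (numerator-odd-even α β γ N
        (double-injective (≡.trans (≡.sym (double-+ γ β)) (≡.trans cb (≡.sym (double≡ (suc (double α))))))) eq)))
    by-parity {N = N} (even α) (odd β) (odd γ) cb eq rewrite ℕ.+-suc (double α) (double β) | double-+ α β = ≡.sym (≡.trans
      (classNumber-odd-odd (α ℕ.+ β) β (difference (double α) (suc (double β)) (suc-+-double α β)))
      (cancel {N = N} {β} (numerator-even-odd α β γ N
        (double-injective (≡.trans (≡.sym (≡.trans (≡.cong suc (ℕ.+-suc (double γ) (double β))) (≡.cong (suc ∘ suc) (double-+ γ β))))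
          (≡.trans cb (≡.sym (double≡ (double α)))))) eq)))
    -- b and 2a - b have the same parity, so the remaining cases are void.
    by-parity {a} (_) (even β) (odd γ) cb eq =
      contradiction (≡.trans (≡.cong suc (≡.sym (double-+ γ β))) (≡.trans cb (≡.sym (double≡ a)))) suc-double≢double
    by-parity {a} (_) (odd β) (even γ) cb eq =
      contradiction (≡.trans (suc-+-double γ β) (≡.trans cb (≡.sym (double≡ a)))) suc-double≢double

  total≡classNumber : ∀ {a b} → a ℕ.≤ b → b ℕ.≤ a ℕ.+ a → cast (total a b) ≡ classNumber (a ℕ.+ b) b
  total≡classNumber {a} {b} a≤b b≤2a = by-parity (half a) (half b) (half (a ∸ (b ∸ a)))
    (≡.trans (≡.cong (a ∸ (b ∸ a) ℕ.+_) (≡.trans (≡.sym (ℕ.m+[n∸m]≡n a≤b)) (ℕ.+-comm a (b ∸ a))))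
      (≡.trans (≡.sym (ℕ.+-assoc (a ∸ (b ∸ a)) (b ∸ a) a)) (≡.cong (ℕ._+ a) (ℕ.m∸n+n≡m e≤a))))
    (≡.subst (λ b′ → total a b′ ℕ.+ T (a ∸ (b ∸ a)) ≡ T (suc a) ℕ.+ T (a ∸ 1) ℕ.+ T a) (ℕ.m+[n∸m]≡n a≤b) (total-T a (b ∸ a) e≤a))
    where
    e≤a : b ∸ a ℕ.≤ a
    e≤a = ℕ.m≤n+o⇒m∸n≤o b a b≤2a

-- The setting: a subfield of E with its ring of integers.

least : ∀ {p} {Q : ℕ → Set p} → (∀ k → Dec (Q k)) → ∀ n → Q n →
        ∃[ m ] m ℕ.≤ n × Q m × (∀ {k} → k ℕ.< m → ¬ Q k)
least Q? zero    Qn = zero , z≤n , Qn , λ ()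
least Q? (suc n) Qn with Q? 0
... | yes Q0 = zero , z≤n , Q0 , λ ()
... | no ¬Q0 with least (Q? ∘ suc) n Qn
... | m , m≤n , Qm , below = suc m , s≤s m≤n , Qm ,
      λ { {zero} _ → ¬Q0 ; {suc k} (s≤s k<m) → below k<m }

-- F enters through its image in E, so that all computations take place in one ring. A uniformiser
-- of E that lies in K expresses that the extension is unramified.
record Subfield {c ℓ} (E : DiscretelyValuedField c ℓ) k : Set (c ⊔ ℓ ⊔ lsuc k) where
  open DiscretelyValuedField E
  open Valuation E
  field
    K           : Pred Carrier k
    K-isSubring : IsSubring commutativeRing K
    K-inverse   : ∀ {x y} → K x → x * y ≈ 1# → K y
    ϖ           : Carrier
    ϖ∈K         : K ϖ
    v-ϖ         : v ϖ ≡ [ 1ℤ ]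

  𝔬 : Pred Carrier k
  𝔬 x = K x × V 0 x

module Scalars {c ℓ} {E : DiscretelyValuedField c ℓ} {k} (S : Subfield E k) where
  open DiscretelyValuedField E hiding (π)
  open Valuation E
  open Subfield S
  open Uniformiser E v-ϖ
  open IntegerSolver commutativeRing
  open LinearCombination commutativeRing
  private module K = IsSubring K-isSubring

  𝔬-+ : ∀ {x y} → 𝔬 x → 𝔬 y → 𝔬 (x + y)
  𝔬-+ (Kx , Vx) (Ky , Vy) = K.+-closed Kx Ky , v-+ Vx Vy

  𝔬-* : ∀ {x y} → 𝔬 x → 𝔬 y → 𝔬 (x * y)
  𝔬-* (Kx , Vx) (Ky , Vy) = K.*-closed Kx Ky , V-* Vx Vy

  𝔬-neg : ∀ {x} → 𝔬 x → 𝔬 (- x)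
  𝔬-neg (Kx , Vx) = K.neg-closed Kx , V-neg Vx

  𝔬-- : ∀ {x y} → 𝔬 x → 𝔬 y → 𝔬 (x - y)
  𝔬-- 𝔬x 𝔬y = 𝔬-+ 𝔬x (𝔬-neg 𝔬y)

  𝔬-0# : 𝔬 0#
  𝔬-0# = K.0-closed , V-0#

  𝔬-1# : 𝔬 1#
  𝔬-1# = K.1-closed , V-1#

  𝔬-ϖ^ : ∀ n → 𝔬 (ϖ^ n)
  𝔬-ϖ^ n = K-ϖ^ n , ϖ^-integral n
    where
    K-ϖ^ : ∀ n → K (ϖ^ n)
    K-ϖ^ zero    = K.resp (sym ϖ^-zero) K.1-closed
    K-ϖ^ (suc n) = K.resp (sym (ϖ^-suc n)) (K.*-closed ϖ∈K (K-ϖ^ n))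

  V-divide : ∀ n {x} → V n x → ∃[ y ] V 0 y × x ≈ ϖ^ n * y × (K x → K y)
  V-divide n {x} Vx with invertible (ϖ^≉0 n)
  ... | u , ϖu≈1 = u * x , V-ϖ^-cancel n (≡.subst (λ m → V m (ϖ^ n * (u * x))) (≡.sym (ℕ.+-identityʳ n)) (V-resp x≈ Vx))
                 , x≈ , K.*-closed (K-inverse (proj₁ (𝔬-ϖ^ n)) ϖu≈1)
    where
    x≈ : x ≈ ϖ^ n * (u * x)
    x≈ = linear (- x) ϖu≈1
      (solve 3 (λ x p u → x :- p :* (u :* x) := (:- x) :* (p :* u :- con 1ℤ)) refl x (ϖ^ n) u)

  𝔬-divide : ∀ n {x} → 𝔬 x → V n x → ∃[ y ] 𝔬 y × x ≈ ϖ^ n * y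
  𝔬-divide n (Kx , _) Vx with V-divide n Vx
  ... | y , Vy , x≈ , K⇒ = y , (K⇒ Kx , Vy) , x≈

  𝔬-inverse : ∀ {x} → 𝔬 x → ¬ V 1 x → ∃[ y ] 𝔬 y × U y × x * y ≈ 1#
  𝔬-inverse (Kx , Vx) ¬Vx with U-inverse (Vx , ¬Vx)
  ... | y , Uy , xy≈1 = y , (K-inverse Kx xy≈1 , proj₁ Uy) , Uy , xy≈1

  record IsModule {p} (N : Pred Carrier p) : Set (c ⊔ ℓ ⊔ k ⊔ p) where
    field
      resp     : ∀ {x y} → x ≈ y → N x → N y
      +-closed : ∀ {x y} → N x → N y → N (x + y)
      *-closed : ∀ {a x} → 𝔬 a → N x → N (a * x)

-- What the counting uses of an unramified cubic extension E/F: K is the image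
-- of F in E, `digit` enumerates its residue field, `dependence` says that
-- [E : F] ≤ 3 and `residue-extension` that the residue degree is at least 3.
record UnramifiedCubic {c ℓ} (E : DiscretelyValuedField c ℓ) k : Set (c ⊔ ℓ ⊔ lsuc k) where
  open DiscretelyValuedField E
  open Valuation E
  field
    subfield : Subfield E k
  open Subfield subfield public
  field
    q               : ℕ
    digit           : Fin q → Carrier
    digit∈𝔬         : ∀ d → 𝔬 (digit d)
    digit-injective : ∀ {d d′} → V 1 (digit d - digit d′) → d ≡ d′
    digit-surjective : ∀ {x} → 𝔬 x → ∃[ d ] V 1 (x - digit d)
    dependence      : ∀ x₀ x₁ x₂ x₃ → Σ[ c₀ ∈ Carrier ] Σ[ c₁ ∈ Carrier ] Σ[ c₂ ∈ Carrier ] Σ[ c₃ ∈ Carrier ]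
      (𝔬 c₀ × 𝔬 c₁ × 𝔬 c₂ × 𝔬 c₃)
      × ¬ (V 1 c₀ × V 1 c₁ × V 1 c₂ × V 1 c₃)
      × c₀ * x₀ + c₁ * x₁ + c₂ * x₂ + c₃ * x₃ ≈ 0#
    residue-extension : ∀ {x} → V 0 x →
      ∃[ z ] V 0 z × (∀ {c d} → 𝔬 c → 𝔬 d → ¬ V 1 (z - (c + d * x)))

-- Coordinates with respect to 1, w and w².

module Cubic {c ℓ} {E : DiscretelyValuedField c ℓ} {k} (X : UnramifiedCubic E k) where
  open DiscretelyValuedField E hiding (π)
  open Valuation E
  open UnramifiedCubic X
  open Uniformiser E v-ϖ
  open IntegerSolver commutativeRing
  open LinearCombination commutativeRing
  open Scalars subfield public

  -- The residues of 1 and w are linearly independent over the residue field of F.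
  Ind : Pred Carrier (c ⊔ k)
  Ind w = V 0 w × (∀ {c} → 𝔬 c → ¬ V 1 (w - c))

  Ind-independent : ∀ {w c d} → Ind w → 𝔬 c → 𝔬 d → V 1 (c + d * w) → V 1 c × V 1 d
  Ind-independent {w} {c} {d} (Vw , ¬V) 𝔬c 𝔬d Vc+dw with V? 1 d
  ... | yes Vd = V-resp (solve 3 (λ c d w → (c :+ d :* w) :- d :* w := c) refl c d w)
                        (V-- Vc+dw (V-*ʳ Vd Vw)) , Vd
  ... | no ¬Vd with 𝔬-inverse 𝔬d ¬Vd
  ... | e , 𝔬e , _ , de≈1 = contradiction
    (V-resp (linear w de≈1 (solve 4 (λ c d e w →
               e :* (c :+ d :* w) :- (w :- :- (e :* c)) := w :* (d :* e :- con 1ℤ)) refl c d e w))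
            (V-*ˡ (proj₂ 𝔬e) Vc+dw))
    (¬V (𝔬-neg (𝔬-* 𝔬e 𝔬c)))

  -- If w² were a combination of 1 and w modulo ϖ then the residues of 1 and w
  -- would span a quadratic subfield, over which E would have residue degree at
  -- least 2, so that 1, w, z, z w would be independent for a suitable z.
  Ind-quadratic : ∀ {w c d e} → Ind w → 𝔬 c → 𝔬 d → 𝔬 e →
                  V 1 (c + d * w + e * (w * w)) → V 1 c × V 1 d × V 1 e
  Ind-quadratic {w} {c} {d} {e} iw@(Vw , ¬V) 𝔬c 𝔬d 𝔬e Vs with V? 1 e
  ... | yes Ve = let (Vc , Vd) = Ind-independent iw 𝔬c 𝔬d
                       (V-resp (solve 3 (λ x e w → (x :+ e :* (w :* w)) :- e :* (w :* w) := x) refl (c + d * w) e w)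
                               (V-- Vs (V-*ʳ Ve (V-* Vw Vw))))
                 in Vc , Vd , Ve
  ... | no ¬Ve with 𝔬-inverse 𝔬e ¬Ve | residue-extension Vw
  ... | e′ , 𝔬e′ , _ , ee′≈1 | z , Vz , ¬Vz with dependence 1# w z (z * w)
  ... | c₀ , c₁ , c₂ , c₃ , (𝔬c₀ , 𝔬c₁ , 𝔬c₂ , 𝔬c₃) , nontrivial , relation = contradiction
    (U-cancel (proj₂ 𝔬N , ¬VN) (V-resp (sym N*z≈) (V-*ˡ V-cofactor Vδ)))
    (¬Vz (𝔬-neg (𝔬-* 𝔬M 𝔬P)) (𝔬-neg (𝔬-* 𝔬M 𝔬Q)))
    where
    -- Modulo ϖ the element w satisfies w² = α + β w, with error δ. The relation reads κ z + c₀ + c₁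
    -- w = 0. The conjugation w ↦ β - w takes κ to κ′, and N is the norm κ κ′ up to a multiple of δ.
    -- Multiplication by κ′ turns the relation into N z ≡ -(P + Q w), and division by the unit N
    -- puts z into 𝔬 + 𝔬 w modulo ϖ, against the choice of z.
    α β δ κ κ′ N P Q : Carrier
    α = - (e′ * c)
    β = - (e′ * d)
    δ = w * w - (α + β * w)
    κ = c₂ + c₃ * w
    κ′ = (c₂ + c₃ * β) + (- c₃) * w
    N = c₂ * c₂ + c₂ * c₃ * β - c₃ * c₃ * α
    P = (c₂ + c₃ * β) * c₀ - c₃ * c₁ * α
    Q = (c₂ + c₃ * β) * c₁ - c₃ * c₀ - c₃ * c₁ * β

    𝔬α : 𝔬 α
    𝔬α = 𝔬-neg (𝔬-* 𝔬e′ 𝔬c)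
    𝔬β : 𝔬 β
    𝔬β = 𝔬-neg (𝔬-* 𝔬e′ 𝔬d)

    𝔬c₂+c₃β : 𝔬 (c₂ + c₃ * β)
    𝔬c₂+c₃β = 𝔬-+ 𝔬c₂ (𝔬-* 𝔬c₃ 𝔬β)

    𝔬N : 𝔬 N
    𝔬N = 𝔬-- (𝔬-+ (𝔬-* 𝔬c₂ 𝔬c₂) (𝔬-* (𝔬-* 𝔬c₂ 𝔬c₃) 𝔬β)) (𝔬-* (𝔬-* 𝔬c₃ 𝔬c₃) 𝔬α)

    𝔬P : 𝔬 P
    𝔬P = 𝔬-- (𝔬-* 𝔬c₂+c₃β 𝔬c₀) (𝔬-* (𝔬-* 𝔬c₃ 𝔬c₁) 𝔬α)

    𝔬Q : 𝔬 Q
    𝔬Q = 𝔬-- (𝔬-- (𝔬-* 𝔬c₂+c₃β 𝔬c₁) (𝔬-* 𝔬c₃ 𝔬c₀)) (𝔬-* (𝔬-* 𝔬c₃ 𝔬c₁) 𝔬β)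

    Vδ : V 1 δ
    Vδ = V-resp (linear (w * w) ee′≈1 (solve 5 (λ c d e e′ w →
           e′ :* (c :+ d :* w :+ e :* (w :* w)) :- (w :* w :- (:- (e′ :* c) :+ :- (e′ :* d) :* w))
             := (w :* w) :* (e :* e′ :- con 1ℤ)) refl c d e e′ w))
           (V-*ˡ (proj₂ 𝔬e′) Vs)

    N≈ : N ≈ κ * κ′ + c₃ * c₃ * δ
    N≈ = solve 5 (λ c₂ c₃ w α β →
      c₂ :* c₂ :+ c₂ :* c₃ :* β :- c₃ :* c₃ :* α :=
      (c₂ :+ c₃ :* w) :* ((c₂ :+ c₃ :* β) :+ (:- c₃) :* w) :+ c₃ :* c₃ :* (w :* w :- (α :+ β :* w)))
      refl c₂ c₃ w α β

    κz≈ : κ * z + (c₀ + c₁ * w) ≈ 0#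
    κz≈ = linear 1# relation (solve 6 (λ c₀ c₁ c₂ c₃ w z →
      ((c₂ :+ c₃ :* w) :* z :+ (c₀ :+ c₁ :* w)) :- con 0ℤ :=
      con 1ℤ :* (c₀ :* con 1ℤ :+ c₁ :* w :+ c₂ :* z :+ c₃ :* (z :* w) :- con 0ℤ)) refl c₀ c₁ c₂ c₃ w z)

    ¬Vκ : ¬ V 1 κ
    ¬Vκ Vκ with Ind-independent iw 𝔬c₂ 𝔬c₃ Vκ
    ... | Vc₂ , Vc₃ with Ind-independent iw 𝔬c₀ 𝔬c₁
      (V-resp (linear (- 1#) κz≈ (solve 3 (λ κ z S →
        (:- (κ :* z)) :- S := (:- con 1ℤ) :* ((κ :* z :+ S) :- con 0ℤ)) refl κ z (c₀ + c₁ * w)))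
        (V-neg (V-*ʳ Vκ Vz)))
    ... | Vc₀ , Vc₁ = nontrivial (Vc₀ , Vc₁ , Vc₂ , Vc₃)

    ¬Vκ′ : ¬ V 1 κ′
    ¬Vκ′ Vκ′ with Ind-independent iw 𝔬c₂+c₃β (𝔬-neg 𝔬c₃) Vκ′
    ... | Vc₂+c₃β , V-c₃ = ¬Vκ (v-+
      (V-resp (solve 2 (λ x y → x :+ y :- y := x) refl c₂ (c₃ * β)) (V-- Vc₂+c₃β (V-*ʳ Vc₃ (proj₂ 𝔬β))))
      (V-*ʳ Vc₃ Vw))
      where
      Vc₃ : V 1 c₃
      Vc₃ = V-neg⁻¹ V-c₃

    Vκ : V 0 κ
    Vκ = v-+ (proj₂ 𝔬c₂) (V-* (proj₂ 𝔬c₃) Vw)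

    Vκ′ : V 0 κ′
    Vκ′ = v-+ (proj₂ 𝔬c₂+c₃β) (V-* (proj₂ (𝔬-neg 𝔬c₃)) Vw)

    ¬VN : ¬ V 1 N
    ¬VN VN = proj₂ (U-* (Vκ , ¬Vκ) (Vκ′ , ¬Vκ′))
      (V-resp (linear 1# N≈ (solve 3 (λ N x y → (N :- y) :- x := con 1ℤ :* (N :- (x :+ y))) refl N (κ * κ′) (c₃ * c₃ * δ)))
        (V-- VN (V-*ˡ (V-* (proj₂ 𝔬c₃) (proj₂ 𝔬c₃)) Vδ)))

    N⁻¹ : ∃[ y ] 𝔬 y × U y × N * y ≈ 1#
    N⁻¹ = 𝔬-inverse 𝔬N ¬VN
    M : Carrier
    M = proj₁ N⁻¹
    𝔬M : 𝔬 M
    𝔬M = proj₁ (proj₂ N⁻¹)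

    V-cofactor : V 0 (c₃ * c₃ * z + c₃ * c₁)
    V-cofactor = v-+ (V-* (V-* (proj₂ 𝔬c₃) (proj₂ 𝔬c₃)) Vz) (V-* (proj₂ 𝔬c₃) (proj₂ 𝔬c₁))

    P+Qw≈ : P + Q * w ≈ κ′ * (c₀ + c₁ * w) + c₃ * c₁ * δ
    P+Qw≈ = solve 7 (λ b c₀ c₁ c₃ w α β →
      (b :* c₀ :- c₃ :* c₁ :* α) :+ (b :* c₁ :- c₃ :* c₀ :- c₃ :* c₁ :* β) :* w :=
      (b :+ (:- c₃) :* w) :* (c₀ :+ c₁ :* w) :+ c₃ :* c₁ :* (w :* w :- (α :+ β :* w)))
      refl (c₂ + c₃ * β) c₀ c₁ c₃ w α β

    N*z≈ : N * (z - (- (M * P) + - (M * Q) * w)) ≈ (c₃ * c₃ * z + c₃ * c₁) * δ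
    N*z≈ = begin
      N * (z - (- (M * P) + - (M * Q) * w))
        ≈⟨ solve 6 (λ N z M P Q w → N :* (z :- (:- (M :* P) :+ :- (M :* Q) :* w))
             := N :* z :+ (N :* M) :* (P :+ Q :* w)) refl N z M P Q w ⟩
      N * z + (N * M) * (P + Q * w)
        ≈⟨ +-cong (*-congʳ N≈) (trans (*-congʳ (proj₂ (proj₂ (proj₂ N⁻¹)))) (trans (*-identityˡ _) P+Qw≈)) ⟩
      (κ * κ′ + c₃ * c₃ * δ) * z + (κ′ * (c₀ + c₁ * w) + c₃ * c₁ * δ)
        ≈⟨ linear κ′ κz≈ (solve 7 (λ κ κ′ g δ z S h →
             ((κ :* κ′ :+ g :* δ) :* z :+ (κ′ :* S :+ h :* δ)) :- (g :* z :+ h) :* δ :=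
             κ′ :* ((κ :* z :+ S) :- con 0ℤ)) refl κ κ′ (c₃ * c₃) δ z (c₀ + c₁ * w) (c₃ * c₁)) ⟩
      (c₃ * c₃ * z + c₃ * c₁) * δ ∎
      where open SetoidReasoning setoid

  ≡⇒V : ∀ {m n x} → m ≡ n → V m x → V n x
  ≡⇒V ≡.refl Vx = Vx

  opaque
    -- Induction on n: the coefficients are divisible by ϖⁿ already, and `Ind-quadratic` applies to
    -- the quotients. Thus the valuation of a combination is the minimum over its coefficients.
    Ind-valuation : ∀ {w c d e} → Ind w → 𝔬 c → 𝔬 d → 𝔬 e →
                    ∀ n → V n (c + d * w + e * (w * w)) → V n c × V n d × V n e
    Ind-valuation iw 𝔬c 𝔬d 𝔬e zero    _  = proj₂ 𝔬c , proj₂ 𝔬d , proj₂ 𝔬e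
    Ind-valuation {w} {c} {d} {e} iw 𝔬c 𝔬d 𝔬e (suc n) Vs
      with Ind-valuation iw 𝔬c 𝔬d 𝔬e n (V-mono (ℕ.n≤1+n n) Vs)
    ... | Vc , Vd , Ve with 𝔬-divide n 𝔬c Vc | 𝔬-divide n 𝔬d Vd | 𝔬-divide n 𝔬e Ve
    ... | c′ , 𝔬c′ , c≈ | d′ , 𝔬d′ , d≈ | e′ , 𝔬e′ , e≈
        with Ind-quadratic iw 𝔬c′ 𝔬d′ 𝔬e′ (V-ϖ^-cancel n (≡⇒V (ℕ.+-comm 1 n) (V-resp (begin
          c + d * w + e * (w * w)   ≈⟨ +-cong (+-cong c≈ (*-congʳ d≈)) (*-congʳ e≈) ⟩
          p * c′ + (p * d′) * w + (p * e′) * (w * w)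
            ≈⟨ solve 5 (λ p c d e w → p :* c :+ (p :* d) :* w :+ (p :* e) :* (w :* w)
                         := p :* (c :+ d :* w :+ e :* (w :* w))) refl p c′ d′ e′ w ⟩
          p * (c′ + d′ * w + e′ * (w * w)) ∎) Vs)))
        where
        open SetoidReasoning setoid
        p : Carrier
        p = ϖ^ n
    ... | Vc′ , Vd′ , Ve′ = lift′ c≈ Vc′ , lift′ d≈ Vd′ , lift′ e≈ Ve′
      where
      lift′ : ∀ {x y} → x ≈ ϖ^ n * y → V 1 y → V (suc n) x
      lift′ x≈ Vy = ≡⇒V (ℕ.+-comm n 1) (V-resp (sym x≈) (V-ϖ^* n Vy))

    -- In a relation between 1, w, w² and x the coefficient of x is a unit; otherwise
    -- `Ind-quadratic` would make the other three divisible by ϖ as well.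
    Ind-span : ∀ {w x} → Ind w → V 0 x → Σ[ c ∈ Carrier ] Σ[ d ∈ Carrier ] Σ[ e ∈ Carrier ]
               (𝔬 c × 𝔬 d × 𝔬 e) × x ≈ c + d * w + e * (w * w)
    Ind-span {w} {x} iw Vx with dependence 1# w (w * w) x
    ... | c₀ , c₁ , c₂ , c₃ , (𝔬c₀ , 𝔬c₁ , 𝔬c₂ , 𝔬c₃) , nontrivial , relation with V? 1 c₃
    ... | yes Vc₃ = let (V₀ , V₁ , V₂) = Ind-quadratic iw 𝔬c₀ 𝔬c₁ 𝔬c₂ (V-resp
                          (linear (- 1#) relation (solve 6 (λ c₀ c₁ c₂ c₃ w x →
                            (:- (c₃ :* x)) :- (c₀ :+ c₁ :* w :+ c₂ :* (w :* w)) := (:- con 1ℤ) :*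
                            (c₀ :* con 1ℤ :+ c₁ :* w :+ c₂ :* (w :* w) :+ c₃ :* x :- con 0ℤ)) refl c₀ c₁ c₂ c₃ w x))
                          (V-neg (V-*ʳ Vc₃ Vx)))
                    in contradiction (V₀ , V₁ , V₂ , Vc₃) nontrivial
    ... | no ¬Vc₃ with 𝔬-inverse 𝔬c₃ ¬Vc₃
    ... | u , 𝔬u , _ , c₃u≈1 = - (u * c₀) , - (u * c₁) , - (u * c₂)
      , (𝔬-neg (𝔬-* 𝔬u 𝔬c₀) , 𝔬-neg (𝔬-* 𝔬u 𝔬c₁) , 𝔬-neg (𝔬-* 𝔬u 𝔬c₂))
      , linear₂ (- x) u c₃u≈1 relation (solve 7 (λ c₀ c₁ c₂ c₃ w x u →
          x :- (:- (u :* c₀) :+ :- (u :* c₁) :* w :+ :- (u :* c₂) :* (w :* w)) :=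
          (:- x) :* (c₃ :* u :- con 1ℤ) :+
          u :* (c₀ :* con 1ℤ :+ c₁ :* w :+ c₂ :* (w :* w) :+ c₃ :* x :- con 0ℤ)) refl c₀ c₁ c₂ c₃ w x u)

    Ind-combination : ∀ {w c d e} → Ind w → 𝔬 c → 𝔬 d → 𝔬 e → ¬ (V 1 d × V 1 e) → Ind (c + d * w + e * (w * w))
    Ind-combination {w} {c} {d} {e} iw 𝔬c 𝔬d 𝔬e ¬V =
        v-+ (v-+ (proj₂ 𝔬c) (V-* (proj₂ 𝔬d) (proj₁ iw))) (V-* (proj₂ 𝔬e) (V-* (proj₁ iw) (proj₁ iw)))
      , λ {c′} 𝔬c′ V-c′ → ¬V (proj₂ (Ind-quadratic iw (𝔬-- 𝔬c 𝔬c′) 𝔬d 𝔬e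
          (V-resp (solve 4 (λ c y z c′ → (c :+ y :+ z) :- c′ := (c :- c′) :+ y :+ z) refl
            c (d * w) (e * (w * w)) c′) V-c′)))

    Ind-combination⁻¹ : ∀ {w c d e} → V 0 w → 𝔬 c → Ind (c + d * w + e * (w * w)) → ¬ (V 1 d × V 1 e)
    Ind-combination⁻¹ {w} {c} {d} {e} Vw 𝔬c (_ , ¬V) (Vd , Ve) = ¬V 𝔬c
      (V-resp (solve 3 (λ c y z → y :+ z := (c :+ y :+ z) :- c) refl c (d * w) (e * (w * w)))
        (v-+ (V-*ʳ Vd Vw) (V-*ʳ Ve (V-* Vw Vw))))

    Ind-exists : ∃ Ind
    Ind-exists with residue-extension V-0#
    ... | z , Vz , ¬V = z , Vz , λ {c} 𝔬c Vz-c → ¬V 𝔬c 𝔬-0#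
      (V-resp (solve 2 (λ z c → z :- c := z :- (c :+ con 0ℤ :* con 0ℤ)) refl z c) Vz-c)

  -- Representatives modulo ϖⁿ, and lattices in coordinates.

  -- Expansions in n digits, lowest first: a system of representatives of 𝔬/ϖⁿ, indexed so that
  -- quantifiers over it are decidable.
  expand : ∀ n → Fin (q ℕ.^ n) → Carrier
  expand zero    _ = 0#
  expand (suc n) d = digit (proj₁ (Fin.remQuot {q} (q ℕ.^ n) d)) + ϖ * expand n (proj₂ (Fin.remQuot {q} (q ℕ.^ n) d))

  V-ϖ : V 1 ϖ
  V-ϖ rewrite v-ϖ = [ ℤ.≤-refl ]

  𝔬-ϖ : 𝔬 ϖ
  𝔬-ϖ = ϖ∈K , V-mono z≤n V-ϖ

  ϖ^1≈ϖ : ϖ^ 1 ≈ ϖ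
  ϖ^1≈ϖ = trans (ϖ^-suc 0) (trans (*-congˡ ϖ^-zero) (*-identityʳ ϖ))

  opaque
    expand∈𝔬 : ∀ n d → 𝔬 (expand n d)
    expand∈𝔬 zero    d = 𝔬-0#
    expand∈𝔬 (suc n) d = 𝔬-+ (digit∈𝔬 _) (𝔬-* 𝔬-ϖ (expand∈𝔬 n _))

    expand-surjective : ∀ n {x} → 𝔬 x → ∃[ d ] V n (x - expand n d)
    expand-surjective zero    𝔬x = Fin.zero , proj₂ (𝔬-- 𝔬x 𝔬-0#)
    expand-surjective (suc n) {x} 𝔬x with digit-surjective 𝔬x
    ... | a , Va with 𝔬-divide 1 (𝔬-- 𝔬x (digit∈𝔬 a)) Va
    ... | y , 𝔬y , x-a≈ with expand-surjective n 𝔬y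
    ... | b , Vb = Fin.combine a b , V-resp (begin
      ϖ^ 1 * (y - expand n b)         ≈⟨ linear₂ (- 1#) (- expand n b) x-a≈ ϖ^1≈ϖ
                                             (solve 6 (λ p y b x a q → p :* (y :- b) :- (x :- (a :+ q :* b)) :=
                                               (:- con 1ℤ) :* ((x :- a) :- p :* y) :+ (:- b) :* (p :- q))
                                               refl (ϖ^ 1) y (expand n b) x (digit a) ϖ) ⟩
      x - (digit a + ϖ * expand n b)   ≡⟨ ≡.cong (λ (a , b) → x - (digit a + ϖ * expand n b)) (Fin.remQuot-combine a b) ⟨
      x - expand (suc n) (Fin.combine a b) ∎) (V-ϖ^* 1 Vb)
      where open SetoidReasoning setoid

    expand-injective : ∀ n {d d′} → V n (expand n d - expand n d′) → d ≡ d′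
    expand-injective zero    {Fin.zero} {Fin.zero} _ = ≡.refl
    expand-injective (suc n) {d} {d′} Vdd′ = begin
      d                        ≡⟨ Fin.combine-remQuot {q} (q ℕ.^ n) d ⟨
      Fin.combine a b          ≡⟨ ≡.cong₂ Fin.combine a≡a′ (expand-injective n Vbb′) ⟩
      Fin.combine a′ b′        ≡⟨ Fin.combine-remQuot {q} (q ℕ.^ n) d′ ⟩
      d′                       ∎
      where
      open ≡.≡-Reasoning
      a a′ : Fin q
      a  = proj₁ (Fin.remQuot {q} (q ℕ.^ n) d)
      a′ = proj₁ (Fin.remQuot {q} (q ℕ.^ n) d′)
      b b′ : Fin (q ℕ.^ n)
      b  = proj₂ (Fin.remQuot {q} (q ℕ.^ n) d)
      b′ = proj₂ (Fin.remQuot {q} (q ℕ.^ n) d′)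
      a≡a′ : a ≡ a′
      a≡a′ = digit-injective (V-resp
        (solve 5 (λ a a′ b b′ p → ((a :+ p :* b) :- (a′ :+ p :* b′)) :- p :* (b :- b′) := a :- a′)
          refl (digit a) (digit a′) (expand n b) (expand n b′) ϖ)
        (V-- (V-mono (s≤s z≤n) Vdd′) (V-*ʳ V-ϖ (proj₂ (𝔬-- (expand∈𝔬 n b) (expand∈𝔬 n b′))))))
      Vbb′ : V n (expand n b - expand n b′)
      Vbb′ = V-ϖ^-cancel 1 (V-resp (linear₂ 1# (expand n b - expand n b′) (reflexive (≡.cong digit a≡a′)) (sym ϖ^1≈ϖ)
        (solve 6 (λ a a′ b b′ p p′ → ((a :+ p :* b) :- (a′ :+ p :* b′)) :- p′ :* (b :- b′) :=
           con 1ℤ :* (a :- a′) :+ (b :- b′) :* (p :- p′)) refl (digit a) (digit a′) (expand n b) (expand n b′) ϖ (ϖ^ 1))) Vdd′)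

  -- The index f is a known precision: membership depends only on the class modulo ϖᶠ.
  record IsLattice {p} (f : ℕ) (P : Pred Carrier p) : Set (c ⊔ ℓ ⊔ k ⊔ p) where
    field
      resp     : ∀ {x y} → x ≈ y → P x → P y
      +-closed : ∀ {x y} → P x → P y → P (x + y)
      *-closed : ∀ {a x} → 𝔬 a → P x → P (a * x)
      1-closed : P 1#
      V-⊆      : ∀ {x} → V f x → P x
      integral : ∀ {x} → P x → V 0 x

    𝔬-⊆ : ∀ {a} → 𝔬 a → P a
    𝔬-⊆ 𝔬a = resp (*-identityʳ _) (*-closed 𝔬a 1-closed)

    neg-closed : ∀ {x} → P x → P (- x)
    neg-closed Px = resp (RingProperties.-1*x≈-x ring _) (*-closed (𝔬-neg 𝔬-1#) Px)

    sub-closed : ∀ {x y} → P x → P y → P (x - y)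
    sub-closed Px Py = +-closed Px (neg-closed Py)

  Lat : ℕ → ℕ → Carrier → Pred Carrier (c ⊔ k)
  Lat i j w x = ∃₂ λ a b → 𝔬 a × 𝔬 b × V j (x - (a + b * (ϖ^ i * w)))

  opaque
    Lat-V : ∀ {i j w x} → V j x → Lat i j w x
    Lat-V {i} {j} {w} {x} Vx = 0# , 0# , 𝔬-0# , 𝔬-0# , V-resp
      (solve 2 (λ x y → x := x :- (con 0ℤ :+ con 0ℤ :* y)) refl x (ϖ^ i * w)) Vx

    Lat-generator : ∀ {i j w} → Lat i j w (ϖ^ i * w)
    Lat-generator {i} {j} {w} = 0# , 1# , 𝔬-0# , 𝔬-1# , V-resp
      (solve 1 (λ y → con 0ℤ := y :- (con 0ℤ :+ con 1ℤ :* y)) refl (ϖ^ i * w)) V-0#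

    Lat-isLattice : ∀ {i j w} → V 0 w → IsLattice j (Lat i j w)
    Lat-isLattice {i} {j} {w} Vw = record
      { resp = λ { x≈y (a , b , 𝔬a , 𝔬b , Vx) → a , b , 𝔬a , 𝔬b , V-resp (+-congʳ x≈y) Vx }
      ; +-closed = λ { {x} {y} (a , b , 𝔬a , 𝔬b , Vx) (a′ , b′ , 𝔬a′ , 𝔬b′ , Vy) →
          a + a′ , b + b′ , 𝔬-+ 𝔬a 𝔬a′ , 𝔬-+ 𝔬b 𝔬b′ , V-resp
            (solve 7 (λ x y a b a′ b′ W → (x :- (a :+ b :* W)) :+ (y :- (a′ :+ b′ :* W)) :=
              (x :+ y) :- ((a :+ a′) :+ (b :+ b′) :* W)) refl x y a b a′ b′ (ϖ^ i * w)) (v-+ Vx Vy) }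
      ; *-closed = λ { {t} {x} 𝔬t (a , b , 𝔬a , 𝔬b , Vx) →
          t * a , t * b , 𝔬-* 𝔬t 𝔬a , 𝔬-* 𝔬t 𝔬b , V-resp
            (solve 5 (λ t x a b W → t :* (x :- (a :+ b :* W)) := t :* x :- (t :* a :+ (t :* b) :* W))
              refl t x a b (ϖ^ i * w)) (V-*ˡ (proj₂ 𝔬t) Vx) }
      ; 1-closed = 1# , 0# , 𝔬-1# , 𝔬-0# , V-resp
          (solve 1 (λ y → con 0ℤ := con 1ℤ :- (con 1ℤ :+ con 0ℤ :* y)) refl (ϖ^ i * w)) V-0#
      ; V-⊆ = Lat-V
      ; integral = λ { {x} (a , b , 𝔬a , 𝔬b , Vx) → V-resp
          (solve 2 (λ x s → (x :- s) :+ s := x) refl x (a + b * (ϖ^ i * w)))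
          (v-+ (V-mono z≤n Vx) (v-+ (proj₂ 𝔬a) (V-* (proj₂ 𝔬b) (V-* (ϖ^-integral i) Vw)))) }
      }

    Lat-least : ∀ {p f i j w} {P : Pred Carrier p} → IsLattice f P →
                P (ϖ^ i * w) → (∀ {x} → V j x → P x) → Lat i j w ⊆ P
    Lat-least {i = i} {w = w} P-lat PW V⊆ {x} (a , b , 𝔬a , 𝔬b , Vx) = resp
      (solve 2 (λ x s → (x :- s) :+ s := x) refl x (a + b * (ϖ^ i * w)))
      (+-closed (V⊆ Vx) (+-closed (𝔬-⊆ 𝔬a) (*-closed 𝔬b PW)))
      where open IsLattice P-lat

    -- The coefficients of 1, w, w² can be compared separately modulo ϖʲ, and i ≤ j lets the
    -- condition modulo ϖⁱ on d survive. Membership thereby becomes two divisibilities, hence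
    -- decidable.
    Lat-coordinates : ∀ {i j w a d e} → i ℕ.≤ j → Ind w → 𝔬 a → 𝔬 d → 𝔬 e →
                      Lat i j w (a + d * w + e * (w * w)) → V i d × V j e
    Lat-coordinates {i} {j} {w} {a} {d} {e} i≤j iw 𝔬a 𝔬d 𝔬e (a′ , b , 𝔬a′ , 𝔬b , Vx)
      with Ind-valuation iw (𝔬-- 𝔬a 𝔬a′) (𝔬-- 𝔬d (𝔬-* 𝔬b (𝔬-ϖ^ i))) 𝔬e j (V-resp
        (solve 7 (λ a d s a′ b p w → (a :+ d :* w :+ s) :- (a′ :+ b :* (p :* w)) :=
           (a :- a′) :+ (d :- b :* p) :* w :+ s) refl a d (e * (w * w)) a′ b (ϖ^ i) w) Vx)
    ... | _ , Vd , Ve = V-resp (solve 2 (λ d s → (d :- s) :+ s := d) refl d (b * ϖ^ i))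
                          (v-+ (V-mono i≤j Vd) (V-*ˡ (proj₂ 𝔬b) (V-ϖ^ i))) , Ve

    Lat-coordinates⁻¹ : ∀ {i j w a d e} → V 0 w → 𝔬 a → 𝔬 d → V i d → V j e →
                        Lat i j w (a + d * w + e * (w * w))
    Lat-coordinates⁻¹ {i} {j} {w} {a} {d} {e} Vw 𝔬a 𝔬d Vd Ve with 𝔬-divide i 𝔬d Vd
    ... | d′ , 𝔬d′ , d≈ = a , d′ , 𝔬a , 𝔬d′ , V-resp
      (sym (linear w d≈ (solve 6 (λ a d s d′ p w → ((a :+ d :* w :+ s) :- (a :+ d′ :* (p :* w))) :- s :=
         w :* (d :- p :* d′)) refl a d (e * (w * w)) d′ (ϖ^ i) w)))
      (V-*ʳ Ve (V-* Vw Vw))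

    Lat? : ∀ {i j w} → i ℕ.≤ j → Ind w → ∀ x → Dec (Lat i j w x)
    Lat? {i} {j} {w} i≤j iw x with V? 0 x
    ... | no ¬Vx = no (¬Vx ∘ IsLattice.integral (Lat-isLattice (proj₁ iw)))
    ... | yes Vx with Ind-span iw Vx
    ... | a , d , e , (𝔬a , 𝔬d , 𝔬e) , x≈ = map′
      (λ (Vd , Ve) → resp (sym x≈) (Lat-coordinates⁻¹ (proj₁ iw) 𝔬a 𝔬d Vd Ve))
      (λ Lx → Lat-coordinates i≤j iw 𝔬a 𝔬d 𝔬e (resp x≈ Lx))
      (V? i d ×-dec V? j e)
      where open IsLattice (Lat-isLattice {i} {j} (proj₁ iw))

  -- Normal form of a lattice with decidable membership.

  module _ {p f} {P : Pred Carrier p} (P-lat : IsLattice f P) (P? : ∀ x → Dec (P x)) where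
    open IsLattice P-lat
    private
      w₀ : Carrier
      w₀ = proj₁ Ind-exists
      iw₀ : Ind w₀
      iw₀ = proj₂ Ind-exists

      Full : ℕ → Set p
      Full n = P (ϖ^ n * w₀) × P (ϖ^ n * (w₀ * w₀))

      Full? : ∀ n → Dec (Full n)
      Full? n = P? _ ×-dec P? _

    opaque
      -- ϖⁿ O is spanned by ϖⁿ, ϖⁿ w and ϖⁿ w², and the first of these lies in 𝔬, hence in P.
      basis⇒⊆ : ∀ {n w} → Ind w → P (ϖ^ n * w) → P (ϖ^ n * (w * w)) → ∀ {x} → V n x → P x
      basis⇒⊆ {n} {w} iw Pw Pw² {x} Vx with V-divide n Vx
      ... | y , Vy , x≈ , _ with Ind-span iw Vy
      ... | a , d , e , (𝔬a , 𝔬d , 𝔬e) , y≈ = resp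
        (sym (linear₂ 1# (ϖ^ n) x≈ y≈ (solve 7 (λ x p y a d e w →
          x :- (p :* a :+ d :* (p :* w) :+ e :* (p :* (w :* w))) :=
          con 1ℤ :* (x :- p :* y) :+ p :* (y :- (a :+ d :* w :+ e :* (w :* w)))) refl x (ϖ^ n) y a d e w)))
        (+-closed (+-closed (𝔬-⊆ (𝔬-* (𝔬-ϖ^ n) 𝔬a)) (*-closed 𝔬d Pw)) (*-closed 𝔬e Pw²))

    private
      Hit : ℕ → Set (c ⊔ k ⊔ p)
      Hit n = ∃[ w ] Ind w × P (ϖ^ n * w)

      -- Makes `Hit` a finite search: 𝔬 ⊆ P lets the constant coordinate of w be dropped, and ϖᶠ O ⊆
      -- P lets the others be reduced. The precision is f + 1 rather than f in order that the
      -- residues of d and e, and with them independence, be determined even when f = 0.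
      Candidate : ℕ → Fin (q ℕ.^ suc f) → Fin (q ℕ.^ suc f) → Set p
      Candidate n d e = ¬ (V 1 (expand (suc f) d) × V 1 (expand (suc f) e))
        × P (ϖ^ n * (0# + expand (suc f) d * w₀ + expand (suc f) e * (w₀ * w₀)))

      Candidate? : ∀ n → Dec (∃₂ (Candidate n))
      Candidate? n = Fin.any? λ d → Fin.any? λ e → ¬? (V? 1 _ ×-dec V? 1 _) ×-dec P? _

      candidate⇒hit : ∀ {n} → ∃₂ (Candidate n) → Hit n
      candidate⇒hit (d , e , ¬V , Pw) =
        _ , Ind-combination iw₀ 𝔬-0# (expand∈𝔬 (suc f) d) (expand∈𝔬 (suc f) e) ¬V , Pw

      opaque
        hit⇒candidate : ∀ {n} → Hit n → ∃₂ (Candidate n)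
        hit⇒candidate {n} (w , iw , Pw) with Ind-span iw₀ (proj₁ iw)
        ... | a , d , e , (𝔬a , 𝔬d , 𝔬e) , w≈ with expand-surjective (suc f) 𝔬d | expand-surjective (suc f) 𝔬e
        ... | d′ , Vd | e′ , Ve = d′ , e′
          , (λ (Vd′ , Ve′) → Ind-combination⁻¹ (proj₁ iw₀) 𝔬a
               (V-resp w≈ (proj₁ iw) , λ 𝔬x → proj₂ iw 𝔬x ∘ V-resp (+-congʳ (sym w≈)))
               (mod Vd Vd′ , mod Ve Ve′))
          , resp (sym (linear (- (ϖ^ n)) w≈ (solve 8 (λ p w a d e d′ e′ w₀ →
              p :* (con 0ℤ :+ d′ :* w₀ :+ e′ :* (w₀ :* w₀)) :- ((p :* w :- p :* a) :- p :* ((d :- d′) :* w₀ :+ (e :- e′) :* (w₀ :* w₀)))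
              := (:- p) :* (w :- (a :+ d :* w₀ :+ e :* (w₀ :* w₀)))) refl (ϖ^ n) w a d e (expand (suc f) d′) (expand (suc f) e′) w₀)))
              (sub-closed (sub-closed Pw (𝔬-⊆ (𝔬-* (𝔬-ϖ^ n) 𝔬a)))
                (V-⊆ (V-*ˡ (ϖ^-integral n) (v-+ (V-*ʳ (V-mono (ℕ.n≤1+n f) Vd) (proj₁ iw₀))
                                               (V-*ʳ (V-mono (ℕ.n≤1+n f) Ve) (V-* (proj₁ iw₀) (proj₁ iw₀)))))))
          where
          mod : ∀ {x y} → V (suc f) (x - y) → V 1 y → V 1 x
          mod {x} {y} Vx-y Vy = V-resp (solve 2 (λ x y → (x :- y) :+ y := x) refl x y) (v-+ (V-mono (s≤s z≤n) Vx-y) Vy)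

      Hit? : ∀ n → Dec (Hit n)
      Hit? n = map′ candidate⇒hit hit⇒candidate (Candidate? n)

    -- j is the least exponent with ϖʲ O ⊆ P, and i the least one for which P
    -- contains ϖⁱ w with w independent of 1 modulo ϖ.
    opaque
      normal-form : Σ[ i ∈ ℕ ] Σ[ j ∈ ℕ ] Σ[ w ∈ Carrier ] i ℕ.≤ j × j ℕ.≤ f × Ind w × P ≐ Lat i j w
      normal-form with least Full? f (V-⊆ (V-*ʳ (V-ϖ^ f) (proj₁ iw₀)) , V-⊆ (V-*ʳ (V-ϖ^ f) (V-* (proj₁ iw₀) (proj₁ iw₀))))
      -- The element ϖʲ w₀ of P bounds the search for i by j.
      ... | j , j≤f , (Pw₀ , Pw₀²) , ¬full with least Hit? j (w₀ , iw₀ , Pw₀)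
      ... | i , i≤j , (w , iw , PW) , ¬hit = i , j , w , i≤j , j≤f , iw , P⊆ , Lat-least P-lat PW (basis⇒⊆ iw₀ Pw₀ Pw₀²)
        where
        module _ {x} (Px : P x) where
          -- If ϖⁿ with n < i were the exact power dividing both d and e, then (d w + e w²)/ϖⁿ would
          -- be independent of 1 and contradict the minimality of i.
          both : ∀ {d e} → 𝔬 d → 𝔬 e → P (d * w + e * (w * w)) → ∀ n → n ℕ.≤ i → V n d × V n e
          both 𝔬d 𝔬e Px′ zero    _ = proj₂ 𝔬d , proj₂ 𝔬e
          both {d} {e} 𝔬d 𝔬e Px′ (suc n) n<i with both 𝔬d 𝔬e Px′ n (ℕ.<⇒≤ n<i)
          ... | Vd , Ve with 𝔬-divide n 𝔬d Vd | 𝔬-divide n 𝔬e Ve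
          ... | d′ , 𝔬d′ , d≈ | e′ , 𝔬e′ , e≈ with V? 1 d′ ×-dec V? 1 e′
          ... | yes (Vd′ , Ve′) = ≡⇒V (ℕ.+-comm n 1) (V-resp (sym d≈) (V-ϖ^* n Vd′))
                                , ≡⇒V (ℕ.+-comm n 1) (V-resp (sym e≈) (V-ϖ^* n Ve′))
          ... | no ¬V = contradiction
            (0# + d′ * w + e′ * (w * w) , Ind-combination iw 𝔬-0# 𝔬d′ 𝔬e′ ¬V , resp
              (linear₂ w (w * w) d≈ e≈ (solve 6 (λ d e d′ e′ p w →
                (d :* w :+ e :* (w :* w)) :- p :* (con 0ℤ :+ d′ :* w :+ e′ :* (w :* w)) :=
                w :* (d :- p :* d′) :+ (w :* w) :* (e :- p :* e′)) refl d e d′ e′ (ϖ^ n) w)) Px′)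
            (¬hit n<i)

          -- If e had valuation m + i < j, then ϖᵐ⁺ⁱ w² would lie in P, as ϖᵐ⁺ⁱ w does, so that ϖᵐ⁺ⁱ
          -- O ⊆ P against the minimality of j.
          second : ∀ {e} → 𝔬 e → V i e → P (e * (w * w)) → ∀ m → m ℕ.+ i ℕ.≤ j → V (m ℕ.+ i) e
          second 𝔬e Ve Pe zero    _ = Ve
          second {e} 𝔬e Ve Pe (suc m) m<j with second 𝔬e Ve Pe m (ℕ.<⇒≤ m<j)
          ... | Vn with 𝔬-divide (m ℕ.+ i) 𝔬e Vn
          ... | e′ , 𝔬e′ , e≈ with V? 1 e′
          ... | yes Ve′ = ≡⇒V (ℕ.+-comm (m ℕ.+ i) 1) (V-resp (sym e≈) (V-ϖ^* (m ℕ.+ i) Ve′))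
          ... | no ¬Ve′ with 𝔬-inverse 𝔬e′ ¬Ve′
          ... | u , 𝔬u , _ , e′u≈1 = contradiction
            ( full (V-*ʳ (V-ϖ^ (m ℕ.+ i)) (proj₁ iw₀))
            , full (V-*ʳ (V-ϖ^ (m ℕ.+ i)) (V-* (proj₁ iw₀) (proj₁ iw₀)))) (¬full m<j)
            where
            full : ∀ {x} → V (m ℕ.+ i) x → P x
            full = basis⇒⊆ iw
              (resp (linear (- w) (ϖ^-homo m i) (solve 4 (λ m i r w → m :* (i :* w) :- r :* w := (:- w) :* (r :- m :* i))
                 refl (ϖ^ m) (ϖ^ i) (ϖ^ (m ℕ.+ i)) w)) (*-closed (𝔬-ϖ^ m) PW))
              (resp (linear₂ (u * (w * w)) (ϖ^ (m ℕ.+ i) * (w * w)) e≈ e′u≈1 (solve 5 (λ e e′ u w p →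
                 u :* (e :* (w :* w)) :- p :* (w :* w) := (u :* (w :* w)) :* (e :- p :* e′) :+ (p :* (w :* w)) :* (e′ :* u :- con 1ℤ))
                 refl e e′ u w (ϖ^ (m ℕ.+ i)))) (*-closed 𝔬u Pe))

        P⊆ : P ⊆ Lat i j w
        P⊆ {x} Px with Ind-span iw (integral Px)
        ... | a , d , e , (𝔬a , 𝔬d , 𝔬e) , x≈ = L.resp (sym x≈)
          (Lat-coordinates⁻¹ (proj₁ iw) 𝔬a 𝔬d (proj₁ Vs) (V-resp refl
            (≡⇒V (ℕ.m∸n+n≡m i≤j) (second Px 𝔬e (proj₂ Vs) Pe (j ∸ i) (ℕ.≤-reflexive (ℕ.m∸n+n≡m i≤j))))))
          where
          module L = IsLattice (Lat-isLattice {i} {j} (proj₁ iw))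
          Pde : P (d * w + e * (w * w))
          Pde = resp (linear 1# x≈ (solve 4 (λ x a y z → (x :- a) :- (y :+ z) := con 1ℤ :* (x :- (a :+ y :+ z)))
                        refl x a (d * w) (e * (w * w)))) (sub-closed Px (𝔬-⊆ 𝔬a))
          Vs : V i d × V i e
          Vs = both Px 𝔬d 𝔬e Pde i ℕ.≤-refl
          Pd : P (d * w)
          Pd with 𝔬-divide i 𝔬d (proj₁ Vs)
          ... | d′ , 𝔬d′ , d≈ = resp (linear (- w) d≈ (solve 4 (λ d d′ p w →
                d′ :* (p :* w) :- d :* w := (:- w) :* (d :- p :* d′)) refl d d′ (ϖ^ i) w)) (*-closed 𝔬d′ PW)
          Pe : P (e * (w * w))
          Pe = resp (solve 2 (λ y z → (y :+ z) :- y := z) refl (d * w) (e * (w * w))) (sub-closed Pde Pd)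

  -- Adjoining elements to a lattice.

  infixl 6 _⊞_
  _⊞_ : ∀ {p} → Pred Carrier p → Carrier → Pred Carrier (c ⊔ k ⊔ p)
  (P ⊞ x) z = ∃ λ a → 𝔬 a × P (z - a * x)

  module _ {p f} {P : Pred Carrier p} (P-lat : IsLattice f P) {x} (Vx : V 0 x) where
    open IsLattice P-lat

    ⊞-⊆ : ∀ {z} → P z → (P ⊞ x) z
    ⊞-⊆ {z} Pz = 0# , 𝔬-0# , resp (solve 2 (λ z x → z := z :- con 0ℤ :* x) refl z x) Pz

    ⊞-∋ : (P ⊞ x) x
    ⊞-∋ = 1# , 𝔬-1# , resp (solve 1 (λ x → con 0ℤ := x :- con 1ℤ :* x) refl x) (V-⊆ V-0#)

    ⊞-isLattice : IsLattice f (P ⊞ x)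
    ⊞-isLattice = record
      { resp = λ { z≈z′ (a , 𝔬a , Pz) → a , 𝔬a , resp (+-congʳ z≈z′) Pz }
      ; +-closed = λ { {z} {z′} (a , 𝔬a , Pz) (a′ , 𝔬a′ , Pz′) → a + a′ , 𝔬-+ 𝔬a 𝔬a′ , resp
          (solve 5 (λ z z′ a a′ x → (z :- a :* x) :+ (z′ :- a′ :* x) := (z :+ z′) :- (a :+ a′) :* x) refl z z′ a a′ x)
          (+-closed Pz Pz′) }
      ; *-closed = λ { {t} {z} 𝔬t (a , 𝔬a , Pz) → t * a , 𝔬-* 𝔬t 𝔬a , resp
          (solve 4 (λ t z a x → t :* (z :- a :* x) := t :* z :- (t :* a) :* x) refl t z a x) (*-closed 𝔬t Pz) }
      ; 1-closed = ⊞-⊆ 1-closed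
      ; V-⊆ = ⊞-⊆ ∘ V-⊆
      ; integral = λ { {z} (a , 𝔬a , Pz) → V-resp (solve 2 (λ z s → (z :- s) :+ s := z) refl z (a * x))
          (v-+ (integral Pz) (V-* (proj₂ 𝔬a) Vx)) }
      }

    -- The coefficient of x matters only modulo ϖᶠ, because x is integral and P contains ϖᶠ O.
    ⊞? : (∀ z → Dec (P z)) → ∀ z → Dec ((P ⊞ x) z)
    ⊞? P? z = map′ (λ (d , Pz) → expand f d , expand∈𝔬 f d , Pz)
      (λ (a , 𝔬a , Pz) → let (d , Vad) = expand-surjective f 𝔬a in d , resp
        (solve 4 (λ z a d x → (z :- a :* x) :+ (a :- d) :* x := z :- d :* x) refl z a (expand f d) x)
        (+-closed Pz (V-⊆ (V-*ʳ Vad Vx))))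
      (Fin.any? λ d → P? (z - expand f d * x))

  ⊞-least : ∀ {p p′} {P : Pred Carrier p} {Q : Pred Carrier p′} {x} → IsModule Q →
            P ⊆ Q → Q x → P ⊞ x ⊆ Q
  ⊞-least {x = x} Q-sub P⊆Q Qx {z} (a , 𝔬a , Pz) = resp (solve 2 (λ z s → (z :- s) :+ s := z) refl z (a * x))
    (+-closed (P⊆Q Pz) (*-closed 𝔬a Qx))
    where open IsModule Q-sub

  -- At level c ⊔ k, which `⊞` does not raise, the adjunction can be iterated.
  adjoin : ∀ {n} → Pred Carrier (c ⊔ k) → (Fin n → Carrier) → Pred Carrier (c ⊔ k)
  adjoin {zero}  P g = P
  adjoin {suc n} P g = adjoin P (g ∘ Fin.suc) ⊞ g Fin.zero

  adjoin-isLattice : ∀ {n f P} (g : Fin n → Carrier) → IsLattice f P → (∀ i → V 0 (g i)) → IsLattice f (adjoin P g)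
  adjoin-isLattice {zero}  g P-lat Vg = P-lat
  adjoin-isLattice {suc n} g P-lat Vg = ⊞-isLattice (adjoin-isLattice (g ∘ Fin.suc) P-lat (Vg ∘ Fin.suc)) (Vg Fin.zero)

  adjoin-⊆ : ∀ {n f P} (g : Fin n → Carrier) → IsLattice f P → (∀ i → V 0 (g i)) → P ⊆ adjoin P g
  adjoin-⊆ {zero}  g P-lat Vg Px = Px
  adjoin-⊆ {suc n} g P-lat Vg Px = ⊞-⊆ (adjoin-isLattice (g ∘ Fin.suc) P-lat (Vg ∘ Fin.suc)) (Vg Fin.zero)
    (adjoin-⊆ (g ∘ Fin.suc) P-lat (Vg ∘ Fin.suc) Px)

  adjoin-∋ : ∀ {n f P} (g : Fin n → Carrier) → IsLattice f P → (∀ i → V 0 (g i)) → ∀ i → adjoin P g (g i)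
  adjoin-∋ {suc n} g P-lat Vg Fin.zero    = ⊞-∋ (adjoin-isLattice (g ∘ Fin.suc) P-lat (Vg ∘ Fin.suc)) (Vg Fin.zero)
  adjoin-∋ {suc n} g P-lat Vg (Fin.suc i) = ⊞-⊆ (adjoin-isLattice (g ∘ Fin.suc) P-lat (Vg ∘ Fin.suc)) (Vg Fin.zero)
    (adjoin-∋ (g ∘ Fin.suc) P-lat (Vg ∘ Fin.suc) i)

  adjoin? : ∀ {n f P} (g : Fin n → Carrier) → IsLattice f P → (∀ i → V 0 (g i)) →
            (∀ z → Dec (P z)) → ∀ z → Dec (adjoin P g z)
  adjoin? {zero}  g P-lat Vg P? = P?
  adjoin? {suc n} g P-lat Vg P? = ⊞? (adjoin-isLattice (g ∘ Fin.suc) P-lat (Vg ∘ Fin.suc)) (Vg Fin.zero)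
    (adjoin? (g ∘ Fin.suc) P-lat (Vg ∘ Fin.suc) P?)

  adjoin-least : ∀ {n p P} {Q : Pred Carrier p} (g : Fin n → Carrier) → IsModule Q →
                 P ⊆ Q → (∀ i → Q (g i)) → adjoin P g ⊆ Q
  adjoin-least {zero}  g Q-sub P⊆Q Qg = P⊆Q
  adjoin-least {suc n} g Q-sub P⊆Q Qg = ⊞-least Q-sub (adjoin-least (g ∘ Fin.suc) Q-sub P⊆Q (Qg ∘ Fin.suc)) (Qg Fin.zero)

  -- Inclusions between lattices, and chains.

  opaque
    Lat-antitone : ∀ {i i′ j j′ w} → V 0 w → i′ ℕ.≤ i → j′ ℕ.≤ j → Lat i j w ⊆ Lat i′ j′ w
    Lat-antitone {i} {i′} {j} {j′} {w} Vw i′≤i j′≤j = Lat-least L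
      (resp (linear (- w) (trans (reflexive (≡.cong ϖ^_ (≡.sym (ℕ.m∸n+n≡m i′≤i)))) (ϖ^-homo (i ∸ i′) i′))
              (solve 4 (λ p q s w → q :* (s :* w) :- p :* w := (:- w) :* (p :- q :* s)) refl (ϖ^ i) (ϖ^ (i ∸ i′)) (ϖ^ i′) w))
            (*-closed (𝔬-ϖ^ (i ∸ i′)) Lat-generator))
      (V-⊆ ∘ V-mono j′≤j)
      where
      L : IsLattice j′ (Lat i′ j′ w)
      L = Lat-isLattice Vw
      open IsLattice L

    generator∉ : ∀ {i i′ j w} → Ind w → i ℕ.≤ j → i′ ℕ.< i → ¬ Lat i j w (ϖ^ i′ * w)
    generator∉ {i} {i′} {j} {w} iw i≤j i′<i Lw = ℕ.<⇒≱ i′<i (V-ϖ^⁻¹ (proj₁ (Lat-coordinates i≤j iw 𝔬-0# (𝔬-ϖ^ i′) 𝔬-0#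
      (IsLattice.resp (Lat-isLattice {i} {j} (proj₁ iw))
        (solve 2 (λ p w → p :* w := con 0ℤ :+ p :* w :+ con 0ℤ :* (w :* w)) refl (ϖ^ i′) w) Lw))))

    square∉ : ∀ {i j j′ w} → Ind w → i ℕ.≤ j → j′ ℕ.< j → ¬ Lat i j w (ϖ^ j′ * (w * w))
    square∉ {i} {j} {j′} {w} iw i≤j j′<j Lw = ℕ.<⇒≱ j′<j (V-ϖ^⁻¹ (proj₂ (Lat-coordinates i≤j iw 𝔬-0# 𝔬-0# (𝔬-ϖ^ j′)
      (IsLattice.resp (Lat-isLattice {i} {j} (proj₁ iw))
        (solve 2 (λ p w → p :* (w :* w) := con 0ℤ :+ con 0ℤ :* w :+ p :* (w :* w)) refl (ϖ^ j′) w) Lw))))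

    -- The square of ϖᵃ y is ϖ²ᵃ y², while the y²-coordinates in the lattice are divisible by ϖᵇ.
    ring⇒≤2a : ∀ {a b y} → Ind y → a ℕ.≤ b → Lat a b y ((ϖ^ a * y) * (ϖ^ a * y)) → b ℕ.≤ a ℕ.+ a
    ring⇒≤2a {a} {b} {y} iy a≤b LY² = ℕ.≮⇒≥ λ 2a<b → square∉ iy a≤b 2a<b
      (IsLattice.resp (Lat-isLattice {a} {b} (proj₁ iy))
        (linear (- (y * y)) (ϖ^-homo a a) (solve 3 (λ p r y → (p :* y) :* (p :* y) :- r :* (y :* y) := (:- (y :* y)) :* (r :- p :* p))
          refl (ϖ^ a) (ϖ^ (a ℕ.+ a)) y)) LY²)

    V⊆Lat⇒≤ : ∀ {i j w n} → Ind w → i ℕ.≤ j → (∀ {x} → V n x → Lat i j w x) → j ℕ.≤ n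
    V⊆Lat⇒≤ iw i≤j V⊆ = ℕ.≮⇒≥ λ n<j → square∉ iw i≤j n<j (V⊆ (V-*ʳ (V-ϖ^ _) (V-* (proj₁ iw) (proj₁ iw))))

    -- An inclusion gives i′ ≤ i and j′ ≤ j. If both are equalities, then the larger lattice is
    -- generated by elements of the smaller one.
    Lat-strict : ∀ {i j w i′ j′ w′ x} → Ind w → Ind w′ → i ℕ.≤ j → i′ ℕ.≤ j′ → Lat i j w ⊆ Lat i′ j′ w′ →
                 Lat i′ j′ w′ x → ¬ Lat i j w x → i′ ℕ.+ j′ ℕ.< i ℕ.+ j
    Lat-strict {i} {j} {w} {i′} {j′} {w′} {x} iw iw′ i≤j i′≤j′ L⊆L′ L′x ¬Lx =
      ℕ.≤∧≢⇒< (ℕ.+-mono-≤ i′≤i j′≤j) λ eq → ¬Lx (equal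
        (ℕ.≤-antisym (ℕ.+-cancelʳ-≤ j′ i i′ (ℕ.≤-trans (ℕ.+-monoʳ-≤ i j′≤j) (ℕ.≤-reflexive (≡.sym eq)))) i′≤i)
        (ℕ.≤-antisym (ℕ.+-cancelˡ-≤ i′ j j′ (ℕ.≤-trans (ℕ.+-monoˡ-≤ j i′≤i) (ℕ.≤-reflexive (≡.sym eq)))) j′≤j))
      where
      L : IsLattice j (Lat i j w)
      L = Lat-isLattice (proj₁ iw)
      open IsLattice L
      j′≤j : j′ ℕ.≤ j
      j′≤j = V⊆Lat⇒≤ iw′ i′≤j′ (L⊆L′ ∘ Lat-V)
      W∈ : Lat i′ j′ w′ (ϖ^ i * w)
      W∈ = L⊆L′ Lat-generator
      a b : Carrier
      a = proj₁ W∈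
      b = proj₁ (proj₂ W∈)
      𝔬a : 𝔬 a
      𝔬a = proj₁ (proj₂ (proj₂ W∈))
      𝔬b : 𝔬 b
      𝔬b = proj₁ (proj₂ (proj₂ (proj₂ W∈)))
      Vξ : V j′ (ϖ^ i * w - (a + b * (ϖ^ i′ * w′)))
      Vξ = proj₂ (proj₂ (proj₂ (proj₂ W∈)))
      valuation : ∀ {n} → n ℕ.≤ j′ → V n (b * (ϖ^ i′ * w′)) → n ℕ.≤ i
      valuation {n} n≤j′ Vb = V-ϖ^⁻¹ (proj₁ (proj₂ (Ind-valuation iw (𝔬-neg 𝔬a) (𝔬-ϖ^ i) 𝔬-0# n (V-resp
        (solve 4 (λ p w a s → (p :* w :- (a :+ s)) :+ s := (:- a) :+ p :* w :+ con 0ℤ :* (w :* w)) refl (ϖ^ i) w a (b * (ϖ^ i′ * w′)))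
        (v-+ (V-mono n≤j′ Vξ) Vb)))))
      i′≤i : i′ ℕ.≤ i
      i′≤i = valuation i′≤j′ (V-*ˡ (proj₂ 𝔬b) (V-*ʳ (V-ϖ^ i′) (proj₁ iw′)))
      equal : i ≡ i′ → j ≡ j′ → Lat i j w x
      equal ≡.refl ≡.refl = Lat-least L W′∈ V-⊆ L′x
        where
        -- In ϖⁱ w ≡ a + b ϖⁱ w′ modulo ϖʲ with i < j, a factor ϖ of b would make the w-coordinate
        -- ϖⁱ divisible by ϖⁱ⁺¹. So b is a unit, and the congruence is solved for ϖⁱ w′.
        W′∈ : Lat i j w (ϖ^ i * w′)
        W′∈ with i ℕ.<? j
        ... | no i≮j = V-⊆ (V-mono (ℕ.≮⇒≥ i≮j) (V-*ʳ (V-ϖ^ i) (proj₁ iw′)))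
        ... | yes i<j with V? 1 b
        ... | yes Vb = contradiction (valuation i<j (V-*  Vb (V-*ʳ (V-ϖ^ i) (proj₁ iw′)))) (ℕ.<⇒≱ ℕ.≤-refl)
        ... | no ¬Vb with 𝔬-inverse 𝔬b ¬Vb
        ... | u , 𝔬u , _ , bu≈1 = resp
          (linear (ϖ^ i * w′) bu≈1 (solve 5 (λ W W′ a b u →
            u :* ((W :- a) :- (W :- (a :+ b :* W′))) :- W′ := W′ :* (b :* u :- con 1ℤ)) refl (ϖ^ i * w) (ϖ^ i * w′) a b u))
          (*-closed 𝔬u (sub-closed (sub-closed Lat-generator (𝔬-⊆ 𝔬a)) (V-⊆ Vξ)))

  -- Adjoin the witnesses of strictness one after another: the colength i + j
  -- of the lattice drops at each step.
  chain-bound : ∀ {p} n {i j w} → Ind w → i ℕ.≤ j → (N : Fin (suc n) → Pred Carrier p) →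
    (∀ t → IsModule (N t)) → (∀ t → N (Fin.inject₁ t) ⊆ N (Fin.suc t)) →
    (∀ (t : Fin n) → ∃[ x ] V 0 x × N (Fin.suc t) x × ¬ N (Fin.inject₁ t) x) →
    Lat i j w ⊆ N Fin.zero → n ℕ.≤ i ℕ.+ j
  chain-bound zero iw i≤j N N-sub increasing strict L⊆N = z≤n
  chain-bound (suc n) {i} {j} {w} iw i≤j N N-sub increasing strict L⊆N with strict Fin.zero
  ... | x , Vx , Nx , ¬Nx
    with normal-form (⊞-isLattice (Lat-isLattice {i} {j} (proj₁ iw)) Vx) (⊞? (Lat-isLattice (proj₁ iw)) Vx (Lat? i≤j iw))
  ... | i′ , j′ , w′ , i′≤j′ , _ , iw′ , P⊆L′ , L′⊆P = ℕ.≤-trans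
    (s≤s (chain-bound n iw′ i′≤j′ (N ∘ Fin.suc) (N-sub ∘ Fin.suc) (increasing ∘ Fin.suc) (strict ∘ Fin.suc)
      (⊞-least (N-sub (Fin.suc Fin.zero)) (increasing Fin.zero ∘ L⊆N) Nx ∘ L′⊆P)))
    (Lat-strict iw iw′ i≤j i′≤j′ (P⊆L′ ∘ ⊞-⊆ (Lat-isLattice (proj₁ iw)) Vx)
      (P⊆L′ (⊞-∋ (Lat-isLattice (proj₁ iw)) Vx)) (¬Nx ∘ L⊆N))

  module _ {a b y} (iy : Ind y) (a≤b : a ℕ.≤ b) where
    -- A chain from Lat a b y up to O: for t ≤ a the exponent of y drops, afterwards that of ϖᵇ O.
    -- The truncated differences join the two phases.
    step : ℕ → Pred Carrier (c ⊔ k)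
    step t = Lat (a ∸ t) (b ∸ (t ∸ a)) y

    step-≤ : ∀ t → a ∸ t ℕ.≤ b ∸ (t ∸ a)
    step-≤ t with a ℕ.≤? t
    ... | yes a≤t = ℕ.≤-trans (ℕ.≤-reflexive (ℕ.m≤n⇒m∸n≡0 a≤t)) z≤n
    ... | no  a≰t = ℕ.≤-trans (ℕ.m∸n≤m a t) (ℕ.≤-trans a≤b
      (ℕ.≤-reflexive (≡.cong (b ∸_) (≡.sym (ℕ.m≤n⇒m∸n≡0 (ℕ.≰⇒≥ a≰t))))))

    step-⊆ : ∀ t → step t ⊆ step (suc t)
    step-⊆ t = Lat-antitone (proj₁ iy) (ℕ.∸-monoʳ-≤ a (ℕ.n≤1+n t)) (ℕ.∸-monoʳ-≤ b (ℕ.∸-monoˡ-≤ a (ℕ.n≤1+n t)))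

    step-strict : ∀ t → t ℕ.< a ℕ.+ b → ∃[ x ] V 0 x × step (suc t) x × ¬ step t x
    step-strict t t<a+b with t ℕ.<? a
    ... | yes t<a = ϖ^ (a ∸ suc t) * y , V-* (ϖ^-integral _) (proj₁ iy) , Lat-generator
                  , generator∉ iy (step-≤ t) (ℕ.∸-monoʳ-< ℕ.≤-refl t<a)
    ... | no t≮a = ϖ^ (b ∸ (suc t ∸ a)) * (y * y) , V-* (ϖ^-integral _) (V-* (proj₁ iy) (proj₁ iy))
                 , Lat-V (V-*ʳ (V-ϖ^ _) (V-* (proj₁ iy) (proj₁ iy)))
                 , square∉ iy (step-≤ t) (ℕ.≤-trans (ℕ.≤-reflexive (≡.cong (λ n → suc (b ∸ n)) t∸a))
                     (ℕ.∸-monoʳ-< ℕ.≤-refl (≡.subst (ℕ._≤ b) t∸a (ℕ.m≤n+o⇒m∸n≤o (suc t) a t<a+b))))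
      where
      t∸a : suc t ∸ a ≡ suc (t ∸ a)
      t∸a = ℕ.+-∸-assoc 1 (ℕ.≮⇒≥ t≮a)

  -- Points of the projective line, homotheties, and stability under R.

  infix 4 _∼_mod_
  -- If m ≥ 1 and w, w′ are independent of 1, then b is necessarily a unit. So this compares the
  -- lines spanned by w and w′ in O/(𝔬 + ϖᵐ O), free of rank two over 𝔬/ϖᵐ; these lines are the
  -- points of P¹(𝔬/ϖᵐ).
  _∼_mod_ : Carrier → Carrier → ℕ → Set (c ⊔ k)
  w ∼ w′ mod m = ∃₂ λ a b → 𝔬 a × 𝔬 b × V m (w - (a + b * w′))

  -- Between lattices that contain 1 and lie in O, a homothety and its inverse both have integral
  -- scalars, so only units have to be considered.
  record _≃_ {p p′} (P : Pred Carrier p) (P′ : Pred Carrier p′) : Set (c ⊔ ℓ ⊔ p ⊔ p′) where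
    field
      scalar scalar⁻¹ : Carrier
      unit            : U scalar
      inverse         : scalar * scalar⁻¹ ≈ 1#
      to              : ∀ {x} → P x → P′ (scalar * x)
      from            : ∀ {x} → P′ x → P (scalar⁻¹ * x)

  ≃-sym : ∀ {p p′} {P : Pred Carrier p} {P′ : Pred Carrier p′} → P ≃ P′ → P′ ≃ P
  ≃-sym h = record
    { scalar = scalar⁻¹ ; scalar⁻¹ = scalar
    ; unit = v≡0⇒U (≡.trans (≡.sym (v-unit-* unit)) (≡.trans (v-cong inverse) v-1#))
    ; inverse = trans (*-comm _ _) inverse ; to = from ; from = to }
    where
    open _≃_ h

  opaque
    Lat-mono : ∀ {i j w w′} → i ℕ.≤ j → V 0 w′ → w ∼ w′ mod (j ∸ i) → Lat i j w ⊆ Lat i j w′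
    Lat-mono {i} {j} {w} {w′} i≤j Vw′ (a , b , 𝔬a , 𝔬b , Vw) = Lat-least L
      (ϖ^ i * a , b , 𝔬-* (𝔬-ϖ^ i) 𝔬a , 𝔬b , V-resp
        (solve 5 (λ p w a b w′ → p :* (w :- (a :+ b :* w′)) := p :* w :- (p :* a :+ b :* (p :* w′))) refl (ϖ^ i) w a b w′)
        (≡⇒V (ℕ.m+[n∸m]≡n i≤j) (V-ϖ^* i Vw))) (IsLattice.V-⊆ L)
      where
      L : IsLattice j (Lat i j w′)
      L = Lat-isLattice Vw′

    ∼-invert : ∀ {m w w′ a b} → V 0 w′ → 𝔬 a → 𝔬 b → U b → V m (w - (a + b * w′)) → w′ ∼ w mod m
    ∼-invert {w = w} {w′} {a} {b} Vw′ 𝔬a 𝔬b Ub Vw with 𝔬-inverse 𝔬b (proj₂ Ub)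
    ... | b⁻¹ , 𝔬b⁻¹ , _ , bb⁻¹≈1 = - (b⁻¹ * a) , b⁻¹ , 𝔬-neg (𝔬-* 𝔬b⁻¹ 𝔬a) , 𝔬b⁻¹ , V-resp
      (linear w′ bb⁻¹≈1 (solve 5 (λ w w′ a b b⁻¹ →
        (:- b⁻¹) :* (w :- (a :+ b :* w′)) :- (w′ :- (:- (b⁻¹ :* a) :+ b⁻¹ :* w)) := w′ :* (b :* b⁻¹ :- con 1ℤ))
        refl w w′ a b b⁻¹))
      (V-*ˡ (V-neg (proj₂ 𝔬b⁻¹)) Vw)

    -- Only the products of Y with 1 and W matter. In y = μ + ν w + η the bound i ≤ a places ϖᵃ ν w
    -- in the lattice, the congruence disposes of ϖᵃ η, and j ≤ a + i disposes of the term ν ϖᵃ⁺ⁱ w²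
    -- of Y W.
    multiplier : ∀ {a b y i j w} → V 0 y → V 0 w → i ℕ.≤ a → j ℕ.≤ b → j ℕ.≤ a ℕ.+ i → y ∼ w mod (j ∸ a) →
                 ∀ {r x} → Lat a b y r → Lat i j w x → Lat i j w (r * x)
    multiplier {a} {b} {y} {i} {j} {w} Vy Vw i≤a j≤b j≤a+i (μ , ν , 𝔬μ , 𝔬ν , Vη) {r} {x} Rr Lx =
      go Rr Lx
      where
      L : IsLattice j (Lat i j w)
      L = Lat-isLattice Vw
      open IsLattice L
      Y W η : Carrier
      Y = ϖ^ a * y
      W = ϖ^ i * w
      η = y - (μ + ν * w)
      Vπη : V j (ϖ^ a * η)
      Vπη = V-mono (ℕ.m≤n+m∸n j a) (V-ϖ^* a Vη)
      Lπw : Lat i j w (ϖ^ a * w)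
      Lπw = resp (linear (- w) (trans (reflexive (≡.cong ϖ^_ (≡.sym (ℕ.m∸n+n≡m i≤a)))) (ϖ^-homo (a ∸ i) i))
                   (solve 4 (λ p q s w → q :* (s :* w) :- p :* w := (:- w) :* (p :- q :* s)) refl (ϖ^ a) (ϖ^ (a ∸ i)) (ϖ^ i) w))
                 (*-closed (𝔬-ϖ^ (a ∸ i)) Lat-generator)
      LY : Lat i j w Y
      LY = resp (solve 5 (λ p y μ ν w → p :* μ :+ ν :* (p :* w) :+ p :* (y :- (μ :+ ν :* w)) := p :* y) refl (ϖ^ a) y μ ν w)
             (+-closed (+-closed (𝔬-⊆ (𝔬-* (𝔬-ϖ^ a) 𝔬μ)) (*-closed 𝔬ν Lπw)) (V-⊆ Vπη))
      VW : V 0 W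
      VW = V-* (ϖ^-integral i) Vw
      LYW : Lat i j w (Y * W)
      LYW = resp (solve 6 (λ p y μ ν w s → (p :* μ) :* (s :* w) :+ (ν :* ((p :* s) :* (w :* w)) :+ (p :* (y :- (μ :+ ν :* w))) :* (s :* w))
                   := (p :* y) :* (s :* w)) refl (ϖ^ a) y μ ν w (ϖ^ i))
              (+-closed (*-closed (𝔬-* (𝔬-ϖ^ a) 𝔬μ) Lat-generator)
                (V-⊆ (v-+ (V-*ˡ (proj₂ 𝔬ν) (V-*ʳ (V-mono j≤a+i (V-* (V-ϖ^ a) (V-ϖ^ i))) (V-* Vw Vw))) (V-*ʳ Vπη VW))))
      LYx : ∀ {x} → Lat i j w x → Lat i j w (Y * x)
      LYx {x} (α , β , 𝔬α , 𝔬β , Vξ) = resp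
        (solve 5 (λ Y W x α β → (α :* Y :+ β :* (Y :* W)) :+ Y :* (x :- (α :+ β :* W)) := Y :* x) refl Y W x α β)
        (+-closed (+-closed (*-closed 𝔬α LY) (*-closed 𝔬β LYW)) (V-⊆ (V-*ˡ (V-* (ϖ^-integral a) Vy) Vξ)))
      go : ∀ {r x} → Lat a b y r → Lat i j w x → Lat i j w (r * x)
      go {r} {x} (γ , δ , 𝔬γ , 𝔬δ , Vρ) Lx = resp
        (solve 5 (λ r x γ δ Y → (γ :* x :+ δ :* (Y :* x)) :+ (r :- (γ :+ δ :* Y)) :* x := r :* x) refl r x γ δ Y)
        (+-closed (+-closed (*-closed 𝔬γ Lx) (*-closed 𝔬δ (LYx Lx))) (V-⊆ (V-*ʳ (V-mono j≤b Vρ) (integral Lx))))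

    -- For j ≤ a all three claims are immediate. For j > a the coordinates of Y = ϖᵃ y are divisible
    -- by ϖᵃ, and the quotient ν of the w-coordinate is a unit because y is independent of 1.
    -- Comparing w-coordinates gives i ≤ a; the w²-coordinate ν ϖᵃ⁺ⁱ of Y W gives j ≤ a + i.
    multiplier⁻¹ : ∀ {a y i j w} → Ind y → Ind w → i ℕ.≤ j → Lat i j w (ϖ^ a * y) → Lat i j w ((ϖ^ a * y) * (ϖ^ i * w)) →
                   i ℕ.≤ a × j ℕ.≤ a ℕ.+ i × y ∼ w mod (j ∸ a)
    multiplier⁻¹ {a} {y} {i} {j} {w} iy iw i≤j (μ′ , ν′ , 𝔬μ′ , 𝔬ν′ , Vξ) LYW with j ℕ.≤? a
    ... | yes j≤a = ℕ.≤-trans i≤j j≤a , ℕ.≤-trans j≤a (ℕ.m≤m+n a i)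
                  , 0# , 0# , 𝔬-0# , 𝔬-0# , ≡⇒V (≡.sym (ℕ.m≤n⇒m∸n≡0 j≤a))
                      (V-- (proj₁ iy) (v-+ V-0# (V-* V-0# (proj₁ iw))))
    ... | no j≰a with Ind-valuation iw 𝔬μ′ (𝔬-* 𝔬ν′ (𝔬-ϖ^ i)) 𝔬-0# a (V-resp
             (solve 5 (λ Y μ ν p w → Y :- (Y :- (μ :+ ν :* (p :* w))) := μ :+ (ν :* p) :* w :+ con 0ℤ :* (w :* w))
               refl (ϖ^ a * y) μ′ ν′ (ϖ^ i) w)
             (V-- (V-*ʳ (V-ϖ^ a) (proj₁ iy)) (V-mono (ℕ.≰⇒≥ j≰a) Vξ)))
    ... | Vμ′ , Vν′ , _ with 𝔬-divide a 𝔬μ′ Vμ′ | 𝔬-divide a (𝔬-* 𝔬ν′ (𝔬-ϖ^ i)) Vν′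
    ... | μ , 𝔬μ , μ≈ | ν , 𝔬ν , ν≈ = i≤a , j≤a+i , μ , ν , 𝔬μ , 𝔬ν , Vη
      where
      L : IsLattice j (Lat i j w)
      L = Lat-isLattice (proj₁ iw)
      open IsLattice L
      W : Carrier
      W = ϖ^ i * w
      Vη : V (j ∸ a) (y - (μ + ν * w))
      Vη = V-ϖ^-cancel a (≡⇒V (≡.sym (ℕ.m+[n∸m]≡n (ℕ.≰⇒≥ j≰a))) (V-resp
        (linear₂ (- 1#) (- w) μ≈ ν≈ (solve 8 (λ p y μ′ ν′ s w μ ν →
          (p :* y :- (μ′ :+ ν′ :* (s :* w))) :- p :* (y :- (μ :+ ν :* w)) :=
          (:- con 1ℤ) :* (μ′ :- p :* μ) :+ (:- w) :* (ν′ :* s :- p :* ν)) refl (ϖ^ a) y μ′ ν′ (ϖ^ i) w μ ν)) Vξ))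
      ¬Vν : ¬ V 1 ν
      ¬Vν Vν = proj₂ iy 𝔬μ (V-resp (solve 4 (λ y μ ν w → (y :- (μ :+ ν :* w)) :+ ν :* w := y :- μ) refl y μ ν w)
        (v-+ (V-mono (ℕ.m<n⇒0<n∸m (ℕ.≰⇒> j≰a)) Vη) (V-*ʳ Vν (proj₁ iw))))
      Uν : U ν
      Uν = proj₂ 𝔬ν , ¬Vν
      i≤a : i ℕ.≤ a
      i≤a = V-ϖ^⁻¹ (U-cancel Uν (V-resp (trans ν≈ (*-comm _ _)) (V-*ˡ (proj₂ 𝔬ν′) (V-ϖ^ i))))
      j≤a+i : j ℕ.≤ a ℕ.+ i
      j≤a+i = V-ϖ^⁻¹ (V-resp (sym (ϖ^-homo a i)) (U-cancel Uν (proj₂ (Lat-coordinates i≤j iw 𝔬-0# 𝔬-0# (𝔬-* 𝔬ν (𝔬-* (𝔬-ϖ^ a) (𝔬-ϖ^ i)))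
        (resp (linear (W * w) ν≈ (solve 7 (λ Y μ′ ν′ s w p ν →
            (Y :* (s :* w) :- (Y :- (μ′ :+ ν′ :* (s :* w))) :* (s :* w) :- μ′ :* (s :* w))
              :- (con 0ℤ :+ con 0ℤ :* w :+ (ν :* (p :* s)) :* (w :* w)) := ((s :* w) :* w) :* (ν′ :* s :- p :* ν))
            refl (ϖ^ a * y) μ′ ν′ (ϖ^ i) w (ϖ^ a) ν))
          (sub-closed (sub-closed LYW (V-⊆ (V-*ʳ Vξ (V-* (ϖ^-integral i) (proj₁ iw))))) (*-closed 𝔬μ′ Lat-generator)))))))

  -- Invariants of a homothety class.

  module _ {i j w i′ j′ w′} (iw : Ind w) (iw′ : Ind w′) (i′≤j′ : i′ ℕ.≤ j′)
           (h : Lat i j w ≃ Lat i′ j′ w′) where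
    open _≃_ h renaming (scalar to t; scalar⁻¹ to t⁻¹; unit to Ut)
    private
      module L  = IsLattice (Lat-isLattice {i} {j} (proj₁ iw))
      module L′ = IsLattice (Lat-isLattice {i′} {j′} (proj₁ iw′))

    opaque
      -- Multiplication by a unit of O preserves ϖʲ O, so L′ contains ϖʲ O, in particular ϖʲ w′².
      ≃⇒j≥ : j′ ℕ.≤ j
      ≃⇒j≥ = V-ϖ^⁻¹ (proj₂ (Lat-coordinates i′≤j′ iw′ 𝔬-0# 𝔬-0# (𝔬-ϖ^ j) (L′.resp
        (linear (ϖ^ j * (w′ * w′)) inverse (solve 4 (λ t t⁻¹ p w →
          t :* (t⁻¹ :* (p :* (w :* w))) :- (con 0ℤ :+ con 0ℤ :* w :+ p :* (w :* w)) :=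
          (p :* (w :* w)) :* (t :* t⁻¹ :- con 1ℤ)) refl t t⁻¹ (ϖ^ j) w′))
        (to (L.V-⊆ (V-*ˡ (proj₁ (_≃_.unit (≃-sym h))) (V-*ʳ (V-ϖ^ j) (V-* (proj₁ iw′) (proj₁ iw′)))))))))

      private
        t∈ : Lat i′ j′ w′ t
        t∈ = L′.resp (*-identityʳ t) (to L.1-closed)
        tW∈ : Lat i′ j′ w′ (t * (ϖ^ i * w))
        tW∈ = to Lat-generator
        a b a₁ b₁ : Carrier
        a = proj₁ t∈
        b = proj₁ (proj₂ t∈)
        a₁ = proj₁ tW∈
        b₁ = proj₁ (proj₂ tW∈)
        𝔬a : 𝔬 a
        𝔬a = proj₁ (proj₂ (proj₂ t∈))
        𝔬b : 𝔬 b
        𝔬b = proj₁ (proj₂ (proj₂ (proj₂ t∈)))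
        𝔬a₁ : 𝔬 a₁
        𝔬a₁ = proj₁ (proj₂ (proj₂ tW∈))
        𝔬b₁ : 𝔬 b₁
        𝔬b₁ = proj₁ (proj₂ (proj₂ (proj₂ tW∈)))
        Vt : V j′ (t - (a + b * (ϖ^ i′ * w′)))
        Vt = proj₂ (proj₂ (proj₂ (proj₂ t∈)))
        VtW : V j′ (t * (ϖ^ i * w) - (a₁ + b₁ * (ϖ^ i′ * w′)))
        VtW = proj₂ (proj₂ (proj₂ (proj₂ tW∈)))

        VbW′ : ∀ {b} → 𝔬 b → V i′ (b * (ϖ^ i′ * w′))
        VbW′ 𝔬b = V-*ˡ (proj₂ 𝔬b) (V-*ʳ (V-ϖ^ i′) (proj₁ iw′))

        Ua : 1 ℕ.≤ i′ → U a
        Ua 1≤i′ = proj₂ 𝔬a , λ Va → proj₂ Ut (V-resp (solve 3 (λ t a s → (t :- (a :+ s)) :+ (a :+ s) := t) refl t a (b * (ϖ^ i′ * w′)))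
          (v-+ (V-mono (ℕ.≤-trans 1≤i′ i′≤j′) Vt) (v-+ Va (V-mono 1≤i′ (VbW′ 𝔬b)))))

      -- Modulo ϖ^i′ every element of L′ is congruent to one of 𝔬. For i′ ≥ 1 this makes t congruent
      -- to a unit a of 𝔬, and a ϖⁱ w to an element of 𝔬, which forces i′ ≤ i.
      ≃⇒i≥ : i′ ℕ.≤ i
      ≃⇒i≥ with 1 ℕ.≤? i′
      ... | no  1≰i′ = ℕ.≤-trans (ℕ.≮⇒≥ 1≰i′) z≤n
      ... | yes 1≤i′ = V-ϖ^⁻¹ (U-cancel (Ua 1≤i′) (proj₁ (proj₂ (Ind-valuation iw (𝔬-neg 𝔬a₁) (𝔬-* 𝔬a (𝔬-ϖ^ i)) 𝔬-0# i′ (V-resp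
        (solve 7 (λ t p w a a₁ s s₁ →
          ((t :* (p :* w) :- (a₁ :+ s₁)) :+ s₁) :- ((t :- (a :+ s)) :+ s) :* (p :* w) :=
          (:- a₁) :+ (a :* p) :* w :+ con 0ℤ :* (w :* w)) refl t (ϖ^ i) w a a₁ (b * (ϖ^ i′ * w′)) (b₁ * (ϖ^ i′ * w′)))
        (V-- (v-+ (V-mono i′≤j′ VtW) (VbW′ 𝔬b₁))
             (V-*ʳ (v-+ (V-mono i′≤j′ Vt) (VbW′ 𝔬b)) (V-* (ϖ^-integral i) (proj₁ iw)))))))))

      -- Substituting t ≡ a + b W′ into t W ≡ a₁ + b₁ W′ gives a W ≡ a₁ + b₁ W′ up to b W W′ in ϖ²ⁱ
      -- O and up to ϖ^j′ O. Division by a ϖⁱ leaves precision min (i, j′ - i).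
      ≃⇒∼ : i ≡ i′ → w ∼ w′ mod (i′ ⊓ (j′ ∸ i′))
      ≃⇒∼ ≡.refl with 1 ℕ.≤? i
      ... | no 1≰i = 0# , 0# , 𝔬-0# , 𝔬-0# , V-mono (ℕ.≤-trans (ℕ.m⊓n≤m i (j′ ∸ i)) (ℕ.≮⇒≥ 1≰i))
                      (V-- (proj₁ iw) (v-+ V-0# (V-* V-0# (proj₁ iw′))))
      ... | yes 1≤i with 𝔬-inverse 𝔬a (proj₂ (Ua 1≤i))
      ... | a⁻¹ , 𝔬a⁻¹ , _ , aa⁻¹≈1 = μ , a⁻¹ * b₁ , 𝔬μ , 𝔬-* 𝔬a⁻¹ 𝔬b₁ , V-ϖ^-cancel i (V-resp
          (linear (- 1#) μ≈ (solve 6 (λ p w w′ β μ α →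
            (p :* (w :- β :* w′) :- α) :- p :* (w :- (μ :+ β :* w′)) := (:- con 1ℤ) :* (α :- p :* μ))
            refl (ϖ^ i) w w′ (a⁻¹ * b₁) μ (a⁻¹ * a₁))) Vc)
        where
        m : ℕ
        m = i ⊓ (j′ ∸ i)
        i+m≤j : i ℕ.+ m ℕ.≤ j′
        i+m≤j = ℕ.≤-trans (ℕ.+-monoʳ-≤ i (ℕ.m⊓n≤n i (j′ ∸ i))) (ℕ.≤-reflexive (ℕ.m+[n∸m]≡n i′≤j′))
        W W′ : Carrier
        W = ϖ^ i * w
        W′ = ϖ^ i * w′
        VWW′ : V (i ℕ.+ m) (W * W′)
        VWW′ = V-mono (ℕ.+-monoʳ-≤ i (ℕ.m⊓n≤m i (j′ ∸ i))) (V-* (V-*ʳ (V-ϖ^ i) (proj₁ iw)) (V-*ʳ (V-ϖ^ i) (proj₁ iw′)))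
        Va : V (i ℕ.+ m) (a * W - (a₁ + b₁ * W′))
        Va = V-resp (solve 7 (λ t a b a₁ b₁ W W′ →
               ((t :* W :- (a₁ :+ b₁ :* W′)) :- (t :- (a :+ b :* W′)) :* W) :- b :* (W :* W′) := a :* W :- (a₁ :+ b₁ :* W′))
               refl t a b a₁ b₁ W W′)
             (V-- (V-mono i+m≤j (V-- VtW (V-*ʳ Vt (V-* (ϖ^-integral i) (proj₁ iw))))) (V-*ˡ (proj₂ 𝔬b) VWW′))
        Vc : V (i ℕ.+ m) (ϖ^ i * (w - (a⁻¹ * b₁) * w′) - a⁻¹ * a₁)
        Vc = V-resp (linear W aa⁻¹≈1 (solve 7 (λ a a⁻¹ a₁ b₁ p w w′ →
               a⁻¹ :* (a :* (p :* w) :- (a₁ :+ b₁ :* (p :* w′))) :- (p :* (w :- (a⁻¹ :* b₁) :* w′) :- a⁻¹ :* a₁) :=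
               (p :* w) :* (a :* a⁻¹ :- con 1ℤ)) refl a a⁻¹ a₁ b₁ (ϖ^ i) w w′)) (V-*ˡ (proj₂ 𝔬a⁻¹) Va)
        Vaa₁ : V i (a⁻¹ * a₁)
        Vaa₁ = V-resp (solve 2 (λ x y → x :- (x :- y) := y) refl (ϖ^ i * (w - (a⁻¹ * b₁) * w′)) (a⁻¹ * a₁))
          (V-- (V-*ʳ (V-ϖ^ i) (V-- (proj₁ iw) (V-* (proj₂ (𝔬-* 𝔬a⁻¹ 𝔬b₁)) (proj₁ iw′)))) (V-mono (ℕ.m≤m+n i m) Vc))
        quotient′ : ∃[ y ] 𝔬 y × a⁻¹ * a₁ ≈ ϖ^ i * y
        quotient′ = 𝔬-divide i (𝔬-* 𝔬a⁻¹ 𝔬a₁) Vaa₁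
        μ : Carrier
        μ = proj₁ quotient′
        𝔬μ : 𝔬 μ
        𝔬μ = proj₁ (proj₂ quotient′)
        μ≈ : a⁻¹ * a₁ ≈ ϖ^ i * μ
        μ≈ = proj₂ (proj₂ quotient′)

  ≃-respʳ : ∀ {p p′ p″} {P : Pred Carrier p} {P′ : Pred Carrier p′} {P″ : Pred Carrier p″} →
            P ≃ P′ → P′ ≐ P″ → P ≃ P″
  ≃-respʳ h (P′⊆P″ , P″⊆P′) = record
    { scalar = scalar ; scalar⁻¹ = scalar⁻¹ ; unit = unit ; inverse = inverse
    ; to = P′⊆P″ ∘ to ; from = from ∘ P″⊆P′ }
    where open _≃_ h

  ≐⇒≃ : ∀ {p p′ f f′} {P : Pred Carrier p} {P′ : Pred Carrier p′} → IsLattice f P → IsLattice f′ P′ → P ≐ P′ → P ≃ P′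
  ≐⇒≃ L L′ (P⊆P′ , P′⊆P) = record
    { scalar = 1# ; scalar⁻¹ = 1# ; unit = U-1# ; inverse = *-identityˡ 1#
    ; to   = IsLattice.*-closed L′ 𝔬-1# ∘ P⊆P′
    ; from = IsLattice.*-closed L 𝔬-1# ∘ P′⊆P }

  Ind-resp : ∀ {w w′} → w ≈ w′ → Ind w → Ind w′
  Ind-resp w≈w′ (Vw , ¬V) = V-resp w≈w′ Vw , λ 𝔬c → ¬V 𝔬c ∘ V-resp (+-congʳ (sym w≈w′))

  opaque
    Lat-map : ∀ {p i j w t} {P : Pred Carrier p} → IsLattice j P → V 0 t → P t → P (t * (ϖ^ i * w)) →
              ∀ {x} → Lat i j w x → P (t * x)
    Lat-map {i = i} {w = w} {t} L Vt Pt PtW {x} (a , b , 𝔬a , 𝔬b , Vx) = resp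
      (solve 5 (λ t x a b W → (a :* t :+ b :* (t :* W)) :+ t :* (x :- (a :+ b :* W)) := t :* x) refl t x a b (ϖ^ i * w))
      (+-closed (+-closed (*-closed 𝔬a Pt) (*-closed 𝔬b PtW)) (V-⊆ (V-*ˡ Vt Vx)))
      where open IsLattice L

  -- Homotheties that change w.

  module _ {i j : ℕ} {w w₀ t : Carrier} (iw : Ind w) (iw₀ : Ind w₀) (Vt : V 0 t) (w₀≈ : w₀ ≈ w + ϖ^ i * t)
           {α β γ δ : Carrier} (𝔬α : 𝔬 α) (𝔬β : 𝔬 β) (𝔬γ : 𝔬 γ) (𝔬δ : 𝔬 δ)
           (nontrivial : ¬ (V 1 α × V 1 β × V 1 γ × V 1 δ))
           (relation : α * 1# + β * w + γ * t + δ * (w * w₀) ≈ 0#) where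
    private
      -- The relation says that W₀ is the image of W under the Möbius transformation with rows (γ -
      -- pβ, -p²α) and (δ, γ), whose determinant is Δ. Its denominator at W is u; that of the
      -- adjugate matrix at W₀ is e. Hence u maps 1 and W₀ into the lattice of w, e maps 1 and W
      -- into that of w₀, and u e = Δ.
      p W W₀ u e Δ : Carrier
      p = ϖ^ i
      W = p * w
      W₀ = p * w₀
      u = γ + δ * W
      e = (γ - p * β) - δ * W₀
      Δ = γ * (γ - p * β) + (p * p) * (δ * α)
      Vw : V 0 w
      Vw = proj₁ iw
      Vw₀ : V 0 w₀
      Vw₀ = proj₁ iw₀
      module L  = IsLattice (Lat-isLattice {i} {j} Vw)
      module L₀ = IsLattice (Lat-isLattice {i} {j} Vw₀)

      from-relation : ∀ {x} → V 1 x → x ≈ γ * t + δ * (w * w₀) → V 1 α × V 1 β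
      from-relation Vx x≈ = Ind-independent iw 𝔬α 𝔬β (V-resp
        (linear₂ (- 1#) (- 1#) x≈ relation (solve 6 (λ α β w c d x →
           (:- x) :- (α :+ β :* w) := (:- con 1ℤ) :* (x :- (c :+ d)) :+ (:- con 1ℤ) :* (α :* con 1ℤ :+ β :* w :+ c :+ d :- con 0ℤ))
           refl α β w (γ * t) (δ * (w * w₀)) _)) (V-neg Vx))

      opaque
        -- Both u and e are γ modulo ϖ. If γ vanished there, the relation would become α + β w + δ
        -- w² ≡ 0, as w₀ ≡ w, and all coefficients would vanish.
        unit-u-e-pos : 1 ℕ.≤ i → U u × U e
        unit-u-e-pos 1≤i = U-+ (proj₂ 𝔬γ , ¬Vγ) (V-*ˡ (proj₂ 𝔬δ) (V-*ʳ Vp Vw))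
                         , U-resp (sym (+-assoc γ _ _)) (U-+ (proj₂ 𝔬γ , ¬Vγ)
                             (v-+ (V-neg (V-*ʳ Vp (proj₂ 𝔬β))) (V-neg (V-*ˡ (proj₂ 𝔬δ) (V-*ʳ Vp Vw₀)))))
          where
          Vp : V 1 p
          Vp = V-mono 1≤i (V-ϖ^ i)
          ¬Vγ : ¬ V 1 γ
          ¬Vγ Vγ with Ind-quadratic iw 𝔬α 𝔬β 𝔬δ (V-resp
            (linear₂ (δ * w) (- 1#) w₀≈ relation (solve 8 (λ α β γ δ w w₀ t p →
              (:- (γ :* t :+ δ :* (w :* (p :* t)))) :- (α :+ β :* w :+ δ :* (w :* w)) :=
              (δ :* w) :* (w₀ :- (w :+ p :* t)) :+ (:- con 1ℤ) :* (α :* con 1ℤ :+ β :* w :+ γ :* t :+ δ :* (w :* w₀) :- con 0ℤ))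
              refl α β γ δ w w₀ t p))
            (V-neg (v-+ (V-*ʳ Vγ Vt) (V-*ˡ (proj₂ 𝔬δ) (V-*ˡ Vw (V-*ʳ Vp Vt))))))
          ... | Vα , Vβ , Vδ = nontrivial (Vα , Vβ , Vγ , Vδ)

        -- With p = 1, u ≡ 0 forces γ ≡ δ ≡ 0, and e ≡ 0 forces γ ≡ β and δ ≡ 0. The relation then
        -- shrinks to α + β w ≡ 0 or to α + γ w₀ ≡ 0.
        unit-u-e-zero : i ≡ 0 → U u × U e
        unit-u-e-zero i≡0 = (v-+ (proj₂ 𝔬γ) (V-* (proj₂ 𝔬δ) (V-* (ϖ^-integral i) Vw)) , ¬Vu)
                          , (V-- (proj₂ 𝔬γ-pβ) (V-* (proj₂ 𝔬δ) (V-* (ϖ^-integral i) Vw₀)) , ¬Ve)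
          where
          𝔬γ-pβ : 𝔬 (γ - p * β)
          𝔬γ-pβ = 𝔬-- 𝔬γ (𝔬-* (𝔬-ϖ^ i) 𝔬β)
          p≈1 : p ≈ 1#
          p≈1 = trans (reflexive (≡.cong ϖ^_ i≡0)) ϖ^-zero
          ¬Vu : ¬ V 1 u
          ¬Vu Vu with Ind-independent iw 𝔬γ 𝔬δ (V-resp (linear (δ * w) p≈1 (solve 4 (λ γ δ w p →
            (γ :+ δ :* (p :* w)) :- (γ :+ δ :* w) := (δ :* w) :* (p :- con 1ℤ)) refl γ δ w p)) Vu)
          ... | Vγ , Vδ with from-relation (v-+ (V-*ʳ Vγ Vt) (V-*ʳ Vδ (V-* Vw Vw₀))) refl
          ... | Vα , Vβ = nontrivial (Vα , Vβ , Vγ , Vδ)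
          ¬Ve : ¬ V 1 e
          ¬Ve Ve with Ind-independent iw₀ (𝔬-- 𝔬γ 𝔬β) (𝔬-neg 𝔬δ) (V-resp (linear (- (β + δ * w₀)) p≈1 (solve 5 (λ γ β δ w p →
            ((γ :- p :* β) :- δ :* (p :* w)) :- ((γ :- β) :+ (:- δ) :* w) := (:- (β :+ δ :* w)) :* (p :- con 1ℤ)) refl γ β δ w₀ p)) Ve)
          ... | Vγ-β , V-δ with Ind-independent iw₀ 𝔬α 𝔬γ (V-resp
            (linear 1# relation′ (solve 6 (λ α β γ w w₀ d →
              (γ :- β) :* w :- d :- (α :+ γ :* w₀) := con 1ℤ :* (con 0ℤ :- (α :+ β :* w :+ γ :* (w₀ :- w) :+ d)))
              refl α β γ w w₀ (δ * (w * w₀))))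
            (V-- (V-*ʳ Vγ-β Vw) (V-*ʳ (V-neg⁻¹ V-δ) (V-* Vw Vw₀))))
            where
            relation′ : 0# ≈ α + β * w + γ * (w₀ - w) + δ * (w * w₀)
            relation′ = trans (sym relation) (linear₂ (- γ) (- (γ * t)) w₀≈ p≈1
              (solve 8 (λ α β γ w w₀ t p d →
                (α :* con 1ℤ :+ β :* w :+ γ :* t :+ d) :- (α :+ β :* w :+ γ :* (w₀ :- w) :+ d) :=
                (:- γ) :* (w₀ :- (w :+ p :* t)) :+ (:- (γ :* t)) :* (p :- con 1ℤ)) refl α β γ w w₀ t p (δ * (w * w₀))))
          ... | Vα , Vγ = nontrivial (Vα
              , V-resp (solve 2 (λ γ β → γ :- (γ :- β) := β) refl γ β) (V-- Vγ Vγ-β) , Vγ , V-neg⁻¹ V-δ)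

        unit-u-e : U u × U e
        unit-u-e with i ℕ.≟ 0
        ... | yes i≡0 = unit-u-e-zero i≡0
        ... | no  i≢0 = unit-u-e-pos (ℕ.n≢0⇒n>0 i≢0)

        𝔬Δ : 𝔬 Δ
        𝔬Δ = 𝔬-+ (𝔬-* 𝔬γ (𝔬-- 𝔬γ (𝔬-* (𝔬-ϖ^ i) 𝔬β))) (𝔬-* (𝔬-* (𝔬-ϖ^ i) (𝔬-ϖ^ i)) (𝔬-* 𝔬δ 𝔬α))

        u*e≈Δ : u * e ≈ Δ
        u*e≈Δ = linear₂ (- (γ * δ * p)) (- (δ * (p * p))) w₀≈ relation
          (solve 8 (λ α β γ δ w w₀ t p →
            (γ :+ δ :* (p :* w)) :* ((γ :- p :* β) :- δ :* (p :* w₀)) :- (γ :* (γ :- p :* β) :+ (p :* p) :* (δ :* α)) :=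
            (:- (γ :* δ :* p)) :* (w₀ :- (w :+ p :* t)) :+
            (:- (δ :* (p :* p))) :* (α :* con 1ℤ :+ β :* w :+ γ :* t :+ δ :* (w :* w₀) :- con 0ℤ))
            refl α β γ δ w w₀ t p)

        u*W₀≈ : u * W₀ ≈ (γ - p * β) * W - (p * p) * α
        u*W₀≈ = linear₂ (γ * p) (p * p) w₀≈ relation
          (solve 8 (λ α β γ δ w w₀ t p →
            (γ :+ δ :* (p :* w)) :* (p :* w₀) :- ((γ :- p :* β) :* (p :* w) :- (p :* p) :* α) :=
            (γ :* p) :* (w₀ :- (w :+ p :* t)) :+
            (p :* p) :* (α :* con 1ℤ :+ β :* w :+ γ :* t :+ δ :* (w :* w₀) :- con 0ℤ))
            refl α β γ δ w w₀ t p)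

        e*W≈ : e * W ≈ γ * W₀ + (p * p) * α
        e*W≈ = linear₂ (- (γ * p)) (- (p * p)) w₀≈ relation
          (solve 8 (λ α β γ δ w w₀ t p →
            ((γ :- p :* β) :- δ :* (p :* w₀)) :* (p :* w) :- (γ :* (p :* w₀) :+ (p :* p) :* α) :=
            (:- (γ :* p)) :* (w₀ :- (w :+ p :* t)) :+
            (:- (p :* p)) :* (α :* con 1ℤ :+ β :* w :+ γ :* t :+ δ :* (w :* w₀) :- con 0ℤ))
            refl α β γ δ w w₀ t p)

      Δ⁻¹ : ∃[ y ] 𝔬 y × U y × Δ * y ≈ 1#
      Δ⁻¹ = 𝔬-inverse 𝔬Δ (proj₂ (U-resp u*e≈Δ (U-* (proj₁ unit-u-e) (proj₂ unit-u-e))))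

    shear-relation : Lat i j w₀ ≃ Lat i j w
    shear-relation = record
      { scalar   = u
      ; scalar⁻¹ = D * e
      ; unit     = proj₁ unit-u-e
      ; inverse  = linear₂ D 1# u*e≈Δ (proj₂ (proj₂ (proj₂ Δ⁻¹)))
          (solve 4 (λ u e D Δ → u :* (D :* e) :- con 1ℤ := D :* (u :* e :- Δ) :+ con 1ℤ :* (Δ :* D :- con 1ℤ)) refl u e D Δ)
      ; to       = Lat-map (Lat-isLattice Vw) (proj₁ (proj₁ unit-u-e))
          (L.+-closed (L.𝔬-⊆ 𝔬γ) (L.*-closed 𝔬δ Lat-generator))
          (L.resp (sym u*W₀≈) (L.sub-closed
            (L.*-closed (𝔬-- 𝔬γ (𝔬-* (𝔬-ϖ^ i) 𝔬β)) Lat-generator)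
            (L.𝔬-⊆ (𝔬-* (𝔬-* (𝔬-ϖ^ i) (𝔬-ϖ^ i)) 𝔬α))))
      ; from     = Lat-map (Lat-isLattice Vw₀) (V-* (proj₂ 𝔬D) (proj₁ (proj₂ unit-u-e)))
          (L₀.*-closed 𝔬D (L₀.sub-closed (L₀.𝔬-⊆ (𝔬-- 𝔬γ (𝔬-* (𝔬-ϖ^ i) 𝔬β))) (L₀.*-closed 𝔬δ Lat-generator)))
          (L₀.resp (trans (*-congˡ (sym e*W≈)) (sym (*-assoc D e W)))
            (L₀.*-closed 𝔬D (L₀.+-closed (L₀.*-closed 𝔬γ Lat-generator) (L₀.𝔬-⊆ (𝔬-* (𝔬-* (𝔬-ϖ^ i) (𝔬-ϖ^ i)) 𝔬α)))))
      }
      where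
      D : Carrier
      D = proj₁ Δ⁻¹
      𝔬D : 𝔬 D
      𝔬D = proj₁ (proj₂ Δ⁻¹)

  -- The class of 𝔬 + 𝔬 ϖⁱ w + ϖʲ O depends on w modulo ϖⁱ only: if
  -- w₀ = w + ϖⁱ t, an 𝔬-linear relation α + βw + γt + δww₀ = 0, which exists
  -- because [E : F] = 3, makes u = γ + δ ϖⁱ w the scalar of a homothety.
  opaque
    shear : ∀ {i j w w₀ t} → Ind w → Ind w₀ → V 0 t → w₀ ≈ w + ϖ^ i * t → Lat i j w₀ ≃ Lat i j w
    shear {w = w} {w₀} {t} iw iw₀ Vt w₀≈ with dependence 1# w t (w * w₀)
    ... | _ , _ , _ , _ , (𝔬α , 𝔬β , 𝔬γ , 𝔬δ) , nontrivial , relation =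
      shear-relation iw iw₀ Vt w₀≈ 𝔬α 𝔬β 𝔬γ 𝔬δ nontrivial relation

    -- For 2i > j the minimum is j - i and the two lattices are equal. For 2i ≤ j it is i: replacing
    -- w by a + b w does not change the lattice, and w₀ differs from that by a multiple of ϖⁱ, as
    -- `shear` requires.
    ∼⇒≃ : ∀ {i j w w₀ a b} → i ℕ.≤ j → Ind w → Ind w₀ → 𝔬 a → 𝔬 b → U b →
          V (i ⊓ (j ∸ i)) (w₀ - (a + b * w)) → Lat i j w₀ ≃ Lat i j w
    ∼⇒≃ {i} {j} {w} {w₀} {a} {b} i≤j iw iw₀ 𝔬a 𝔬b Ub Vw₀ with i ℕ.+ i ℕ.≤? j
    ... | no 2i≰j = ≐⇒≃ (Lat-isLattice (proj₁ iw₀)) (Lat-isLattice (proj₁ iw))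
      ( Lat-mono i≤j (proj₁ iw) (a , b , 𝔬a , 𝔬b , Vw₀′)
      , Lat-mono i≤j (proj₁ iw₀) (∼-invert (proj₁ iw) 𝔬a 𝔬b Ub Vw₀′))
      where
      Vw₀′ : V (j ∸ i) (w₀ - (a + b * w))
      Vw₀′ = ≡⇒V (ℕ.m≥n⇒m⊓n≡n (ℕ.≤-trans (ℕ.∸-monoˡ-≤ i (ℕ.≰⇒≥ 2i≰j)) (ℕ.≤-reflexive (ℕ.m+n∸n≡m i i)))) Vw₀
    ... | yes 2i≤j with V-divide i (≡⇒V (ℕ.m≤n⇒m⊓n≡m (ℕ.≤-trans (ℕ.≤-reflexive (≡.sym (ℕ.m+n∸n≡m i i))) (ℕ.∸-monoˡ-≤ i 2i≤j))) Vw₀)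
    ... | t , Vt , t≈ , _ = ≃-respʳ
      (shear iw₁ iw₀ Vt (linear 1# t≈ (solve 4 (λ w₀ w₁ p t → w₀ :- (w₁ :+ p :* t) := con 1ℤ :* ((w₀ :- w₁) :- p :* t)) refl w₀ w₁ (ϖ^ i) t)))
      ( Lat-mono i≤j (proj₁ iw) (a , b , 𝔬a , 𝔬b , exact)
      , Lat-mono i≤j (proj₁ iw₁) (∼-invert (proj₁ iw) 𝔬a 𝔬b Ub exact))
      where
      w₁ : Carrier
      w₁ = a + b * w
      exact : ∀ {n} → V n (w₁ - w₁)
      exact = V-resp (sym (-‿inverseʳ w₁)) V-0#
      iw₁ : Ind w₁
      iw₁ = Ind-resp (solve 2 (λ s w → s :+ con 0ℤ :* (w :* w) := s) refl w₁ w)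
              (Ind-combination iw 𝔬a 𝔬b 𝔬-0# (λ (Vb , _) → proj₂ Ub Vb))

  -- Enumeration of the points congruent to y.

  private
    -- A representative in O of the point (d : e), in the basis y, y² of O modulo 𝔬.
    combination : Carrier → Carrier → Carrier → Carrier
    combination y d e = 0# + d * y + e * (y * y)

  module _ {y} (iy : Ind y) where
    opaque
      combination-Ind : ∀ {d e} → 𝔬 d → 𝔬 e → ¬ (V 1 d × V 1 e) → Ind (combination y d e)
      combination-Ind = Ind-combination iy 𝔬-0#

      combination-compare : ∀ {m μ ν a d e d′ e′} → 𝔬 a → 𝔬 μ → 𝔬 ν → 𝔬 d → 𝔬 e → 𝔬 d′ → 𝔬 e′ →
        V m ((a + d * y + e * (y * y)) - (μ + ν * combination y d′ e′)) → V m (d - ν * d′) × V m (e - ν * e′)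
      combination-compare {m} {μ} {ν} {a} {d} {e} {d′} {e′} 𝔬a 𝔬μ 𝔬ν 𝔬d 𝔬e 𝔬d′ 𝔬e′ Vx =
        proj₂ (Ind-valuation iy (𝔬-- 𝔬a 𝔬μ) (𝔬-- 𝔬d (𝔬-* 𝔬ν 𝔬d′)) (𝔬-- 𝔬e (𝔬-* 𝔬ν 𝔬e′)) m (V-resp
          (solve 8 (λ a d e μ ν d′ e′ y →
            (a :+ d :* y :+ e :* (y :* y)) :- (μ :+ ν :* (con 0ℤ :+ d′ :* y :+ e′ :* (y :* y))) :=
            (a :- μ) :+ (d :- ν :* d′) :* y :+ (e :- ν :* e′) :* (y :* y)) refl a d e μ ν d′ e′ y) Vx))

    -- The points w of P¹(𝔬/ϖᵐ), m = min(i, j - i), which are congruent to y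
    -- modulo ϖ^(j ∸ a), as y + e y² and, if j ≤ a, also as y² + d y with d ≡ 0.
    module _ (a : ℕ) where
      Points : ℕ → ℕ → Set
      Points i j = (j ∸ a ℕ.≤ i ⊓ (j ∸ i) × Fin (q ℕ.^ (i ⊓ (j ∸ i) ∸ (j ∸ a))))
                 ⊎ ((j ℕ.≤ a × 1 ℕ.≤ i ⊓ (j ∸ i)) × Fin (q ℕ.^ (i ⊓ (j ∸ i) ∸ 1)))

      point₁ point₂ : ∀ {i j} → Points i j → Carrier
      point₁ (inj₁ _) = 1#
      point₁ {i} {j} (inj₂ (_ , d)) = ϖ^ 1 * expand (i ⊓ (j ∸ i) ∸ 1) d
      point₂ {i} {j} (inj₁ (_ , d)) = ϖ^ (j ∸ a) * expand (i ⊓ (j ∸ i) ∸ (j ∸ a)) d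
      point₂ (inj₂ _) = 1#

      point : ∀ {i j} → Points i j → Carrier
      point x = combination y (point₁ x) (point₂ x)

      opaque
        𝔬-point₁ : ∀ {i j} (x : Points i j) → 𝔬 (point₁ x)
        𝔬-point₁ (inj₁ _) = 𝔬-1#
        𝔬-point₁ {i} {j} (inj₂ (_ , d)) = 𝔬-* (𝔬-ϖ^ 1) (expand∈𝔬 (i ⊓ (j ∸ i) ∸ 1) d)

        𝔬-point₂ : ∀ {i j} (x : Points i j) → 𝔬 (point₂ x)
        𝔬-point₂ {i} {j} (inj₁ (_ , d)) = 𝔬-* (𝔬-ϖ^ (j ∸ a)) (expand∈𝔬 (i ⊓ (j ∸ i) ∸ (j ∸ a)) d)
        𝔬-point₂ (inj₂ _) = 𝔬-1#

        point-Ind : ∀ {i j} (x : Points i j) → Ind (point x)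
        point-Ind x@(inj₁ _) = combination-Ind (𝔬-point₁ x) (𝔬-point₂ x) (¬V₁1 ∘ proj₁)
        point-Ind x@(inj₂ _) = combination-Ind (𝔬-point₁ x) (𝔬-point₂ x) (¬V₁1 ∘ proj₂)

        point-∼ : ∀ {i j} (x : Points i j) → y ∼ point x mod (j ∸ a)
        point-∼ {i} {j} x@(inj₁ (_ , d)) = 0# , 1# , 𝔬-0# , 𝔬-1# , V-resp
          (solve 2 (λ y e → :- (e :* (y :* y)) := y :- (con 0ℤ :+ con 1ℤ :* (con 0ℤ :+ con 1ℤ :* y :+ e :* (y :* y)))) refl y (point₂ {i} {j} x))
          (V-neg (V-*ʳ (V-*ʳ (V-ϖ^ (j ∸ a)) (proj₂ (expand∈𝔬 (i ⊓ (j ∸ i) ∸ (j ∸ a)) d))) (V-* (proj₁ iy) (proj₁ iy))))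
        point-∼ {i} {j} x@(inj₂ ((j≤a , _) , d)) = 0# , 0# , 𝔬-0# , 𝔬-0# ,
          ≡⇒V (≡.sym (ℕ.m≤n⇒m∸n≡0 j≤a)) (V-- (proj₁ iy) (v-+ V-0# (V-* V-0# (proj₁ (point-Ind {i} {j} x)))))

        -- Together with `≤⇒k≤m` this translates the bounds of `multiplier` into the single
        -- inequality j ∸ a ≤ min (i, j - i), for i ≤ j.
        Points⇒≤ : ∀ {i j} → i ℕ.≤ j → Points i j → i ℕ.≤ a × j ℕ.≤ a ℕ.+ i
        Points⇒≤ {i} {j} i≤j (inj₂ ((j≤a , _) , _)) = ℕ.≤-trans i≤j j≤a , ℕ.≤-trans j≤a (ℕ.m≤m+n a i)
        Points⇒≤ {i} {j} i≤j (inj₁ (k≤m , _)) = i≤a , ℕ.≤-trans (ℕ.m≤n+m∸n j a) (ℕ.+-monoʳ-≤ a (ℕ.≤-trans k≤m (ℕ.m⊓n≤m i (j ∸ i))))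
          where
          i≤a : i ℕ.≤ a
          i≤a = ℕ.≮⇒≥ λ a<i → ℕ.<-irrefl ≡.refl
            (ℕ.<-≤-trans (ℕ.∸-monoʳ-< a<i i≤j) (ℕ.≤-trans k≤m (ℕ.m⊓n≤n i (j ∸ i))))

        ≤⇒k≤m : ∀ {i j} → i ℕ.≤ a → j ℕ.≤ a ℕ.+ i → j ∸ a ℕ.≤ i ⊓ (j ∸ i)
        ≤⇒k≤m {i} {j} i≤a j≤a+i = ℕ.⊓-glb (ℕ.m≤n+o⇒m∸n≤o j a j≤a+i) (ℕ.∸-monoʳ-≤ j i≤a)

        -- Since w is independent of 1, its coordinate c₁ or c₂ is a unit, and dividing by it
        -- selects the chart. Comparison with y gives 1 ≡ ν c₁ and 0 ≡ ν c₂ modulo ϖ^(j ∸ a), hence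
        -- the divisibility of c₂/c₁ in the first chart.
        point-complete : ∀ {i j w} → Ind w → i ℕ.≤ a → j ℕ.≤ a ℕ.+ i → y ∼ w mod (j ∸ a) →
          Σ[ x ∈ Points i j ] ∃₂ λ μ ν → 𝔬 μ × 𝔬 ν × U ν × V (i ⊓ (j ∸ i)) (w - (μ + ν * point x))
        point-complete {i} {j} {w} iw i≤a j≤a+i (μ , ν , 𝔬μ , 𝔬ν , Vy) with Ind-span iy (proj₁ iw)
        ... | c₀ , c₁ , c₂ , (𝔬c₀ , 𝔬c₁ , 𝔬c₂) , w≈ = cases (V? 1 c₁)
          where
          k′ M : ℕ
          k′ = j ∸ a
          M = i ⊓ (j ∸ i)
          k′≤M : k′ ℕ.≤ M
          k′≤M = ≤⇒k≤m i≤a j≤a+i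
          Vs : V k′ (1# - ν * c₁) × V k′ (0# - ν * c₂)
          Vs = combination-compare 𝔬-0# (𝔬-+ 𝔬μ (𝔬-* 𝔬ν 𝔬c₀)) 𝔬ν 𝔬-1# 𝔬-0# 𝔬c₁ 𝔬c₂ (V-resp
            (linear (- ν) w≈ (solve 7 (λ y w μ ν c₀ c₁ c₂ →
              (y :- (μ :+ ν :* w)) :- ((con 0ℤ :+ con 1ℤ :* y :+ con 0ℤ :* (y :* y)) :- ((μ :+ ν :* c₀) :+ ν :* (con 0ℤ :+ c₁ :* y :+ c₂ :* (y :* y))))
              := (:- ν) :* (w :- (c₀ :+ c₁ :* y :+ c₂ :* (y :* y)))) refl y w μ ν c₀ c₁ c₂)) Vy)
          Goal : Set (c ⊔ k)
          Goal = Σ[ x ∈ Points i j ] ∃₂ λ μ ν → 𝔬 μ × 𝔬 ν × U ν × V M (w - (μ + ν * point x))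

          first : ¬ V 1 c₁ → Goal
          first ¬Vc₁ with 𝔬-inverse 𝔬c₁ ¬Vc₁
          ... | u , 𝔬u , _ , c₁u≈1 with 𝔬-divide k′ (𝔬-* 𝔬u 𝔬c₂) (V-resp
                (linear (- (ν * c₂)) c₁u≈1 (solve 4 (λ u c₁ c₂ ν →
                  ((u :* c₂) :* (con 1ℤ :- ν :* c₁) :- (con 0ℤ :- ν :* c₂)) :- (u :* c₂) := (:- (ν :* c₂)) :* (c₁ :* u :- con 1ℤ)) refl u c₁ c₂ ν))
                (V-- (V-*ˡ (proj₂ (𝔬-* 𝔬u 𝔬c₂)) (proj₁ Vs)) (proj₂ Vs)))
          ... | x , 𝔬x , uc₂≈ with expand-surjective (M ∸ k′) 𝔬x
          ... | d , Vd = inj₁ (k′≤M , d) , c₀ , c₁ , 𝔬c₀ , 𝔬c₁ , (proj₂ 𝔬c₁ , ¬Vc₁) , V-resp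
            (linear₂ (- 1#) (- (y * y)) w≈ c₂≈ (solve 8 (λ w c₀ c₁ c₂ y p x e →
              (p :* (x :- e)) :* (c₁ :* (y :* y)) :- (w :- (c₀ :+ c₁ :* (con 0ℤ :+ con 1ℤ :* y :+ (p :* e) :* (y :* y)))) :=
              (:- con 1ℤ) :* (w :- (c₀ :+ c₁ :* y :+ c₂ :* (y :* y))) :+ (:- (y :* y)) :* (c₂ :- c₁ :* (p :* x)))
              refl w c₀ c₁ c₂ y (ϖ^ k′) x (expand (M ∸ k′) d)))
            (V-*ʳ (≡⇒V (ℕ.m+[n∸m]≡n k′≤M) (V-ϖ^* k′ Vd)) (V-* (proj₂ 𝔬c₁) (V-* (proj₁ iy) (proj₁ iy))))
            where
            c₂≈ : c₂ ≈ c₁ * (ϖ^ k′ * x)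
            c₂≈ = linear₂ (- c₂) c₁ c₁u≈1 uc₂≈ (solve 5 (λ c₁ c₂ u p x →
              c₂ :- c₁ :* (p :* x) := (:- c₂) :* (c₁ :* u :- con 1ℤ) :+ c₁ :* (u :* c₂ :- p :* x)) refl c₁ c₂ u (ϖ^ k′) x)

          second : V 1 c₁ → Goal
          second Vc₁ with 1 ℕ.≤? M
          -- For M = 0 the second chart is empty and any point of the first one will do.
          ... | no 1≰M = inj₁ (k′≤M , d) , 0# , 1# , 𝔬-0# , 𝔬-1# , U-1# , V-mono (ℕ.≮⇒≥ 1≰M)
            (V-- (proj₁ iw) (v-+ V-0# (V-* V-1# (proj₁ (point-Ind {i} {j} (inj₁ (k′≤M , d)))))))
            where
            d : Fin (q ℕ.^ (M ∸ k′))
            d = proj₁ (expand-surjective (M ∸ k′) 𝔬-0#)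
          ... | yes 1≤M with 𝔬-inverse 𝔬c₂ (λ Vc₂ → Ind-combination⁻¹ (proj₁ iy) 𝔬c₀ (Ind-resp w≈ iw) (Vc₁ , Vc₂))
          ... | u , 𝔬u , Uu , c₂u≈1 with 𝔬-divide 1 (𝔬-* 𝔬u 𝔬c₁) (V-*ˡ (proj₂ 𝔬u) Vc₁)
          ... | x , 𝔬x , uc₁≈ with expand-surjective (M ∸ 1) 𝔬x
          ... | d , Vd = inj₂ ((j≤a , 1≤M) , d) , c₀ , c₂ , 𝔬c₀ , 𝔬c₂ , U-c₂ , V-resp
            (linear₂ (- 1#) (- y) w≈ c₁≈ (solve 8 (λ w c₀ c₁ c₂ y p x e →
              (p :* (x :- e)) :* (c₂ :* y) :- (w :- (c₀ :+ c₂ :* (con 0ℤ :+ (p :* e) :* y :+ con 1ℤ :* (y :* y)))) :=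
              (:- con 1ℤ) :* (w :- (c₀ :+ c₁ :* y :+ c₂ :* (y :* y))) :+ (:- y) :* (c₁ :- c₂ :* (p :* x)))
              refl w c₀ c₁ c₂ y (ϖ^ 1) x (expand (M ∸ 1) d)))
            (V-*ʳ (≡⇒V (ℕ.m+[n∸m]≡n 1≤M) (V-ϖ^* 1 Vd)) (V-* (proj₂ 𝔬c₂) (proj₁ iy)))
            where
            c₁≈ : c₁ ≈ c₂ * (ϖ^ 1 * x)
            c₁≈ = linear₂ (- c₁) c₂ c₂u≈1 uc₁≈ (solve 5 (λ c₁ c₂ u p x →
              c₁ :- c₂ :* (p :* x) := (:- c₁) :* (c₂ :* u :- con 1ℤ) :+ c₂ :* (u :* c₁ :- p :* x)) refl c₁ c₂ u (ϖ^ 1) x)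
            U-c₂ : U c₂
            U-c₂ = U-factor (proj₂ 𝔬c₂) (proj₁ Uu) (U-resp (sym c₂u≈1) U-1#)
            j≤a : j ℕ.≤ a
            -- Otherwise ν c₁ ≡ 1 modulo ϖ, although ϖ divides c₁.
            j≤a = ℕ.m∸n≡0⇒m≤n (ℕ.n<1⇒n≡0 (ℕ.≰⇒> λ 1≤k′ → ¬V₁1 (V-resp
              (solve 2 (λ ν c₁ → (con 1ℤ :- ν :* c₁) :+ ν :* c₁ := con 1ℤ) refl ν c₁)
              (v-+ (V-mono 1≤k′ (proj₁ Vs)) (V-*ˡ (proj₂ 𝔬ν) Vc₁)))))

          cases : Dec (V 1 c₁) → Goal
          cases (no ¬V) = first ¬V
          cases (yes Vc₁) = second Vc₁

        private
          V-expand : ∀ {m n} l {d d′} → l ℕ.≤ m → m ∸ l ≡ n → V m (ϖ^ l * expand n d - ϖ^ l * expand n d′) → d ≡ d′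
          V-expand {m} l {d} {d′} l≤m ≡.refl Vdd′ = expand-injective (m ∸ l) (V-ϖ^-cancel l (≡⇒V (≡.sym (ℕ.m+[n∸m]≡n l≤m))
            (V-resp (solve 3 (λ p x y → p :* x :- p :* y := p :* (x :- y)) refl (ϖ^ l) (expand (m ∸ l) d) (expand (m ∸ l) d′)) Vdd′)))

          V-transfer : ∀ {m ν x y} → V 0 y → V m (1# - ν * 1#) → V m (x - ν * y) → V m (x - y)
          V-transfer {m} {ν} {x} {y} Vy V₁ V₂ = V-resp
            (solve 3 (λ ν x y → (x :- ν :* y) :- (con 1ℤ :- ν :* con 1ℤ) :* y := x :- y) refl ν x y) (V-- V₂ (V-*ʳ V₁ Vy))

          absurd : ∀ {m ν y} → 1 ℕ.≤ m → V 0 ν → V 1 y → ¬ V m (1# - ν * y)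
          absurd {m} {ν} {y} 1≤m Vν Vy V₁ = ¬V₁1 (V-resp (solve 2 (λ ν y → (con 1ℤ :- ν :* y) :+ ν :* y := con 1ℤ) refl ν y)
            (v-+ (V-mono 1≤m V₁) (V-*ˡ Vν Vy)))

        point-injective : ∀ {i j} (x x′ : Points i j) → point x ∼ point x′ mod (i ⊓ (j ∸ i)) → x ≡ x′
        point-injective {i} {j} x x′ (μ , ν , 𝔬μ , 𝔬ν , Vw)
          with combination-compare 𝔬-0# 𝔬μ 𝔬ν (𝔬-point₁ x) (𝔬-point₂ x) (𝔬-point₁ x′) (𝔬-point₂ x′) Vw
        point-injective {i} {j} (inj₁ (p , d)) (inj₁ (p′ , d′)) (μ , ν , 𝔬μ , 𝔬ν , Vw) | V₁ , V₂ =
          ≡.cong₂ (λ p d → inj₁ (p , d)) (ℕ.≤-irrelevant p p′)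
            (V-expand (j ∸ a) p ≡.refl (V-transfer (proj₂ (𝔬-point₂ {i} {j} (inj₁ (p′ , d′)))) V₁ V₂))
        point-injective {i} {j} x@(inj₁ _) (inj₂ ((_ , 1≤m) , d′)) (μ , ν , 𝔬μ , 𝔬ν , Vw) | V₁ , V₂ =
          contradiction V₁ (absurd 1≤m (proj₂ 𝔬ν) (V-*ʳ (V-ϖ^ 1) (proj₂ (expand∈𝔬 (i ⊓ (j ∸ i) ∸ 1) d′))))
        point-injective {i} {j} (inj₂ ((_ , 1≤m) , d)) x′@(inj₁ _) (μ , ν , 𝔬μ , 𝔬ν , Vw) | V₁ , V₂ =
          contradiction V₂ (λ V₂ → ¬V₁1 (V-resp
            (solve 3 (λ ν x e → ((con 1ℤ :- ν :* e) :- (x :- ν :* con 1ℤ) :* e) :+ x :* e := con 1ℤ) refl ν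
              (ϖ^ 1 * expand (i ⊓ (j ∸ i) ∸ 1) d) (point₂ {i} {j} x′))
            (v-+ (V-- (V-mono 1≤m V₂) (V-*ʳ (V-mono 1≤m V₁) (proj₂ (𝔬-point₂ {i} {j} x′))))
                 (V-*ʳ (V-*ʳ (V-ϖ^ 1) (proj₂ (expand∈𝔬 (i ⊓ (j ∸ i) ∸ 1) d))) (proj₂ (𝔬-point₂ {i} {j} x′))))))
        point-injective {i} {j} (inj₂ ((j≤a , 1≤m) , d)) (inj₂ ((j≤a′ , 1≤m′) , d′)) (μ , ν , 𝔬μ , 𝔬ν , Vw) | V₁ , V₂ =
          ≡.cong₂ (λ p d → inj₂ (p , d)) (≡.cong₂ _,_ (ℕ.≤-irrelevant j≤a j≤a′) (ℕ.≤-irrelevant 1≤m 1≤m′))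
            (V-expand 1 1≤m ≡.refl (V-transfer (proj₂ (𝔬-point₁ {i} {j} (inj₂ ((j≤a′ , 1≤m′) , d′)))) V₂ V₁))

  -- Codes for the classes of lattices stable under Lat a b y.

  module _ {y} (iy : Ind y) (a b : ℕ) where
    Code : Set
    Code = ∃ λ j → j ℕ.< suc b × ∃ λ i → i ℕ.< suc j × Points iy a i j

    code-↔ : Fin (Count.total q a b) ↔ Code
    code-↔ = sumTo-↔ (suc b) λ j → sumTo-↔ (suc j) λ i →
      (guard-↔ (j ∸ a ℕ.≤? i ⊓ (j ∸ i)) ℕ.≤-irrelevant _
        ⊎-↔ guard-↔ (j ℕ.≤? a ×-dec 1 ℕ.≤? i ⊓ (j ∸ i))
              (λ (p , r) (p′ , r′) → ≡.cong₂ _,_ (ℕ.≤-irrelevant p p′) (ℕ.≤-irrelevant r r′)) _)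
      ↔-∘ Fin.+↔⊎

    module _ (C : Code) where
      private
        i j : ℕ
        j = proj₁ C
        i = proj₁ (proj₂ (proj₂ C))
        x : Points iy a i j
        x = proj₂ (proj₂ (proj₂ (proj₂ C)))
        i≤j : i ℕ.≤ j
        i≤j = ℕ.≤-pred (proj₁ (proj₂ (proj₂ (proj₂ C))))
        j≤b : j ℕ.≤ b
        j≤b = ℕ.≤-pred (proj₁ (proj₂ C))
        iw : Ind (point iy a {i} {j} x)
        iw = point-Ind iy a {i} {j} x

      lattice : Pred Carrier (c ⊔ k)
      lattice = Lat i j (point iy a {i} {j} x)

      lattice-isLattice : IsLattice b lattice
      lattice-isLattice = record { L ; V-⊆ = L.V-⊆ ∘ V-mono j≤b }
        where module L = IsLattice (Lat-isLattice {i} {j} (proj₁ iw))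

      lattice? : ∀ z → Dec (lattice z)
      lattice? = Lat? i≤j iw

      lattice-stable : ∀ {r z} → Lat a b y r → lattice z → lattice (r * z)
      lattice-stable = multiplier (proj₁ iy) (proj₁ iw) (proj₁ (Points⇒≤ iy a i≤j x)) j≤b
        (proj₂ (Points⇒≤ iy a i≤j x)) (point-∼ iy a {i} {j} x)

    opaque
      lattice-injective : ∀ C C′ → lattice C ≃ lattice C′ → C ≡ C′
      lattice-injective (j , j<1+b , i , i<1+j , x) (j′ , j′<1+b , i′ , i′<1+j′ , x′) h
        with ℕ.≤-antisym (≃⇒j≥ (point-Ind iy a {i′} {j′} x′) (point-Ind iy a {i} {j} x) (ℕ.≤-pred i<1+j) (≃-sym h))
                         (≃⇒j≥ (point-Ind iy a {i} {j} x) (point-Ind iy a {i′} {j′} x′) (ℕ.≤-pred i′<1+j′) h)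
           | ℕ.≤-antisym (≃⇒i≥ (point-Ind iy a {i′} {j′} x′) (point-Ind iy a {i} {j} x) (ℕ.≤-pred i<1+j) (≃-sym h))
                         (≃⇒i≥ (point-Ind iy a {i} {j} x) (point-Ind iy a {i′} {j′} x′) (ℕ.≤-pred i′<1+j′) h)
      ... | ≡.refl | ≡.refl
        with point-injective iy a {i} {j} x x′
               (≃⇒∼ (point-Ind iy a {i} {j} x) (point-Ind iy a {i} {j} x′) (ℕ.≤-pred i′<1+j′) h ≡.refl)
           | ℕ.≤-irrelevant j<1+b j′<1+b | ℕ.≤-irrelevant i<1+j i′<1+j′
      ... | ≡.refl | ≡.refl | ≡.refl = ≡.refl

      lattice-complete : ∀ {p} {P : Pred Carrier p} → IsLattice b P → (∀ z → Dec (P z)) →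
        (∀ {r z} → Lat a b y r → P z → P (r * z)) → ∃[ C ] P ≃ lattice C
      lattice-complete P-lat P? stable with normal-form P-lat P?
      ... | i , j , w , i≤j , j≤b , iw , P⊆L , L⊆P
        with multiplier⁻¹ {a = a} iy iw i≤j
               (P⊆L (IsLattice.resp P-lat (*-identityʳ _) (stable Lat-generator (IsLattice.1-closed P-lat))))
               (P⊆L (stable Lat-generator (L⊆P Lat-generator)))
      ... | i≤a , j≤a+i , y∼w with point-complete iy a iw i≤a j≤a+i y∼w
      ... | x , μ , ν , 𝔬μ , 𝔬ν , Uν , Vw = (j , s≤s j≤b , i , s≤s i≤j , x)
        , ≃-sym (≃-respʳ (≃-sym (∼⇒≃ i≤j (point-Ind iy a {i} {j} x) iw 𝔬μ 𝔬ν Uν Vw)) (L⊆P , P⊆L))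

-- Linear algebra over the subfield and Nakayama's lemma.

module LinearAlgebra {c ℓ} {E : DiscretelyValuedField c ℓ} {k} (S : Subfield E k) where
  open DiscretelyValuedField E hiding (π)
  open Valuation E
  open Subfield S
  open Uniformiser E v-ϖ
  open Scalars S
  open IntegerSolver commutativeRing
  open LinearCombination commutativeRing
  open import Algebra.Properties.CommutativeMonoid.Sum +-commutativeMonoid using (sum; sum-remove; sum-cong-≋)
  open import Algebra.Properties.Semiring.Sum semiring using (*-distribˡ-sum)
  open import Data.Vec.Functional using (insertAt)
  open import Data.Vec.Functional.Properties using (insertAt-lookup; insertAt-punchIn)
  private module K = IsSubring K-isSubring

  sum-*+ : ∀ {n} (a a′ : Fin n → Carrier) (r : Carrier) (b : Fin n → Carrier) →
           sum (λ i → (a i + r * a′ i) * b i) ≈ sum (λ i → a i * b i) + r * sum (λ i → a′ i * b i)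
  sum-*+ {zero}  a a′ r b = solve 1 (λ r → con 0ℤ := con 0ℤ :+ r :* con 0ℤ) refl r
  sum-*+ {suc n} a a′ r b = trans (+-congˡ (sum-*+ {n} (a ∘ Fin.suc) (a′ ∘ Fin.suc) r (b ∘ Fin.suc)))
    (solve 6 (λ a a′ r b s s′ → (a :+ r :* a′) :* b :+ (s :+ r :* s′) := (a :* b :+ s) :+ r :* (a′ :* b :+ s′))
      refl (a Fin.zero) (a′ Fin.zero) r (b Fin.zero) (sum (λ i → a (Fin.suc i) * b (Fin.suc i))) (sum (λ i → a′ (Fin.suc i) * b (Fin.suc i))))

  sum-*- : ∀ {n} (a x r : Fin n → Carrier) (y : Carrier) →
           sum (λ i → a i * (x i - r i * y)) ≈ sum (λ i → a i * x i) - sum (λ i → a i * r i) * y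
  sum-*- {zero}  a x r y = solve 1 (λ y → con 0ℤ := con 0ℤ :- con 0ℤ :* y) refl y
  sum-*- {suc n} a x r y = trans (+-congˡ (sum-*- {n} (a ∘ Fin.suc) (x ∘ Fin.suc) (r ∘ Fin.suc) y))
    (solve 6 (λ a x r y s s′ → a :* (x :- r :* y) :+ (s :- s′ :* y) := (a :* x :+ s) :- (a :* r :+ s′) :* y)
      refl (a Fin.zero) (x Fin.zero) (r Fin.zero) y (sum (λ i → a (Fin.suc i) * x (Fin.suc i))) (sum (λ i → a (Fin.suc i) * r (Fin.suc i))))

  sum-cong : ∀ {n} (x y : Fin n → Carrier) → (∀ i → x i ≈ y i) → sum x ≈ sum y
  sum-cong x y x≈y = sum-cong-≋ {x = x} {y = y} x≈y

  K-sum : ∀ {n} {a : Fin n → Carrier} → (∀ i → K (a i)) → K (sum a)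
  K-sum {zero}  Ka = K.0-closed
  K-sum {suc n} Ka = K.+-closed (Ka Fin.zero) (K-sum (Ka ∘ Fin.suc))

  ⟨_⟩ : ∀ {n} → (Fin n → Carrier) → Pred Carrier (c ⊔ ℓ ⊔ k)
  ⟨_⟩ {n} b x = Σ[ a ∈ (Fin n → Carrier) ] (∀ i → K (a i)) × x ≈ sum (λ i → a i * b i)

  Dependent : ∀ {n} → (Fin n → Carrier) → Set (c ⊔ ℓ ⊔ k)
  Dependent {n} x = Σ[ a ∈ (Fin n → Carrier) ] (∀ i → K (a i)) × (∃ λ p → ¬ a p ≈ 0#) × sum (λ i → a i * x i) ≈ 0#

  opaque
    eliminate : ∀ {n} p (x : Fin (suc n) → Carrier) (r : Fin n → Carrier) → (∀ i → K (r i)) →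
                Dependent (λ i → x (Fin.punchIn p i) - r i * x p) → Dependent x
    eliminate {n} p x r Kr (a , Ka , (p′ , ap′≉0) , relation) = a⁺ , Ka⁺
      , (Fin.punchIn p p′ , λ a⁺≈0 → ap′≉0 (trans (reflexive (≡.sym (insertAt-punchIn a p pivotal p′))) a⁺≈0))
      , trans (sum-remove {i = p} (λ i → a⁺ i * x i)) (trans
          (+-cong (*-congʳ (reflexive (insertAt-lookup a p pivotal))) (sum-cong-≋ (λ i → *-congʳ (reflexive (insertAt-punchIn a p pivotal i)))))
          (linear 1# (trans (sym (sum-*- a (x ∘ Fin.punchIn p) r (x p))) relation)
            (solve 3 (λ s t y → ((:- s) :* y :+ t) :- con 0ℤ := con 1ℤ :* ((t :- s :* y) :- con 0ℤ)) refl
              (sum (λ i → a i * r i)) (sum (λ i → a i * x (Fin.punchIn p i))) (x p))))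
      where
      pivotal : Carrier
      pivotal = - sum (λ i → a i * r i)
      a⁺ : Fin (suc n) → Carrier
      a⁺ = insertAt a p pivotal
      Ka⁺ : ∀ i → K (a⁺ i)
      Ka⁺ i with p Fin.≟ i
      ... | yes ≡.refl = K.resp (reflexive (≡.sym (insertAt-lookup a p pivotal))) (K.neg-closed (K-sum (λ i → K.*-closed (Ka i) (Kr i))))
      ... | no p≢i = K.resp (reflexive (≡.trans (≡.sym (insertAt-punchIn a p pivotal (Fin.punchOut p≢i))) (≡.cong a⁺ (Fin.punchIn-punchOut p≢i)))) (Ka _)

  opaque
    pivot : ∀ {n} (b : Fin (suc n) → Carrier) {x x′ u} (x∈ : ⟨ b ⟩ x) (x′∈ : ⟨ b ⟩ x′) →
            proj₁ x′∈ Fin.zero * u ≈ 1# → K u → ⟨ b ∘ Fin.suc ⟩ (x - (proj₁ x∈ Fin.zero * u) * x′)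
    pivot b {x} {x′} {u} (a , Ka , x≈) (a′ , Ka′ , x′≈) a′u≈1 Ku =
        (λ i → a (Fin.suc i) + (- (a Fin.zero * u)) * a′ (Fin.suc i))
      , (λ i → K.+-closed (Ka _) (K.*-closed (K.neg-closed (K.*-closed (Ka _) Ku)) (Ka′ _)))
      , trans (+-cong x≈ (-‿cong (*-congˡ x′≈))) (trans
          (linear (- (a Fin.zero * b Fin.zero)) a′u≈1 (solve 6 (λ a a′ u b s s′ →
            ((a :* b :+ s) :- (a :* u) :* (a′ :* b :+ s′)) :- (s :+ (:- (a :* u)) :* s′) := (:- (a :* b)) :* (a′ :* u :- con 1ℤ))
            refl (a Fin.zero) (a′ Fin.zero) u (b Fin.zero) (sum (λ i → a (Fin.suc i) * b (Fin.suc i))) (sum (λ i → a′ (Fin.suc i) * b (Fin.suc i)))))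
          (sym (sum-*+ (a ∘ Fin.suc) (a′ ∘ Fin.suc) (- (a Fin.zero * u)) (b ∘ Fin.suc))))

  opaque
    drop-zero : ∀ {n} (b : Fin (suc n) → Carrier) {x} (x∈ : ⟨ b ⟩ x) → proj₁ x∈ Fin.zero ≈ 0# → ⟨ b ∘ Fin.suc ⟩ x
    drop-zero b (a , Ka , x≈) a₀≈0 = a ∘ Fin.suc , Ka ∘ Fin.suc
      , trans x≈ (trans (+-congʳ (trans (*-congʳ a₀≈0) (zeroˡ _))) (+-identityˡ _))

    dependent-suc : ∀ {n} {x : Fin (suc n) → Carrier} → Dependent (x ∘ Fin.suc) → Dependent x
    dependent-suc {n} {x} (a , Ka , (p , ap≉0) , relation) = a⁺ , Ka⁺ , (Fin.suc p , ap≉0)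
      , trans (+-congʳ (zeroˡ _)) (trans (+-identityˡ _) relation)
      where
      a⁺ : Fin (suc n) → Carrier
      a⁺ Fin.zero    = 0#
      a⁺ (Fin.suc i) = a i
      Ka⁺ : ∀ i → K (a⁺ i)
      Ka⁺ Fin.zero    = K.0-closed
      Ka⁺ (Fin.suc i) = Ka i

  -- Induction on n by elimination of the first coordinate. A pivot can be searched for because the
  -- valuation decides vanishing.
  span⇒dependent : ∀ {n} (b : Fin n → Carrier) (x : Fin (suc n) → Carrier) → (∀ i → ⟨ b ⟩ (x i)) → Dependent x
  span⇒dependent {zero} b x x∈ = (λ _ → 1#) , (λ _ → K.1-closed) , (Fin.zero , 1≉0)
    , trans (+-congʳ (trans (*-identityˡ _) (proj₂ (proj₂ (x∈ Fin.zero))))) (+-identityˡ 0#)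
  span⇒dependent {suc n} b x x∈ = cases (Fin.any? (λ i → ¬? (≈0? (leading i))))
    where
    leading : Fin (suc (suc n)) → Carrier
    leading i = proj₁ (x∈ i) Fin.zero
    K-leading : ∀ i → K (leading i)
    K-leading i = proj₁ (proj₂ (x∈ i)) Fin.zero
    with-pivot : ∀ p → ∃[ u ] leading p * u ≈ 1# → Dependent x
    with-pivot p (u , apu≈1) = eliminate p x (λ i → leading (Fin.punchIn p i) * u)
      (λ i → K.*-closed (K-leading (Fin.punchIn p i)) Ku)
      (span⇒dependent (b ∘ Fin.suc) _ (λ i → pivot b (x∈ (Fin.punchIn p i)) (x∈ p) apu≈1 Ku))
      where
      Ku : K u
      Ku = K-inverse (K-leading p) apu≈1
    cases : Dec (∃ λ i → ¬ leading i ≈ 0#) → Dependent x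
    cases (yes (p , ap≉0)) = with-pivot p (invertible ap≉0)
    cases (no ¬pivot) = dependent-suc {x = x} (span⇒dependent (b ∘ Fin.suc) (x ∘ Fin.suc) λ i →
      drop-zero b (x∈ (Fin.suc i)) (decidable-stable (≈0? _) (λ ≉0 → ¬pivot (Fin.suc i , ≉0))))

  -- Division by a coefficient of least valuation makes all coefficients integral and that one equal
  -- to 1.
  normalise : ∀ {n} {x : Fin (suc n) → Carrier} → Dependent x →
    Σ[ a ∈ (Fin (suc n) → Carrier) ] (∀ i → 𝔬 (a i)) × (∃ λ p → ¬ V 1 (a p)) × sum (λ i → a i * x i) ≈ 0#
  normalise {n} {x} (a , Ka , (s , as≉0) , relation) = divide (minimal-v a)
    where
    divide : (∃[ p ] ∀ i → v (a p) ≤⁺ v (a i)) →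
      Σ[ a ∈ (Fin (suc n) → Carrier) ] (∀ i → 𝔬 (a i)) × (∃ λ p → ¬ V 1 (a p)) × sum (λ i → a i * x i) ≈ 0#
    divide (p , minimal) = divide′ (invertible (v-≤-≉0 (minimal s) as≉0))
      where
      divide′ : ∃[ u ] a p * u ≈ 1# → Σ[ a ∈ (Fin (suc n) → Carrier) ] (∀ i → 𝔬 (a i)) × (∃ λ p → ¬ V 1 (a p)) × sum (λ i → a i * x i) ≈ 0#
      divide′ (u , apu≈1) = (λ i → u * a i)
        , (λ i → K.*-closed (K-inverse (Ka p) apu≈1) (Ka i) , V-quotient apu≈1 (minimal i) (V-resp (sym apu≈1) V-1#))
        , (p , λ V₁ → ¬V₁1 (V-resp (trans (*-comm u (a p)) apu≈1) V₁))
        , trans (sum-cong-≋ (λ i → *-assoc u (a i) (x i))) (trans (sym (*-distribˡ-sum u (λ i → a i * x i)))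
            (trans (*-congˡ relation) (zeroʳ u)))

  span-sum : ∀ {m n} (b : Fin n → Carrier) {r x : Fin m → Carrier} → (∀ i → K (r i)) → (∀ i → ⟨ b ⟩ (x i)) →
             ⟨ b ⟩ (sum (λ i → r i * x i))
  span-sum {zero} {n} b Kr x∈ = (λ _ → 0#) , (λ _ → K.0-closed) , sym (trans (sum-*0 n b) refl)
    where
    sum-*0 : ∀ n (b : Fin n → Carrier) → sum (λ i → 0# * b i) ≈ 0#
    sum-*0 zero    b = refl
    sum-*0 (suc n) b = trans (+-cong (zeroˡ _) (sum-*0 n (b ∘ Fin.suc))) (+-identityˡ 0#)
  span-sum {suc m} {n} b {r} {x} Kr x∈ with span-sum b (Kr ∘ Fin.suc) (x∈ ∘ Fin.suc) | x∈ Fin.zero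
  ... | a , Ka , s≈ | a′ , Ka′ , x≈ = (λ i → a i + r Fin.zero * a′ i)
    , (λ i → K.+-closed (Ka i) (K.*-closed (Kr Fin.zero) (Ka′ i)))
    , trans (+-cong (*-congˡ x≈) s≈) (trans (+-comm _ _) (sym (sum-*+ a a′ (r Fin.zero) b)))

  sum-∈ : ∀ {n p} {N : Pred Carrier p} → N 0# → (∀ {x y} → N x → N y → N (x + y)) →
          {x : Fin n → Carrier} → (∀ i → N (x i)) → N (sum x)
  sum-∈ {zero}          N0 N+ Nx = N0
  sum-∈ {suc n} {N = N} N0 N+ Nx = N+ (Nx Fin.zero) (sum-∈ {N = N} N0 N+ (Nx ∘ Fin.suc))

  sum-closed : ∀ {n p} {N : Pred Carrier p} {a x : Fin n → Carrier} → IsModule N → N 0# →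
               (∀ i → 𝔬 (a i)) → (∀ i → N (x i)) → N (sum (λ i → a i * x i))
  sum-closed {N = N} N-mod N0 𝔬a Nx = sum-∈ {N = N} N0 +-closed (λ i → *-closed (𝔬a i) (Nx i))
    where open IsModule N-mod

  -- Induction on the number of elements, without determinants. The hypothesis for N + 𝔬 g₀ places
  -- the other elements there. The congruence of g₀ then becomes s g₀ ∈ N with s ≡ 1 modulo ϖ, and s
  -- is a unit.
  nakayama : ∀ {n} {N : Pred Carrier (c ⊔ k)} → IsModule N → N 0# → (g : Fin n → Carrier) →
    (∀ i → Σ[ a ∈ (Fin n → Carrier) ] (∀ j → 𝔬 (a j)) × N (g i - ϖ^ 1 * sum (λ j → a j * g j))) → ∀ i → N (g i)
  nakayama {suc n} {N} N-mod N0 g g∈ = λ { Fin.zero → Ng₀ ; (Fin.suc i) → rest i }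
    where
    open IsModule N-mod
    g₀ : Carrier
    g₀ = g Fin.zero
    N′ : Pred Carrier (c ⊔ k)
    N′ z = ∃ λ t → 𝔬 t × N (z - t * g₀)
    N′-mod : IsModule N′
    N′-mod = record
      { resp = λ { z≈ (t , 𝔬t , Nz) → t , 𝔬t , resp (+-congʳ z≈) Nz }
      ; +-closed = λ { {x} {y} (t , 𝔬t , Nx) (t′ , 𝔬t′ , Ny) → t + t′ , 𝔬-+ 𝔬t 𝔬t′ , resp
          (solve 5 (λ x y t t′ g → (x :- t :* g) :+ (y :- t′ :* g) := (x :+ y) :- (t :+ t′) :* g) refl x y t t′ g₀) (+-closed Nx Ny) }
      ; *-closed = λ { {a} {x} 𝔬a (t , 𝔬t , Nx) → a * t , 𝔬-* 𝔬a 𝔬t , resp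
          (solve 4 (λ a x t g → a :* (x :- t :* g) := a :* x :- (a :* t) :* g) refl a x t g₀) (*-closed 𝔬a Nx) }
      }
    N′0 : N′ 0#
    N′0 = 0# , 𝔬-0# , resp (solve 1 (λ g → con 0ℤ := con 0ℤ :- con 0ℤ :* g) refl g₀) N0
    coefficients : Fin (suc n) → Fin (suc n) → Carrier
    coefficients i = proj₁ (g∈ i)
    𝔬a : ∀ i j → 𝔬 (coefficients i j)
    𝔬a i = proj₁ (proj₂ (g∈ i))
    tail : Fin (suc n) → Carrier
    tail i = sum (λ j → coefficients i (Fin.suc j) * g (Fin.suc j))
    N′g : ∀ i → N′ (g (Fin.suc i))
    N′g = nakayama N′-mod N′0 (g ∘ Fin.suc) λ i → coefficients (Fin.suc i) ∘ Fin.suc , 𝔬a (Fin.suc i) ∘ Fin.suc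
      , ϖ^ 1 * coefficients (Fin.suc i) Fin.zero , 𝔬-* (𝔬-ϖ^ 1) (𝔬a (Fin.suc i) Fin.zero)
      , resp (solve 5 (λ x p a g s → x :- p :* (a :* g :+ s) := (x :- p :* s) :- (p :* a) :* g) refl
               (g (Fin.suc i)) (ϖ^ 1) (coefficients (Fin.suc i) Fin.zero) g₀ (tail (Fin.suc i)))
             (proj₂ (proj₂ (g∈ (Fin.suc i))))
    Ng₀ : N g₀
    Ng₀ = finish (sum-closed N′-mod N′0 (𝔬a Fin.zero ∘ Fin.suc) N′g)
      where
      finish : N′ (tail Fin.zero) → N g₀
      finish (t , 𝔬t , Ntail) = divide (𝔬-inverse 𝔬s ¬Vs)
        where
        s : Carrier
        s = 1# - ϖ^ 1 * (coefficients Fin.zero Fin.zero + t)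
        𝔬s : 𝔬 s
        𝔬s = 𝔬-- 𝔬-1# (𝔬-* (𝔬-ϖ^ 1) (𝔬-+ (𝔬a Fin.zero Fin.zero) 𝔬t))
        ¬Vs : ¬ V 1 s
        ¬Vs Vs = ¬V₁1 (V-resp (solve 2 (λ p r → (con 1ℤ :- p :* r) :+ p :* r := con 1ℤ) refl (ϖ^ 1) (coefficients Fin.zero Fin.zero + t))
          (v-+ Vs (V-*ʳ (V-ϖ^ 1) (proj₂ (𝔬-+ (𝔬a Fin.zero Fin.zero) 𝔬t)))))
        divide : (∃[ u ] 𝔬 u × U u × s * u ≈ 1#) → N g₀
        divide (u , 𝔬u , _ , su≈1) = resp
          (linear g₀ su≈1 (solve 6 (λ g u p a t s →
            (u :* ((g :- p :* (a :* g :+ s)) :+ p :* (s :- t :* g))) :- g := g :* ((con 1ℤ :- p :* (a :+ t)) :* u :- con 1ℤ))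
            refl g₀ u (ϖ^ 1) (coefficients Fin.zero Fin.zero) t (tail Fin.zero)))
          (*-closed 𝔬u (+-closed (proj₂ (proj₂ (g∈ Fin.zero))) (*-closed (𝔬-ϖ^ 1) Ntail)))
    rest : ∀ i → N (g (Fin.suc i))
    rest i = finish (N′g i)
      where
      finish : N′ (g (Fin.suc i)) → N (g (Fin.suc i))
      finish (t , 𝔬t , Nx) = resp (solve 2 (λ x y → (x :- y) :+ y := x) refl (g (Fin.suc i)) (t * g₀)) (+-closed Nx (*-closed 𝔬t Ng₀))

-- From the extension E/F to the abstract setting.

module Extension {c₁ ℓ₁ c₂ ℓ₂} {F : LocalField c₁ ℓ₁} {E : LocalField c₂ ℓ₂} (E/F : FiniteExtension F E)
                 (cubic : FiniteExtension.IsCubic E/F) (unramified : FiniteExtension.IsUnramified E/F) where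
  module F = LocalField F
  open LocalField E hiding (π; q)
  open FiniteExtension E/F using (ι; ι-isHom; ramification; hasDimension; asVectorSpace)
  open Valuation discretelyValuedField
  open IntegerSolver commutativeRing
  open LinearCombination commutativeRing
  private
    module ι = IsRingHomomorphism ι-isHom
    module VF = Valuation F.discretelyValuedField

  opaque
    ι-v : ∀ {x m} → F.v x ≡ [ m ] → v (ι x) ≡ [ m ]
    ι-v {x} {m} eq = ≡.trans (ramification eq)
      (≡.cong [_] (≡.trans (≡.cong (λ n → + n ℤ.* m) unramified) (ℤ.*-identityˡ m)))

    ι-0 : ∀ {x} → x F.≈ F.0# → ι x ≈ 0#
    ι-0 x≈0 = trans (ι.⟦⟧-cong x≈0) ι.0#-homo

    ι-V : ∀ {n x} → VF.V n x → V n (ι x)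
    ι-V {n} {x} Vx with F.v x in eq
    ... | [ m ] rewrite ι-v eq = Vx
    ... | ⊤⁺    = V-resp (sym (ι-0 (Equivalence.to F.v-∞ eq))) V-0#

    ι-V⁻¹ : ∀ {n x} → V n (ι x) → VF.V n x
    ι-V⁻¹ {n} {x} Vx with F.v x in eq
    ... | [ m ] rewrite ι-v eq = Vx
    ... | ⊤⁺    = _ ≤⊤⁺

    ι-- : ∀ x y → ι (x F.- y) ≈ ι x - ι y
    ι-- x y = trans (ι.+-homo x (F.- y)) (+-congˡ (ι.-‿homo y))

  K : Pred Carrier (c₁ ⊔ ℓ₂)
  K x = ∃ λ a → x ≈ ι a

  subfield : Subfield discretelyValuedField (c₁ ⊔ ℓ₂)
  subfield = record
    { K = K
    ; K-isSubring = record
      { resp       = λ { x≈y (a , x≈) → a , trans (sym x≈y) x≈ }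
      ; +-closed   = λ { (a , x≈) (b , y≈) → a F.+ b , trans (+-cong x≈ y≈) (sym (ι.+-homo a b)) }
      ; *-closed   = λ { (a , x≈) (b , y≈) → a F.* b , trans (*-cong x≈ y≈) (sym (ι.*-homo a b)) }
      ; neg-closed = λ { (a , x≈) → F.- a , trans (-‿cong x≈) (sym (ι.-‿homo a)) }
      ; 0-closed   = F.0# , sym ι.0#-homo
      ; 1-closed   = F.1# , sym ι.1#-homo
      }
    ; K-inverse = K-inverse
    ; ϖ   = ι F.π
    ; ϖ∈K = F.π , refl
    ; v-ϖ = ι-v F.v-π
    }
    where
    K-inverse : ∀ {x y} → K x → x * y ≈ 1# → K y
    K-inverse {x} {y} (a , x≈) xy≈1 = divide (F.invertible λ a≈0 →
        1≉0 (trans (sym xy≈1) (trans (*-congʳ (trans x≈ (ι-0 a≈0))) (zeroˡ y))))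
      where
      divide : (∃ λ b → a F.* b F.≈ F.1#) → K y
      divide (b , ab≈1) = b , linear₂ (ι b) (- y) xy≈1 xb≈1
        (solve 3 (λ x y b → y :- b := b :* (x :* y :- con 1ℤ) :+ (:- y) :* (x :* b :- con 1ℤ)) refl x y (ι b))
        where
        xb≈1 : x * ι b ≈ 1#
        xb≈1 = trans (*-congʳ x≈) (trans (sym (ι.*-homo a b)) (trans (ι.⟦⟧-cong ab≈1) ι.1#-homo))

  open Subfield subfield using (𝔬; v-ϖ)
  open Uniformiser discretelyValuedField v-ϖ
  open Scalars subfield
  open LinearAlgebra subfield
  open import Algebra.Properties.CommutativeMonoid.Sum +-commutativeMonoid using (sum)

  𝔬-ι : ∀ {a} → a ∈ F.Integral → 𝔬 (ι a)
  𝔬-ι Va = (_ , refl) , ι-V Va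

  private
    basis : Fin 3 → Carrier
    spans : ∀ x → ⟨ basis ⟩ x
    independent : ¬ Dependent basis
    threeDimensional : HasDimension {A = F.commutativeRing} asVectorSpace 3
    threeDimensional = ≡.subst (HasDimension {A = F.commutativeRing} asVectorSpace) cubic hasDimension
    basis = proj₁ threeDimensional
    spans x with proj₁ (proj₂ threeDimensional) x
    ... | a , x≈ = (λ i → ι (a i)) , (λ i → a i , refl) , x≈
    independent (a , Ka , (p , ap≉0) , relation) = ap≉0 (trans (proj₂ (Ka p)) (ι-0
      (proj₂ (proj₂ threeDimensional) (λ i → proj₁ (Ka i))
        (trans (sum-cong (λ i → ι (proj₁ (Ka i)) * basis i) (λ i → a i * basis i) (λ i → *-congʳ (sym (proj₂ (Ka i))))) relation) p)))

    digit : Fin F.q → Carrier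
    digit d = ι (proj₁ (Bijection.to F.residueCard d))

    digit∈𝔬 : ∀ d → 𝔬 (digit d)
    digit∈𝔬 d = 𝔬-ι (proj₂ (Bijection.to F.residueCard d))

    Relation : (x₀ x₁ x₂ x₃ : Carrier) → Set (c₁ ⊔ c₂ ⊔ ℓ₂)
    Relation x₀ x₁ x₂ x₃ = Σ[ c₀ ∈ Carrier ] Σ[ c₁ ∈ Carrier ] Σ[ c₂ ∈ Carrier ] Σ[ c₃ ∈ Carrier ]
      (𝔬 c₀ × 𝔬 c₁ × 𝔬 c₂ × 𝔬 c₃) × ¬ (V 1 c₀ × V 1 c₁ × V 1 c₂ × V 1 c₃)
      × c₀ * x₀ + c₁ * x₁ + c₂ * x₂ + c₃ * x₃ ≈ 0#

    opaque
      digit-injective : ∀ {d d′} → V 1 (digit d - digit d′) → d ≡ d′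
      digit-injective {d} {d′} Vd = Bijection.injective F.residueCard (ι-V⁻¹ (V-resp
        (sym (ι-- (proj₁ (Bijection.to F.residueCard d)) (proj₁ (Bijection.to F.residueCard d′)))) Vd))

      digit-surjective : ∀ {x} → 𝔬 x → ∃[ d ] V 1 (x - digit d)
      digit-surjective {x} ((a , x≈) , Vx) = finish (Bijection.surjective F.residueCard (a , ι-V⁻¹ (V-resp x≈ Vx)))
        where
        finish : (∃ λ d → ∀ {d′} → d′ ≡ d → VF.V 1 (proj₁ (Bijection.to F.residueCard d′) F.- a)) → ∃[ d ] V 1 (x - digit d)
        finish (d , Vd) = d , V-resp (linear (- 1#) x≈ (solve 3 (λ d a x → (:- (d :- a)) :- (x :- d) := (:- con 1ℤ) :* (x :- a)) refl (digit d) (ι a) x))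
          (V-neg (V-resp (ι-- _ a) (ι-V (Vd ≡.refl))))

      dependence : ∀ x₀ x₁ x₂ x₃ → Relation x₀ x₁ x₂ x₃
      dependence x₀ x₁ x₂ x₃ = finish (normalise {x = x} (span⇒dependent basis x (λ i → spans (x i))))
        where
        x : Fin 4 → Carrier
        x Fin.zero = x₀
        x (Fin.suc Fin.zero) = x₁
        x (Fin.suc (Fin.suc Fin.zero)) = x₂
        x (Fin.suc (Fin.suc (Fin.suc Fin.zero))) = x₃
        finish : (Σ[ a ∈ (Fin 4 → Carrier) ] (∀ i → 𝔬 (a i)) × (∃ λ p → ¬ V 1 (a p)) × sum (λ i → a i * x i) ≈ 0#) → Relation x₀ x₁ x₂ x₃
        finish (a , 𝔬a , (p , ¬Vp) , relation) = a 0F , a 1F , a 2F , a 3F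
          , (𝔬a 0F , 𝔬a 1F , 𝔬a 2F , 𝔬a 3F) , ¬all p ¬Vp
          , trans (solve 4 (λ a b c d → a :+ b :+ c :+ d := a :+ (b :+ (c :+ (d :+ con 0ℤ)))) refl
              (a 0F * x₀) (a 1F * x₁) (a 2F * x₂) (a 3F * x₃)) relation
          where
          ¬all : ∀ p → ¬ V 1 (a p) → ¬ (V 1 (a 0F) × V 1 (a 1F) × V 1 (a 2F) × V 1 (a 3F))
          ¬all 0F ¬V (V₀ , _) = ¬V V₀
          ¬all 1F ¬V (_ , V₁ , _) = ¬V V₁
          ¬all 2F ¬V (_ , _ , V₂ , _) = ¬V V₂
          ¬all 3F ¬V (_ , _ , _ , V₃) = ¬V V₃

  -- Integrality of R, and the residue degree extracted from R.

  module Order {p} {R : Pred Carrier p} (isOrder : IsOrder E/F R) {f} (conductor : IsConductorExponent E/F isOrder f) where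
    open IsOrder isOrder using (contains-𝔬; finitelyGenerated) renaming (spans to R-spans)
    module R = IsSubring (IsOrder.isSubring isOrder)

    n : ℕ
    n = proj₁ finitelyGenerated
    g : Fin n → Carrier
    g = proj₁ (proj₂ finitelyGenerated)
    g∈R : ∀ i → R (g i)
    g∈R = proj₁ (proj₂ (proj₂ finitelyGenerated))

    R-combination : ∀ {x} → R x → Σ[ a ∈ (Fin n → Carrier) ] (∀ i → 𝔬 (a i)) × x ≈ sum (λ i → a i * g i)
    R-combination {x} Rx with proj₂ (proj₂ (proj₂ finitelyGenerated)) x Rx
    ... | a , x≈ = (λ i → ι (proj₁ (a i))) , (λ i → 𝔬-ι (proj₂ (a i))) , x≈

    𝔬⊆R : ∀ {x} → 𝔬 x → R x
    𝔬⊆R ((a , x≈) , Vx) = R.resp (sym x≈) (contains-𝔬 (ι-V⁻¹ (V-resp x≈ Vx)))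

    opaque
      unfolding ϖ^_

      Vf⊆R : ∀ {x} → V f x → R x
      Vf⊆R Vx with V-divide f Vx
      ... | y , Vy , x≈ , _ = R.resp (sym x≈) (proj₂ (proj₂ conductor (1# , V-1# , sym (*-identityʳ _))) y Vy)

      f-least : ∀ {m} → (∀ {x} → V m x → R x) → f ℕ.≤ m
      f-least {m} Vm⊆R with proj₁ conductor {ϖ^ m} (ϖ^-integral m , λ b Vb → Vm⊆R (V-*ʳ (V-ϖ^ m) Vb))
      ... | b , Vb , ϖ^m≈ = V-ϖ^⁻¹ (V-resp (sym ϖ^m≈) (V-*ʳ (V-ϖ^ f) Vb))

    private
      bounded : ∀ {n} (g : Fin n → Carrier) → ∃[ B ] ∀ i → V 0 (ϖ^ B * g i)
      bounded {zero}  g = 0 , λ ()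
      bounded {suc n} g with bounded (g ∘ Fin.suc) | pole (g Fin.zero)
        where
        pole : ∀ x → ∃[ B ] V 0 (ϖ^ B * x)
        pole x with v x in eq
        ... | ⊤⁺ = 0 , V-resp (sym (trans (*-congˡ (Equivalence.to v-∞ eq)) (zeroʳ _))) V-0#
        ... | [ m ] = ℤ.∣ m ∣ , bound
          where
          bound : V 0 (ϖ^ ℤ.∣ m ∣ * x)
          bound rewrite v-* (ϖ^ ℤ.∣ m ∣) x | v-ϖ^ ℤ.∣ m ∣ | eq = [ nonneg m ]
            where
            nonneg : ∀ m → 0ℤ ℤ.≤ + ℤ.∣ m ∣ ℤ.+ m
            nonneg (+ m)    = ℤ.+≤+ z≤n
            nonneg -[1+ m ] = ℤ.≤-reflexive (≡.sym (ℤ.n⊖n≡0 (suc m)))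
      ... | B , VB | B′ , VB′ = B ℕ.+ B′ , λ
        { Fin.zero    → V-resp (trans (sym (*-assoc _ _ _)) (*-congʳ (sym (ϖ^-homo B B′)))) (V-* (ϖ^-integral B) VB′)
        ; (Fin.suc i) → V-resp (trans (sym (*-assoc _ _ _)) (*-congʳ (trans (*-comm _ _) (sym (ϖ^-homo B B′))))) (V-* (ϖ^-integral B′) (VB i)) }

    opaque
      -- The powers of a non-integral element have unbounded poles.
      R-integral : ∀ {x} → R x → V 0 x
      R-integral {x} Rx = decidable-stable (V? 0 x) λ ¬Vx → pole ¬Vx (invertible λ x≈0 → ¬Vx (V-resp (sym x≈0) V-0#))
        where
        B : ℕ
        B = proj₁ (bounded g)
        Vϖ^B : ∀ {z} → R z → V 0 (ϖ^ B * z)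
        Vϖ^B {z} Rz with R-combination Rz
        ... | a , 𝔬a , z≈ = V-resp (*-congˡ (sym z≈)) (sum-closed
          {N = λ z → Lift (c₂ ⊔ c₁ ⊔ ℓ₂) (V 0 (ϖ^ B * z))} record
            { resp     = λ { x≈y (lift Vx) → lift (V-resp (*-congˡ x≈y) Vx) }
            ; +-closed = λ { (lift Vx) (lift Vy) → lift (V-resp (sym (distribˡ _ _ _)) (v-+ Vx Vy)) }
            ; *-closed = λ { {t} {z} 𝔬t (lift Vz) → lift (V-resp (solve 3 (λ p t z → t :* (p :* z) := p :* (t :* z)) refl (ϖ^ B) t z)
                               (V-*ˡ (proj₂ 𝔬t) Vz)) }
            } (lift (V-resp (sym (zeroʳ _)) V-0#)) 𝔬a (λ i → lift (proj₂ (bounded g) i)) .lower)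
        pole : ¬ V 0 x → ∃[ y ] x * y ≈ 1# → ⊥
        pole ¬Vx (y , xy≈1) = ℕ.<-irrefl ≡.refl (V-ϖ^⁻¹ {suc B} {B} (V-resp
          (linear (ϖ^ B) (inverse (suc B)) (solve 3 (λ p x y → (p :* x) :* y :- p := p :* (x :* y :- con 1ℤ)) refl (ϖ^ B) (x ^ suc B) (y ^ suc B)))
          (V-*ˡ (Vϖ^B (power (suc B))) (V-power (suc B)))))
          where
          power : ∀ m → R (x ^ m)
          power zero    = R.1-closed
          power (suc m) = R.*-closed Rx (power m)
          V-power : ∀ m → V m (y ^ m)
          V-power zero    = V-1#
          V-power (suc m) = V-* (V-inverse ¬Vx xy≈1) (V-power m)
          inverse : ∀ m → x ^ m * y ^ m ≈ 1#
          inverse zero    = *-identityˡ 1#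
          inverse (suc m) = linear₂ (x ^ m * y ^ m) 1# xy≈1 (inverse m) (solve 4 (λ x y p q →
            (x :* p) :* (y :* q) :- con 1ℤ := (p :* q) :* (x :* y :- con 1ℤ) :+ con 1ℤ :* (p :* q :- con 1ℤ)) refl x y (x ^ m) (y ^ m))

    -- If O ⊆ 𝔬 + 𝔬 x + ϖ O then, by Nakayama's lemma, R ⊆ 𝔬 + 𝔬 x, so that E
    -- would be spanned over F by 1 and x.
    module _ {x} (near : ∀ {z} → V 0 z → ∃₂ λ a b → 𝔬 a × 𝔬 b × V 1 (z - (a + b * x))) where
      private
        N : Pred Carrier (c₂ ⊔ c₁ ⊔ ℓ₂)
        N z = ∃₂ λ a b → 𝔬 a × 𝔬 b × z ≈ a + b * x

        N-mod : IsModule N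
        N-mod = record
          { resp     = λ { z≈ (a , b , 𝔬a , 𝔬b , eq) → a , b , 𝔬a , 𝔬b , trans (sym z≈) eq }
          ; +-closed = λ { {z} {z′} (a , b , 𝔬a , 𝔬b , z≈) (a′ , b′ , 𝔬a′ , 𝔬b′ , z′≈) → a + a′ , b + b′ , 𝔬-+ 𝔬a 𝔬a′ , 𝔬-+ 𝔬b 𝔬b′
              , trans (+-cong z≈ z′≈) (solve 5 (λ a b a′ b′ x → (a :+ b :* x) :+ (a′ :+ b′ :* x) := (a :+ a′) :+ (b :+ b′) :* x) refl a b a′ b′ x) }
          ; *-closed = λ { {t} 𝔬t (a , b , 𝔬a , 𝔬b , z≈) → t * a , t * b , 𝔬-* 𝔬t 𝔬a , 𝔬-* 𝔬t 𝔬b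
              , trans (*-congˡ z≈) (solve 4 (λ t a b x → t :* (a :+ b :* x) := t :* a :+ (t :* b) :* x) refl t a b x) }
          }

        N0 : N 0#
        N0 = 0# , 0# , 𝔬-0# , 𝔬-0# , solve 1 (λ x → con 0ℤ := con 0ℤ :+ con 0ℤ :* x) refl x

        nearer : ∀ m {z} → V 0 z → ∃₂ λ a b → 𝔬 a × 𝔬 b × V m (z - (a + b * x))
        nearer zero    {z} Vz = 0# , 0# , 𝔬-0# , 𝔬-0# , V-resp (solve 2 (λ z x → z := z :- (con 0ℤ :+ con 0ℤ :* x)) refl z x) Vz
        nearer (suc m) {z} Vz with nearer m Vz
        ... | a , b , 𝔬a , 𝔬b , V₁ with V-divide m V₁
        ... | y , Vy , z≈ , _ with near Vy
        ... | a′ , b′ , 𝔬a′ , 𝔬b′ , V₂ = a + ϖ^ m * a′ , b + ϖ^ m * b′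
          , 𝔬-+ 𝔬a (𝔬-* (𝔬-ϖ^ m) 𝔬a′) , 𝔬-+ 𝔬b (𝔬-* (𝔬-ϖ^ m) 𝔬b′)
          , V-resp (linear (- 1#) z≈ (solve 8 (λ z a b a′ b′ x p y →
              p :* (y :- (a′ :+ b′ :* x)) :- (z :- ((a :+ p :* a′) :+ (b :+ p :* b′) :* x)) := (:- con 1ℤ) :* ((z :- (a :+ b :* x)) :- p :* y))
              refl z a b a′ b′ x (ϖ^ m) y))
            (≡.subst (λ n → V n (ϖ^ m * (y - (a′ + b′ * x)))) (ℕ.+-comm m 1) (V-ϖ^* m V₂))

        N-g : ∀ i → N (g i)
        -- Of the precision f + 1, the inclusion ϖᶠ O ⊆ R absorbs f, and the factor ϖ left over is
        -- the one in Nakayama's lemma.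
        N-g = nakayama N-mod N0 g λ i → approximate i (nearer (suc f) (R-integral (g∈R i)))
          where
          approximate : ∀ i → (∃₂ λ a b → 𝔬 a × 𝔬 b × V (suc f) (g i - (a + b * x))) →
                        Σ[ a ∈ (Fin n → Carrier) ] (∀ j → 𝔬 (a j)) × N (g i - ϖ^ 1 * sum (λ j → a j * g j))
          approximate i (a , b , 𝔬a , 𝔬b , Vz) with V-divide 1 (V-mono (s≤s z≤n) Vz)
          ... | y , Vy , z≈ , _ with R-combination (Vf⊆R {y} (V-ϖ^-cancel 1 (V-resp z≈ Vz)))
          ... | t , 𝔬t , y≈ = t , 𝔬t , a , b , 𝔬a , 𝔬b , linear₂ 1# (ϖ^ 1) z≈ y≈ (solve 5 (λ g s p y σ →
            (g :- p :* σ) :- s := con 1ℤ :* ((g :- s) :- p :* y) :+ p :* (y :- σ)) refl (g i) (a + b * x) (ϖ^ 1) y (sum (λ j → t j * g j)))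

        pair : Fin 2 → Carrier
        pair Fin.zero = 1#
        pair (Fin.suc _) = x

        ⟨pair⟩-resp : ∀ {y z} → z ≈ y → ⟨ pair ⟩ y → ⟨ pair ⟩ z
        ⟨pair⟩-resp z≈y (t , Kt , y≈) = t , Kt , trans z≈y y≈

        coefficients : Carrier → Carrier → Fin 2 → Carrier
        coefficients a b Fin.zero    = a
        coefficients a b (Fin.suc _) = b

        N⊆pair : ∀ {z} → N z → ⟨ pair ⟩ z
        N⊆pair {z} (a , b , 𝔬a , 𝔬b , z≈) = coefficients a b , K-coefficients , trans z≈ (expansion a b x)
          where
          K-coefficients : ∀ i → K (coefficients a b i)
          K-coefficients Fin.zero    = proj₁ 𝔬a
          K-coefficients (Fin.suc _) = proj₁ 𝔬b
          expansion : ∀ a b x → a + b * x ≈ a * 1# + (b * x + 0#)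
          expansion = solve 3 (λ a b x → a :+ b :* x := a :* con 1ℤ :+ (b :* x :+ con 0ℤ)) refl

        R⊆pair : ∀ {z} → R z → ⟨ pair ⟩ z
        R⊆pair {z} Rz = finish (R-combination Rz)
          where
          finish : Σ[ a ∈ (Fin n → Carrier) ] (∀ i → 𝔬 (a i)) × z ≈ sum (λ i → a i * g i) → ⟨ pair ⟩ z
          finish (a , 𝔬a , z≈) = ⟨pair⟩-resp z≈ (span-sum pair {a} {g} (λ i → proj₁ (𝔬a i)) (λ i → N⊆pair (N-g i)))

        E⊆pair : ∀ z → ⟨ pair ⟩ z
        E⊆pair z = finish (R-spans z)
          where
          finish : z ∈ Span {A = F.commutativeRing} asVectorSpace R → ⟨ pair ⟩ z
          finish (m , h , h∈R , a , z≈) = ⟨pair⟩-resp z≈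
            (span-sum pair {λ i → ι (a i)} {h} (λ i → a i , refl) (λ i → R⊆pair (h∈R i)))

      not-near : ⊥
      not-near = independent (span⇒dependent pair basis (λ i → E⊆pair (basis i)))

    private
      residue : Fin (LocalField.q E) → Carrier
      residue d = proj₁ (Bijection.to residueCard d)

      -- Quantifies over digits only and is therefore decidable; its failure at some residue yields
      -- an actual element z rather than a double negation.
      Near : Carrier → Carrier → Set
      Near x z = ∃₂ λ d d′ → V 1 (z - (digit d + digit d′ * x))

      Near? : ∀ x z → Dec (Near x z)
      Near? x z = Fin.any? λ d → Fin.any? λ d′ → V? 1 (z - (digit d + digit d′ * x))

      approximate-residue : ∀ {x} → (∀ d → Near x (residue d)) → ∀ {z} → V 0 z → ∃₂ λ a b → 𝔬 a × 𝔬 b × V 1 (z - (a + b * x))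
      approximate-residue {x} near {z} Vz = finish (Bijection.surjective residueCard (z , Vz))
        where
        finish : (∃ λ d → ∀ {d′} → d′ ≡ d → V 1 (residue d′ - z)) → ∃₂ λ a b → 𝔬 a × 𝔬 b × V 1 (z - (a + b * x))
        finish (d , Vd) = finish′ (near d)
          where
          finish′ : Near x (residue d) → ∃₂ λ a b → 𝔬 a × 𝔬 b × V 1 (z - (a + b * x))
          finish′ (e , e′ , Ve) = digit e , digit e′ , digit∈𝔬 e , digit∈𝔬 e′ , V-resp
            (solve 3 (λ r z s → (r :- s) :- (r :- z) := z :- s) refl (residue d) z (digit e + digit e′ * x)) (V-- Ve (Vd ≡.refl))

      near-digits : ∀ {x z a b} → V 0 x → 𝔬 a → 𝔬 b → V 1 (z - (a + b * x)) → Near x z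
      near-digits {x} {z} {a} {b} Vx 𝔬a 𝔬b Vz = finish (digit-surjective 𝔬a) (digit-surjective 𝔬b)
        where
        finish : (∃[ e ] V 1 (a - digit e)) → (∃[ e ] V 1 (b - digit e)) → Near x z
        finish (e , Ve) (e′ , Ve′) = e , e′ , V-resp
          (solve 6 (λ z a b e e′ x → (z :- (a :+ b :* x)) :+ ((a :- e) :+ (b :- e′) :* x) := z :- (e :+ e′ :* x)) refl
            z a b (digit e) (digit e′) x)
          (v-+ Vz (v-+ Ve (V-*ʳ Ve′ Vx)))

    opaque
      residue-extension : ∀ {x} → V 0 x → ∃[ z ] V 0 z × (∀ {a b} → 𝔬 a → 𝔬 b → ¬ V 1 (z - (a + b * x)))
      residue-extension {x} Vx = cases (Fin.all? (λ d → Near? x (residue d)))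
        where
        cases : Dec (∀ d → Near x (residue d)) → ∃[ z ] V 0 z × (∀ {a b} → 𝔬 a → 𝔬 b → ¬ V 1 (z - (a + b * x)))
        cases (yes near) = ⊥-elim (not-near (approximate-residue near))
        cases (no ¬near) = finish (Fin.¬∀⟶∃¬ _ (λ d → Near x (residue d)) (λ d → Near? x (residue d)) ¬near)
          where
          finish : (∃ λ d → ¬ Near x (residue d)) → ∃[ z ] V 0 z × (∀ {a b} → 𝔬 a → 𝔬 b → ¬ V 1 (z - (a + b * x)))
          finish (d , ¬Nd) = residue d , proj₂ (Bijection.to residueCard d) , λ 𝔬a 𝔬b Vz → ¬Nd (near-digits Vx 𝔬a 𝔬b Vz)

    unramifiedCubic : UnramifiedCubic discretelyValuedField (c₁ ⊔ ℓ₂)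
    unramifiedCubic = record
      { subfield          = subfield
      ; q                 = F.q
      ; digit             = digit
      ; digit∈𝔬           = digit∈𝔬
      ; digit-injective   = digit-injective
      ; digit-surjective  = digit-surjective
      ; dependence        = dependence
      ; residue-extension = residue-extension
      }

-- The normal form of R and its colength.

module IdealClasses {c₁ ℓ₁ c₂ ℓ₂ p} {F : LocalField c₁ ℓ₁} {E : LocalField c₂ ℓ₂} (E/F : FiniteExtension F E)
                (cubic : FiniteExtension.IsCubic E/F) (unramified : FiniteExtension.IsUnramified E/F)
                {R : Pred (LocalField.Carrier E) p} (isOrder : IsOrder E/F R) {f : ℕ}
                (conductor : IsConductorExponent E/F isOrder f) where
  open LocalField E hiding (π; q)
  open Extension E/F cubic unramified using (module F; 𝔬-ι; module Order)
  open Order isOrder {f} conductor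
  open Valuation discretelyValuedField
  open UnramifiedCubic unramifiedCubic using (𝔬; K; ϖ; v-ϖ)
  open Uniformiser discretelyValuedField v-ϖ
  open IntegerSolver commutativeRing
  open LinearCombination commutativeRing
  open Cubic unramifiedCubic
  open LinearAlgebra (UnramifiedCubic.subfield unramifiedCubic) using (sum-∈; sum-closed; sum-cong)
  open import Algebra.Properties.CommutativeMonoid.Sum +-commutativeMonoid using (sum)
  open import Algebra.Properties.Semiring.Sum semiring using (*-distribˡ-sum)
  open FractionalIdeal using (ideal)

  R-isLattice : IsLattice f R
  R-isLattice = record
    { resp = R.resp ; +-closed = R.+-closed ; *-closed = λ 𝔬a → R.*-closed (𝔬⊆R 𝔬a)
    ; 1-closed = R.1-closed ; V-⊆ = Vf⊆R ; integral = R-integral }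

  isLattice⇒isModule : ∀ {p f} {P : Pred Carrier p} → IsLattice f P → IsModule P
  isLattice⇒isModule L = record { resp = resp ; +-closed = +-closed ; *-closed = *-closed }
    where open IsLattice L

  private
    w₀ : Carrier
    w₀ = proj₁ Ind-exists
    iw₀ : Ind w₀
    iw₀ = proj₂ Ind-exists
    base-isLattice : IsLattice f (Lat f f w₀)
    base-isLattice = Lat-isLattice (proj₁ iw₀)
    Vg : ∀ i → V 0 (g i)
    Vg i = R-integral (g∈R i)

  opaque
    -- R arises from the decidable lattice `Lat f f w₀`, which is 𝔬 + ϖᶠ O, by adjoining its
    -- finitely many generators.
    R? : ∀ x → Dec (R x)
    R? x = map′
      (adjoin-least g (isLattice⇒isModule R-isLattice)
        (Lat-least R-isLattice (Vf⊆R (V-*ʳ (V-ϖ^ f) (proj₁ iw₀))) Vf⊆R) g∈R)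
      (λ Rx → generated (R-combination Rx))
      (adjoin? g base-isLattice Vg (Lat? ℕ.≤-refl iw₀) x)
      where
      module A = IsLattice (adjoin-isLattice g base-isLattice Vg)
      generated : Σ[ a ∈ (Fin n → Carrier) ] (∀ i → 𝔬 (a i)) × x ≈ sum (λ i → a i * g i) → adjoin (Lat f f w₀) g x
      generated (a , 𝔬a , x≈) = A.resp (sym x≈) (sum-closed (isLattice⇒isModule (adjoin-isLattice g base-isLattice Vg))
        (A.V-⊆ V-0#) 𝔬a (adjoin-∋ g base-isLattice Vg))

  record OrderForm : Set (c₁ ⊔ ℓ₁ ⊔ c₂ ⊔ ℓ₂ ⊔ p) where
    field
      a    : ℕ
      y    : Carrier
      iy   : Ind y
      a≤f  : a ℕ.≤ f
      R⊆L  : R ⊆ Lat a f y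
      L⊆R  : Lat a f y ⊆ R

  opaque
    orderForm : OrderForm
    orderForm = build (normal-form R-isLattice R?)
      where
      build : (Σ[ i ∈ ℕ ] Σ[ j ∈ ℕ ] Σ[ w ∈ Carrier ] i ℕ.≤ j × j ℕ.≤ f × Ind w × R ≐ Lat i j w) → OrderForm
      build (i , j , w , i≤j , j≤f , iw , R⊆L , L⊆R)
        with ℕ.≤-antisym j≤f (f-least (L⊆R ∘ Lat-V))
      ... | ≡.refl = record { a = i ; y = w ; iy = iw ; a≤f = i≤j ; R⊆L = R⊆L ; L⊆R = L⊆R }

  open OrderForm orderForm public

  f≤2a : f ℕ.≤ a ℕ.+ a
  f≤2a = ring⇒≤2a iy a≤f (R⊆L (R.*-closed (L⊆R Lat-generator) (L⊆R Lat-generator)))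

  private
    M = quotient {A = F.𝒪} (𝒪E-over-𝔬 E/F) (order-isSubmodule E/F isOrder)

  R-difference-0 : ∀ {x y} → x ≈ y → R (x - y)
  R-difference-0 {x} {y} x≈y = R.resp (sym (trans (+-congʳ x≈y) (-‿inverseʳ y))) R.0-closed

  opaque
    a+f≤ : ∀ {s} → (∀ k → StrictChain {A = F.𝒪} M k → k ℕ.≤ s) → a ℕ.+ f ℕ.≤ s
    a+f≤ bound = bound (a ℕ.+ f) record
      -- The level of `step` involves ℓ₂, which the chains of M do not admit. The truth of its
      -- decision lives at level zero and can be lifted to any level.
      { N           = λ t z → Lift (c₁ ⊔ c₂ ⊔ p) (True (step? (toℕ t) (proj₁ z)))
      ; isSubmodule = λ t → record
        { resp      = λ {x} {z} x∼z (lift Nx) → lift (fromWitness (IsLattice.resp (step-lat (toℕ t))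
                        (solve 2 (λ x z → x :- (x :- z) := z) refl (proj₁ x) (proj₁ z))
                        (IsLattice.sub-closed (step-lat (toℕ t)) (toWitness Nx) (R⊆step (toℕ t) x∼z))))
        ; 0ᴹ-closed = lift (fromWitness (Lat-V V-0#))
        ; +ᴹ-closed = λ (lift Nx) (lift Nz) → lift (fromWitness (IsLattice.+-closed (step-lat (toℕ t)) (toWitness Nx) (toWitness Nz)))
        ; *ₗ-closed = λ b (lift Nx) → lift (fromWitness (IsLattice.*-closed (step-lat (toℕ t)) (𝔬-ι (proj₂ b)) (toWitness Nx)))
        }
      ; increasing  = λ t {z} (lift Nz) → lift (fromWitness (step-⊆ iy a≤f (toℕ t)
          (≡.subst (λ m → step iy a≤f m (proj₁ z)) (Fin.toℕ-inject₁ t) (toWitness Nz))))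
      ; strict      = λ t → strict t (step-strict iy a≤f (toℕ t) (Fin.toℕ<n t))
      }
      where
      step? : ∀ t x → Dec (step iy a≤f t x)
      step? t = Lat? (step-≤ iy a≤f t) iy
      step-lat : ∀ t → IsLattice (f ∸ (t ∸ a)) (step iy a≤f t)
      step-lat t = Lat-isLattice (proj₁ iy)
      R⊆step : ∀ t → R ⊆ step iy a≤f t
      R⊆step t = Lat-antitone (proj₁ iy) (ℕ.m∸n≤m a t) (ℕ.m∸n≤m f (t ∸ a)) ∘ R⊆L
      strict : ∀ (t : Fin (a ℕ.+ f)) → (∃[ x ] V 0 x × step iy a≤f (suc (toℕ t)) x × ¬ step iy a≤f (toℕ t) x) →
        Σ[ z ∈ Σ[ x ∈ Carrier ] V 0 x ] Lift (c₁ ⊔ c₂ ⊔ p) (True (step? (suc (toℕ t)) (proj₁ z))) × ¬ Lift (c₁ ⊔ c₂ ⊔ p) (True (step? (toℕ (Fin.inject₁ t)) (proj₁ z)))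
      strict t (x , Vx , Nx , ¬Nx) = (x , Vx) , lift (fromWitness Nx)
        , λ (lift Nx′) → ¬Nx (≡.subst (λ m → step iy a≤f m x) (Fin.toℕ-inject₁ t) (toWitness Nx′))

    -- Pulled back to E, a submodule of O/R contains R, so `chain-bound` applies. Invariance modulo
    -- R also makes membership independent of the proof of integrality that an element carries.
    ≤a+f : ∀ {s} → StrictChain {A = F.𝒪} M s → s ℕ.≤ a ℕ.+ f
    ≤a+f {s} chain = chain-bound s iy a≤f N′ N′-mod
      (λ { t (Vx , Nx) → Vx , increasing t Nx })
      (λ t → strict′ t (strict t))
      (λ Lx → R-integral (L⊆R Lx) , IsSubmodule.resp (isSubmodule Fin.zero)
        (R.+-closed R.0-closed (R.neg-closed (L⊆R Lx))) (IsSubmodule.0ᴹ-closed (isSubmodule Fin.zero)))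
      where
      open StrictChain chain
      N′ : Fin (suc s) → Pred Carrier (c₁ ⊔ c₂ ⊔ p)
      N′ t x = Σ[ Vx ∈ V 0 x ] N t (x , Vx)
      N′-mod : ∀ t → IsModule (N′ t)
      N′-mod t = record
        { resp     = λ { x≈z (Vx , Nx) → V-resp x≈z Vx , IsSubmodule.resp (isSubmodule t) (R-difference-0 x≈z) Nx }
        ; +-closed = λ { (Vx , Nx) (Vz , Nz) → v-+ Vx Vz , IsSubmodule.resp (isSubmodule t) (R-difference-0 refl)
                         (IsSubmodule.+ᴹ-closed (isSubmodule t) Nx Nz) }
        ; *-closed = λ { {b} {x} 𝔬b (Vx , Nx) → scale′ 𝔬b Vx Nx }
        }
        where
        scale′ : ∀ {b x} → 𝔬 b → (Vx : V 0 x) → N t (x , Vx) → N′ t (b * x)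
        scale′ {b} {x} ((b′ , b≈) , Vb) Vx Nx = V-* Vb Vx , IsSubmodule.resp (isSubmodule t) (R-difference-0 (*-congʳ (sym b≈)))
          (IsSubmodule.*ₗ-closed (isSubmodule t) (b′ , Extension.ι-V⁻¹ E/F cubic unramified (V-resp b≈ Vb)) Nx)
      strict′ : ∀ (t : Fin s) → (∃[ x ] x ∈ N (Fin.suc t) × x ∉ N (Fin.inject₁ t)) →
                ∃[ x ] V 0 x × N′ (Fin.suc t) x × ¬ N′ (Fin.inject₁ t) x
      strict′ t ((x , Vx) , Nx , ¬Nx) = x , Vx , (Vx , Nx)
        , λ (Vx′ , Nx′) → ¬Nx (IsSubmodule.resp (isSubmodule (Fin.inject₁ t)) (R-difference-0 refl) Nx′)

  length≡ : ∀ {s} → IsS E/F isOrder s → s ≡ a ℕ.+ f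
  length≡ (chain , bound) = ℕ.≤-antisym (≤a+f chain) (a+f≤ bound)

  -- Codes as fractional ideals, and ideals as codes.

  private
    Ideal : Set (lsuc (c₂ ⊔ ℓ₂ ⊔ p))
    Ideal = FractionalIdeal E/F isOrder

    _~_ : Ideal → Ideal → Set (c₂ ⊔ ℓ₂ ⊔ p)
    _~_ = Homothetic E/F isOrder

  module _ (C : Code iy a f) where
    private
      module L = IsLattice (lattice-isLattice iy a f C)
      i j : ℕ
      j = proj₁ C
      i = proj₁ (proj₂ (proj₂ C))
      w : Carrier
      w = point iy a {i} {j} (proj₂ (proj₂ (proj₂ (proj₂ C))))

      -- `lattice` lives at a level with c₁, which is too high for an ideal; the decision of
      -- membership is lifted instead.
      J : Pred Carrier (c₂ ⊔ ℓ₂ ⊔ p)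
      J x = Lift (c₂ ⊔ ℓ₂ ⊔ p) (True (lattice? iy a f C x))

      into : ∀ {x} → lattice iy a f C x → J x
      into Lx = lift (fromWitness Lx)

      out : ∀ {x} → J x → lattice iy a f C x
      out (lift Jx) = toWitness Jx

      -- ϖʲ O is spanned over 𝔬 by ϖʲ, ϖʲ y and ϖʲ y², the first being a multiple of the generator
      -- 1.
      generator : Fin 4 → Carrier
      generator 0F = 1#
      generator 1F = ϖ^ i * w
      generator 2F = ϖ^ j * y
      generator 3F = ϖ^ j * (y * y)

      generator∈ : ∀ t → lattice iy a f C (generator t)
      generator∈ 0F = L.1-closed
      generator∈ 1F = Lat-generator
      generator∈ 2F = Lat-V (V-*ʳ (V-ϖ^ j) (proj₁ iy))
      generator∈ 3F = Lat-V (V-*ʳ (V-ϖ^ j) (V-* (proj₁ iy) (proj₁ iy)))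

      Generated : Carrier → Set (c₂ ⊔ ℓ₂ ⊔ p)
      Generated x = Σ[ r ∈ (Fin 4 → ∃ R) ] x ≈ sum (λ t → proj₁ (r t) * generator t)

      opaque
        generated : ∀ {x} → lattice iy a f C x → Generated x
        generated {x} (α , β , 𝔬α , 𝔬β , Vx) = divide (quotient′ (V-divide j Vx))
          where
          quotient′ : ∀ {X} → (∃[ z ] V 0 z × X ≈ ϖ^ j * z × (K X → K z)) → ∃[ z ] V 0 z × X ≈ ϖ^ j * z
          quotient′ (z , Vz , x≈ , _) = z , Vz , x≈
          divide : (∃[ z ] V 0 z × x - (α + β * (ϖ^ i * w)) ≈ ϖ^ j * z) → Generated x
          divide (z , Vz , x≈) = expand-z (Ind-span iy Vz)
            where
            expand-z : (Σ[ c ∈ Carrier ] Σ[ d ∈ Carrier ] Σ[ e ∈ Carrier ] (𝔬 c × 𝔬 d × 𝔬 e) × z ≈ c + d * y + e * (y * y)) → Generated x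
            expand-z (γ , δ , ε , (𝔬γ , 𝔬δ , 𝔬ε) , z≈) = r
              , linear₂ 1# (ϖ^ j) x≈ z≈ (trans
                  (+-congˡ (-‿cong (solve 8 (λ α β W p γ δ ε y →
                    (α :+ p :* γ) :* con 1ℤ :+ (β :* W :+ (δ :* (p :* y) :+ (ε :* (p :* (y :* y)) :+ con 0ℤ)))
                      := (α :+ β :* W) :+ p :* (γ :+ δ :* y :+ ε :* (y :* y))) refl α β (ϖ^ i * w) (ϖ^ j) γ δ ε y)))
                  (solve 5 (λ x s p z r → x :- (s :+ p :* r) := con 1ℤ :* ((x :- s) :- p :* z) :+ p :* (z :- r)) refl
                    x (α + β * (ϖ^ i * w)) (ϖ^ j) z (γ + δ * y + ε * (y * y))))
              where
              r : Fin 4 → ∃ R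
              r 0F = α + ϖ^ j * γ , 𝔬⊆R (𝔬-+ 𝔬α (𝔬-* (𝔬-ϖ^ j) 𝔬γ))
              r 1F = β , 𝔬⊆R 𝔬β
              r 2F = δ , 𝔬⊆R 𝔬δ
              r 3F = ε , 𝔬⊆R 𝔬ε

    idealOf : Ideal
    idealOf = record
      { ideal             = J
      ; isSubmodule       = record
        { resp      = λ x≈z Jx → into (L.resp x≈z (out Jx))
        ; 0ᴹ-closed = into (L.V-⊆ V-0#)
        ; +ᴹ-closed = λ Jx Jz → into (L.+-closed (out Jx) (out Jz))
        ; *ₗ-closed = λ r Jx → into (lattice-stable iy a f C (R⊆L (proj₂ r)) (out Jx))
        }
      ; finitelyGenerated = 4 , generator , (λ t → into (generator∈ t)) , λ x Jx → generated (out Jx)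
      ; nonzero           = 1# , into L.1-closed , 1≉0
      }

    idealOf-⊆ : ideal idealOf ⊆ lattice iy a f C
    idealOf-⊆ = out

    idealOf-⊇ : lattice iy a f C ⊆ ideal idealOf
    idealOf-⊇ = into

  opaque
    -- Both lattices contain 1 and lie in O: t = t · 1 is integral, and 1 = t z with z integral, so
    -- the scalar is a unit.
    idealOf-injective : ∀ C C′ → idealOf C ~ idealOf C′ → C ≡ C′
    idealOf-injective C C′ (t , t≉0 , J′⊆tJ , tJ⊆J′) = lattice-injective iy a f C C′ (homothety (J′⊆tJ (idealOf-⊇ C′ L′.1-closed)))
      where
      module L  = IsLattice (lattice-isLattice iy a f C)
      module L′ = IsLattice (lattice-isLattice iy a f C′)
      homothety : (∃[ z ] z ∈ ideal (idealOf C) × 1# ≈ t * z) → lattice iy a f C ≃ lattice iy a f C′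
      homothety (z , Jz , 1≈tz) = record
        { scalar   = t
        ; scalar⁻¹ = z
        ; unit     = U-factor (L′.integral (idealOf-⊆ C′ (tJ⊆J′ (1# , idealOf-⊇ C L.1-closed , sym (*-identityʳ t)))))
                       (L.integral (idealOf-⊆ C Jz)) (U-resp 1≈tz U-1#)
        ; inverse  = sym 1≈tz
        ; to       = λ {x} Lx → idealOf-⊆ C′ (tJ⊆J′ (x , idealOf-⊇ C Lx , refl))
        ; from     = λ {x} L′x → divide (J′⊆tJ (idealOf-⊇ C′ L′x))
        }
        where
        divide : ∀ {x} → (∃[ u ] u ∈ ideal (idealOf C) × x ≈ t * u) → lattice iy a f C (z * x)
        divide {x} (u , Ju , x≈) = L.resp (linear₂ (- z) u x≈ 1≈tz
          (solve 4 (λ u z x t → u :- z :* x := (:- z) :* (x :- t :* u) :+ u :* (con 1ℤ :- t :* z)) refl u z x t)) (idealOf-⊆ C Ju)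

  module _ (I : Ideal) where
    private
      open FractionalIdeal I using (isSubmodule; finitelyGenerated; nonzero)
      module I = IsSubmodule isSubmodule

      size : ℕ
      size = proj₁ finitelyGenerated
      h : Fin size → Carrier
      h = proj₁ (proj₂ finitelyGenerated)
      h∈I : ∀ t → h t ∈ ideal I
      h∈I = proj₁ (proj₂ (proj₂ finitelyGenerated))
      combination : ∀ {x} → x ∈ ideal I → Σ[ r ∈ (Fin size → ∃ R) ] x ≈ sum (λ t → proj₁ (r t) * h t)
      combination {x} = proj₂ (proj₂ (proj₂ finitelyGenerated)) x

      I-* : ∀ {r x} → R r → x ∈ ideal I → r * x ∈ ideal I
      I-* {r} Rr = I.*ₗ-closed (r , Rr)

      -- Dividing I by such a generator gives a module that contains 1 and, because R ⊆ O, lies in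
      -- O. The minimum is taken over the generators, where it can be computed.
      Pivot : Set ℓ₂
      Pivot = Σ[ t ∈ Fin size ] ¬ h t ≈ 0# × (∀ s → v (h t) ≤⁺ v (h s))

      opaque
        nonzero-generator : ∃[ t ] ¬ h t ≈ 0#
        nonzero-generator = cases (Fin.any? (λ t → ¬? (≈0? (h t))))
          where
          cases : Dec (∃[ t ] ¬ h t ≈ 0#) → ∃[ t ] ¬ h t ≈ 0#
          cases (yes found) = found
          cases (no none) = contradiction (zero-sum (combination (proj₁ (proj₂ nonzero)))) (proj₂ (proj₂ nonzero))
            where
            zero-sum : Σ[ r ∈ (Fin size → ∃ R) ] proj₁ nonzero ≈ sum (λ t → proj₁ (r t) * h t) → proj₁ nonzero ≈ 0#
            zero-sum (r , x≈) = trans x≈ (sum-∈ {N = λ x → Lift (c₂ ⊔ ℓ₂) (x ≈ 0#)} (lift refl)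
              (λ (lift x≈0) (lift z≈0) → lift (trans (+-cong x≈0 z≈0) (+-identityˡ 0#)))
              (λ t → lift (trans (*-congˡ (decidable-stable (≈0? (h t)) (λ ≉0 → none (t , ≉0)))) (zeroʳ _))) .lower)

        pivot : Pivot
        pivot = minimal-generator h nonzero-generator
          where
          minimal-generator : ∀ {m} (h : Fin m → Carrier) → (∃[ t ] ¬ h t ≈ 0#) → Σ[ t ∈ Fin m ] ¬ h t ≈ 0# × (∀ s → v (h t) ≤⁺ v (h s))
          minimal-generator {suc m} h (s , hs≉0) = finish (minimal-v h)
            where
            finish : (∃[ t ] ∀ s → v (h t) ≤⁺ v (h s)) → Σ[ t ∈ Fin (suc m) ] ¬ h t ≈ 0# × (∀ s → v (h t) ≤⁺ v (h s))
            finish (t , minimal) = t , v-≤-≉0 (minimal s) hs≉0 , minimal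

      module _ {t u : Carrier} (t∈I : t ∈ ideal I) (tu≈1 : t * u ≈ 1#) (minimal : ∀ s → v t ≤⁺ v (h s)) where
        P : Pred Carrier (c₂ ⊔ ℓ₂ ⊔ p)
        P z = t * z ∈ ideal I

        h′ : Fin size → Carrier
        h′ s = u * h s

        cancel : ∀ x → t * (u * x) ≈ x
        cancel x = linear x tu≈1 (solve 3 (λ t u x → t :* (u :* x) :- x := x :* (t :* u :- con 1ℤ)) refl t u x)

        Vh′ : ∀ s → V 0 (h′ s)
        Vh′ s = V-quotient tu≈1 (minimal s) (V-resp (sym tu≈1) V-1#)

        P-* : ∀ {r z} → R r → P z → P (r * z)
        P-* {r} {z} Rr Pz = I.resp (solve 3 (λ t r z → r :* (t :* z) := t :* (r :* z)) refl t r z) (I-* Rr Pz)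

        P-1 : P 1#
        P-1 = I.resp (sym (*-identityʳ t)) t∈I

        P-R : ∀ {r} → R r → P r
        P-R Rr = I.resp (*-congˡ (*-identityʳ _)) (P-* Rr P-1)

        P-resp : ∀ {x z} → x ≈ z → P x → P z
        P-resp x≈z = I.resp (*-congˡ x≈z)

        P-combination : ∀ {z} → P z → Σ[ r ∈ (Fin size → ∃ R) ] z ≈ sum (λ s → proj₁ (r s) * h′ s)
        P-combination {z} Pz = finish (combination Pz)
          where
          finish : Σ[ r ∈ (Fin size → ∃ R) ] t * z ≈ sum (λ s → proj₁ (r s) * h s) → Σ[ r ∈ (Fin size → ∃ R) ] z ≈ sum (λ s → proj₁ (r s) * h′ s)
          finish (r , tz≈) = r , trans (linear₂ (- z) u tu≈1 tz≈ (solve 4 (λ t u z s → z :- u :* s := (:- z) :* (t :* u :- con 1ℤ) :+ u :* (t :* z :- s)) refl t u z Σrh))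
            (trans (*-distribˡ-sum u (λ s → proj₁ (r s) * h s)) (sum-cong (λ s → u * (proj₁ (r s) * h s)) (λ s → proj₁ (r s) * h′ s) (λ s → solve 3 (λ u r h → u :* (r :* h) := r :* (u :* h)) refl u (proj₁ (r s)) (h s))))
            where
            Σrh : Carrier
            Σrh = sum (λ s → proj₁ (r s) * h s)

        P-isLattice : IsLattice f P
        P-isLattice = record
          { resp     = P-resp
          ; +-closed = λ Px Pz → I.resp (sym (distribˡ _ _ _)) (I.+ᴹ-closed Px Pz)
          ; *-closed = λ 𝔬a → P-* (𝔬⊆R 𝔬a)
          ; 1-closed = P-1
          ; V-⊆      = λ Vx → P-R (Vf⊆R Vx)
          ; integral = λ {z} Pz → integral (P-combination Pz)
          }
          where
          integral : ∀ {z} → Σ[ r ∈ (Fin size → ∃ R) ] z ≈ sum (λ s → proj₁ (r s) * h′ s) → V 0 z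
          integral (r , z≈) = V-resp (sym z≈) (sum-∈ {N = λ x → Lift c₂ (V 0 x)} (lift V-0#) (λ (lift Vx) (lift Vz) → lift (v-+ Vx Vz))
            (λ s → lift (V-* (R-integral (proj₂ (r s))) (Vh′ s))) .lower)

        private
          Y : Carrier
          Y = ϖ^ a * y
          VY : V 0 Y
          VY = V-* (ϖ^-integral a) (proj₁ iy)
          VYh′ : ∀ s → V 0 (Y * h′ s)
          VYh′ s = V-* VY (Vh′ s)
          base-lat : IsLattice f (Lat a f y)
          base-lat = Lat-isLattice (proj₁ iy)
          A-lat : IsLattice f (adjoin (Lat a f y) h′)
          A-lat = adjoin-isLattice h′ base-lat Vh′
          B : Pred Carrier _
          B = adjoin (adjoin (Lat a f y) h′) (λ s → Y * h′ s)
          B-lat : IsLattice f B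
          B-lat = adjoin-isLattice (λ s → Y * h′ s) A-lat VYh′
          module B = IsLattice B-lat

          opaque
            R*h′∈B : ∀ {r} s → R r → B (r * h′ s)
            R*h′∈B {r} s Rr = finish (R⊆L Rr)
              where
              finish : Lat a f y r → B (r * h′ s)
              finish (γ , δ , 𝔬γ , 𝔬δ , Vρ) = B.resp
                (solve 5 (λ r h γ δ Y → (γ :* h :+ δ :* (Y :* h)) :+ (r :- (γ :+ δ :* Y)) :* h := r :* h) refl r (h′ s) γ δ Y)
                (B.+-closed (B.+-closed
                  (B.*-closed 𝔬γ (adjoin-⊆ (λ s → Y * h′ s) A-lat VYh′ (adjoin-∋ h′ base-lat Vh′ s)))
                  (B.*-closed 𝔬δ (adjoin-∋ (λ s → Y * h′ s) A-lat VYh′ s)))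
                  (B.V-⊆ (V-*ʳ Vρ (Vh′ s))))

        -- P is generated over R by 1 and the h′, and R is 𝔬 + 𝔬 Y + ϖᶠ O. So P is obtained from the
        -- decidable lattice Lat a f y by adjoining all h′ and Y h′; the products of the h′ with ϖᶠ
        -- O lie in it already.
        P? : ∀ z → Dec (P z)
        P? z = map′
          (adjoin-least (λ s → Y * h′ s) P-mod
            (adjoin-least h′ P-mod (λ Lx → P-R (L⊆R Lx)) h′∈P)
            (λ s → P-* (L⊆R Lat-generator) (h′∈P s)))
          (λ Pz → generated′ (P-combination Pz))
          (adjoin? (λ s → Y * h′ s) A-lat VYh′ (adjoin? h′ base-lat Vh′ (Lat? a≤f iy)) z)
          where
          P-mod : IsModule P
          P-mod = isLattice⇒isModule P-isLattice
          h′∈P : ∀ s → P (h′ s)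
          h′∈P s = I.resp (sym (cancel (h s))) (h∈I s)
          generated′ : Σ[ r ∈ (Fin size → ∃ R) ] z ≈ sum (λ s → proj₁ (r s) * h′ s) → B z
          generated′ (r , z≈) = B.resp (sym z≈) (sum-∈ {N = B} (B.V-⊆ V-0#) B.+-closed (λ s → R*h′∈B s (proj₂ (r s))))

        class : ∃[ C ] idealOf C ~ I
        class = finish (lattice-complete iy a f P-isLattice P? (λ Lr → P-* (L⊆R Lr)))
          where
          finish : ∃[ C ] P ≃ lattice iy a f C → ∃[ C ] idealOf C ~ I
          finish (C , P≃L) = C , t * scalar⁻¹ , ts≉0 , I⊆ , ⊆I
            where
            open _≃_ P≃L
            ts≉0 : ¬ t * scalar⁻¹ ≈ 0#
            ts≉0 ts≈0 = 1≉0 (begin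
              1#                                     ≈⟨ *-identityˡ 1# ⟨
              1# * 1#                                ≈⟨ *-cong tu≈1 inverse ⟨
              (t * u) * (scalar * scalar⁻¹)          ≈⟨ solve 4 (λ t u s s⁻¹ → (t :* u) :* (s :* s⁻¹) := (t :* s⁻¹) :* (u :* s)) refl t u scalar scalar⁻¹ ⟩
              (t * scalar⁻¹) * (u * scalar)          ≈⟨ *-congʳ ts≈0 ⟩
              0# * (u * scalar)                      ≈⟨ zeroˡ _ ⟩
              0#                                     ∎)
              where open SetoidReasoning setoid
            I⊆ : ideal I ⊆ scale E/F isOrder (t * scalar⁻¹) (ideal (idealOf C))
            I⊆ {x} Ix = scalar * (u * x) , idealOf-⊇ C (to (I.resp (sym (cancel x)) Ix))
              , linear₂ (- (t * u * x)) (- x) inverse tu≈1 (solve 5 (λ x t u s s⁻¹ →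
                  x :- (t :* s⁻¹) :* (s :* (u :* x)) := (:- (t :* u :* x)) :* (s :* s⁻¹ :- con 1ℤ) :+ (:- x) :* (t :* u :- con 1ℤ))
                  refl x t u scalar scalar⁻¹)
            ⊆I : scale E/F isOrder (t * scalar⁻¹) (ideal (idealOf C)) ⊆ ideal I
            ⊆I (z , Jz , x≈) = I.resp (sym (trans x≈ (*-assoc _ _ _))) (from (idealOf-⊆ C Jz))

    idealOf-surjective : ∃[ C ] idealOf C ~ I
    idealOf-surjective = finish pivot
      where
      finish : Pivot → ∃[ C ] idealOf C ~ I
      finish (s , hs≉0 , minimal) = finish′ (invertible hs≉0)
        where
        finish′ : ∃[ u ] h s * u ≈ 1# → ∃[ C ] idealOf C ~ I
        finish′ (u , hu≈1) = class (h∈I s) hu≈1 minimal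

theorem4p6 : {c₁ ℓ₁ c₂ ℓ₂ p : Level}
    (F : LocalField c₁ ℓ₁) (E : LocalField c₂ ℓ₂) (E/F : FiniteExtension F E) →
    FiniteExtension.IsCubic E/F → FiniteExtension.IsUnramified E/F →
    (R : Pred (LocalField.Carrier E) p) (isOrder : IsOrder E/F R) (s f : ℕ) →
    IsS E/F isOrder s → IsConductorExponent E/F isOrder f →
    ∃[ n ] HasCardinality (Cl̄ E/F isOrder) n
    × fromℤ (+ n) ≡ ClassNumberFormula.classNumber (LocalField.q F) {{LocalField.q-nonTrivial F}} s f
theorem4p6 F E E/F cubic unramified R isOrder s f isS conductor =
  Count.total F.q a f
  , record
    { to        = to
    ; cong      = λ { ≡.refl → Setoid.refl (Cl̄ E/F isOrder) {to _} }
    ; bijective = injective , λ I → surjective {I} (idealOf-surjective I)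
    }
  , ≡.trans (ClassNumber.total≡classNumber F.q {{LocalField.q-nonTrivial F}} a≤f f≤2a)
      (≡.cong (λ s → ClassNumberFormula.classNumber F.q {{LocalField.q-nonTrivial F}} s f) (≡.sym (length≡ isS)))
  where
  module F = LocalField F
  open Extension E/F cubic unramified using (module Order)
  open Order isOrder {f} conductor using (unramifiedCubic)
  open IdealClasses E/F cubic unramified isOrder {f} conductor
  open Cubic unramifiedCubic using (Code; code-↔)
  module code = Inverse (code-↔ iy a f)

  to : Fin (Count.total F.q a f) → FractionalIdeal E/F isOrder
  to d = idealOf (code.to d)

  injective : ∀ {d d′} → Homothetic E/F isOrder (to d) (to d′) → d ≡ d′
  injective {d} {d′} h = ≡.trans (≡.sym (code.strictlyInverseʳ d))
    (≡.trans (≡.cong code.from (idealOf-injective (code.to d) (code.to d′) h)) (code.strictlyInverseʳ d′))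

  surjective : ∀ {I} → ∃[ C ] Homothetic E/F isOrder (idealOf C) I →
               ∃[ d ] (∀ {d′} → d′ ≡ d → Homothetic E/F isOrder (to d′) I)
  surjective {I} (C , h) = code.from C , λ { ≡.refl →
    ≡.subst (λ C → Homothetic E/F isOrder (idealOf C) I) (≡.sym (code.strictlyInverseˡ C)) h }
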